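{- For every $\delta$ with $0<\delta<1$ there is a constant $\epsilon=\epsilon(\delta)$ with $0<\epsilon<\delta$ such that the following holds. Let $p$ be an odd prime, let $m$ be a positive integer with $m<p^{1-\delta}$, let $k$ be a nonnegative integer and let $b\in \mathbf{F}_p$. Let $N_m^*(k,b)$ be the number of $k$-element subsets $S\subseteq \mathbf{F}_p^*$ such that $\sum_{x\in S}x^m=b$. Then $$\left| N_m^*(k,b)-p^{ -1}{p-1 \choose k} \right|\leq {p^{1-\epsilon}+mk-m \choose k}.$$
   Context: $\mathbf{F}_p$ is the field with $p$ elements and $\mathbf{F}_p^*=\mathbf{F}_p\setminus\{0\}$. The empty sum is $0$. For real $x$ and integer $k\ge 0$, $(x)_0=1$, $(x)_k=x(x-1)\cdots(x-k+1)$, and ${x\choose k}=(x)_k/k!$ (so the binomial coefficient is defined for non-integer upper argument). -}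

module Defs where

open import Data.Nat as ℕ using (ℕ; zero; suc; _+_; _*_; _∸_; _^_; _%_)
open import Data.Integer as ℤ using (ℤ; +_)
open import Data.Rational as ℚ using (ℚ; ↥_; ↧ₙ_; _/_; 0ℚ; 1ℚ)
open import Data.Fin using (Fin; toℕ)
open import Data.Fin.Subset using (Subset; Side; inside; outside; ∣_∣)
open import Data.Vec using ([]; _∷_)
open import Data.List using (List; []; _∷_; map; _++_; length; filterᵇ)
open import Data.Bool using (Bool; _∧_)
open import Data.Nat.Combinatorics using (_C_)
open import Data.Nat.Base using (_≡ᵇ_; _!)

subsets : (n : ℕ) → List (Subset n)
subsets zero    = [] ∷ []
subsets (suc n) = map (inside ∷_) (subsets n) ++ map (outside ∷_) (subsets n)

sumOver : ∀ {n} → (Fin n → ℕ) → Subset n → ℕ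
sumOver f []             = 0
sumOver f (inside  ∷ s)  = f Fin.zero + sumOver (λ i → f (Fin.suc i)) s
  where import Data.Fin as Fin
sumOver f (outside ∷ s)  = sumOver (λ i → f (Fin.suc i)) s
  where import Data.Fin as Fin

-- reduction mod p (as a total function; only used for primes p)
modℕ : ℕ → ℕ → ℕ
modℕ a zero    = a
modℕ a (suc n) = a % suc n

-- F_p^* = {1, …, p-1}; index i : Fin (p ∸ 1) stands for the element toℕ i + 1.
-- A subset S ⊆ F_p^* is a Subset (p ∸ 1).  The sum Σ_{x∈S} x^m is computed in ℕ
-- and reduced mod p, which is the sum in F_p.  b ∈ F_p is given as b : Fin p.
powSumMod : (p m : ℕ) → Subset (p ∸ 1) → ℕ
powSumMod p m S = modℕ (sumOver (λ i → suc (toℕ i) ^ m) S) p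

Nstar : (p m k : ℕ) → Fin p → ℕ
Nstar p m k b = length (filterᵇ (λ S → (∣ S ∣ ≡ᵇ k) ∧ (powSumMod p m S ≡ᵇ toℕ b)) (subsets (p ∸ 1)))

fromℕ : ℕ → ℚ
fromℕ n = (+ n) / 1

-- q / n for a natural number n (n = 0 never occurs in use)
_÷ℕ_ : ℚ → ℕ → ℚ
q ÷ℕ zero    = 0ℚ
q ÷ℕ (suc n) = q ℚ.* ((+ 1) / suc n)

powℚ : ℚ → ℕ → ℚ
powℚ x zero    = 1ℚ
powℚ x (suc n) = x ℚ.* powℚ x n

falling : ℚ → ℕ → ℚ
falling x zero    = 1ℚ
falling x (suc k) = falling x k ℚ.* (x ℚ.- fromℕ k)

binomℚ : ℚ → ℕ → ℚ
binomℚ x k = falling x k ÷ℕ (k !)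


-- Real powers p^q with rational exponent q > 0, via comparisons.
-- Write q = n/d in lowest terms (d = ↧ₙ q, n = ∣ ↥ q ∣).

-- the (real) inequality  m < p^q   for naturals m, p and rational q > 0
-- (equivalent to m^d < p^n since both sides are nonnegative)
NatLtRpow : ℕ → ℕ → ℚ → Set
NatLtRpow m p q = m ^ (↧ₙ q) ℕ.< p ^ ℤ.∣ ↥ q ∣

-- the (real) inequality  p^q < z  for a natural p, rational q > 0 and rational z
-- (equivalent to 0 < z and p^n < z^d)
RpowLtℚ : ℕ → ℚ → ℚ → Set
RpowLtℚ p q z = (0ℚ ℚ.< z) Data.Product.× (powℚ (fromℕ p) ℤ.∣ ↥ q ∣ ℚ.< powℚ z (↧ₙ q))
  where import Data.Product

-- the real inequality   |a| ≤ (X choose k)   where X = p^q + c  (c rational, q > 0),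
-- for X ≥ k-1 (where x ↦ (x choose k) is nondecreasing and continuous), expressed as:
-- for every rational y > X, |a| ≤ (y choose k).
AbsLeBinomRpow : ℚ → ℕ → ℚ → ℚ → ℕ → Set
AbsLeBinomRpow a p q c k = ∀ (y : ℚ) → RpowLtℚ p q (y ℚ.- c) → ℚ.∣ a ∣ ℚ.≤ binomℚ y k

{-# OPTIONS --safe #-}

-- Write π(c) for the number of solutions of x^m = c with x ≠ 0, and let ε be 1/D with D large in terms of δ.
--
-- Reduction.  The generating function of the k-subsets, acting on functions on F_p by translation, is an
-- elementary symmetric polynomial, and by Newton's identities it is governed by the power sums
-- u ↦ Σ_x u(z - j x^m), which for 0 < j < p are dilates of convolution with π.  If that convolution has norm
-- at most B on functions of mean zero, Newton's recursion bounds the norm of the k-th elementary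
-- symmetric polynomial by (B + k - 1 choose k).  So one needs B < p^(1 - ε): a power saving for the
-- exponential sums over the subgroup H of m-th powers, which has more than p^δ elements up to a constant.
--
-- Power saving.  No characters are used.  Iterate the autocorrelation f ↦ (z ↦ Σ_c f(c) f(c - z)) starting
-- from π.  The ratio of maximum to mass is at least 1/p, so it cannot keep dropping by a factor K = p^(small)
-- and reaches a plateau within boundedly many steps.  At such a plateau the Balog–Szemerédi–Gowers
-- argument gives a large set A all of whose differences are popular; popularity is invariant under H, so
-- after passing to popular differences one finds W with few translates of W covering W + W and ξ W for a
-- positive proportion of ξ ∈ H.  The ξ for which few translates of W cover ξ W are closed under sums and
-- products.  If A is a set of such ξ, then either every element of F_p is a quotient of differences of A,
-- or |v A + w A| = |A|² for suitable v and w built from A; iterating boundedly often the first case occurs,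
-- and then double counting w₁ + ξ w₂ = w₃ + ξ w₄ forces |W| to be nearly p, so that the plateau
-- function is nearly uniform.  Finally, averaging over H turns the L² bound for this H-invariant function
-- into an operator bound, and log-convexity transfers it back to π.

module Submission where

open import Defs
open import Data.Nat using (ℕ; zero; suc; _+_; _∸_; _*_; _^_; _≤_; _<_; z≤n; s≤s; NonZero; >-nonZero; _≡ᵇ_; _!; _≤?_; _<?_)
open import Data.Nat.Primality using (Prime)
open import Data.Nat.Combinatorics using (_C_)
open import Data.Rational using (ℚ; 0ℚ; 1ℚ; _-_) renaming (_<_ to _<ℚ_)
open import Data.Fin using (Fin; toℕ)
open import Data.Product using (∃; ∃₂; _×_; _,_; proj₁; proj₂)
open import Algebra.Bundles using (CommutativeSemiring; CommutativeRing)
open import Algebra.Structures using (IsCommutativeRing)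
import Algebra.Properties.Semiring.Sum as SemiringSum
open import Data.Bool using (Bool; true; false; T; T?; if_then_else_; _∧_)
open import Data.Empty using (⊥; ⊥-elim)
open import Data.Fin.Permutation using (permutation)
open import Data.Fin.Properties using (any?) renaming (_≟_ to _≟ᶠ_)
open import Data.Fin.Subset using (Subset; inside; outside) renaming (∣_∣ to cardˢ)
open import Data.Vec using () renaming (_∷_ to _∷ᵛ_)
open import Data.Integer as ℤ using (ℤ; +_; -[1+_])
import Data.Integer.Properties as ℤₚ
open import Data.List using (List; []; _∷_; _++_; length; map; cartesianProductWith; filterᵇ)
open import Data.List.Membership.Propositional using () renaming (_∈_ to _∈ₗ_)
open import Data.List.Relation.Unary.Any using (here; there)
import Data.Nat.Coprimality
import Data.Nat.DivMod
import Data.Nat.Divisibility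
import Data.Nat.Properties as ℕₚ
open import Data.Nat.Tactic.RingSolver using (solve-∀)
open import Data.Integer.Tactic.RingSolver using () renaming (solve-∀ to solve-∀ᶻ)
import Data.Rational as ℚ
import Data.Rational.Properties as ℚₚ
import Data.Rational.Solver
import Data.Rational.Unnormalised as ℚᵘ
import Data.Rational.Unnormalised.Properties as ℚᵘₚ
open import Data.Sum using (_⊎_; inj₁; inj₂)
open import Data.Unit using (tt)
open import Function using (id; case_of_)
open import Level using (0ℓ)
open import Relation.Binary using (Rel; IsPreorder)
open import Relation.Binary.PropositionalEquality using (_≡_; _≢_; refl; sym; trans; cong; cong₂; subst; subst₂; module ≡-Reasoning)
open import Relation.Nullary using (¬_; Dec; yes; no; does; contradiction)
open import Relation.Nullary.Decidable using (_×-dec_; ¬?)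

-- On functions of mean zero the norm of convolution with π is the largest nontrivial exponential
-- sum over the values x^m; working with that norm keeps every quantity in ℕ, ℤ or ℚ. As p^(1 - ε)
-- is irrational in general, the saving is stated for squared norms raised to a fixed power T, where
-- it is a factor p. The plateau sits at an unknown depth j, and log-convexity needs the power
-- 2^(j+1) to come back to π; since j is bounded in terms of δ, one T serves all j. The number δ
-- enters only through an integer d with m^d < p^(d - 1). The factor K is the integer part of a
-- fixed root of p and must be at least 2, so that its powers swallow all numerical constants. The
-- finitely many p too small for this use the trivial bound: omitting x = 0 leaves p - 1 in place of
-- p, and a high power of the quotient p / (p - 1) exceeds p. Newton's identities dilate by j up to
-- k, which is invertible only for j < p; for k ≥ p there are fewer than k elements to choose from
-- and the error is 0. Finally B + k - 1 ≤ B + mk - m because (m - 1)(k - 1) ≥ 0.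

-- Finite sums and the Cauchy-Schwarz inequality over ℕ and ℤ

module Summation
  (R : CommutativeSemiring 0ℓ 0ℓ)
  (_≼_ : Rel (CommutativeSemiring.Carrier R) 0ℓ)
  (isPreorder : IsPreorder (CommutativeSemiring._≈_ R) _≼_)
  (⊹-mono : ∀ {a b c d} → a ≼ b → c ≼ d → CommutativeSemiring._+_ R a c ≼ CommutativeSemiring._+_ R b d)
  (amgm : ∀ a b → CommutativeSemiring._+_ R (CommutativeSemiring._*_ R a b) (CommutativeSemiring._*_ R a b)
                  ≼ CommutativeSemiring._+_ R (CommutativeSemiring._*_ R a a) (CommutativeSemiring._*_ R b b)) where

  private
    module R = CommutativeSemiring R
  open R using (_≈_; 0#; semiring) renaming (_+_ to _⊹_; _*_ to _·_; Carrier to A)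
  open SemiringSum semiring
  open IsPreorder isPreorder using () renaming (reflexive to ≼-reflexive; trans to ≼-trans)
  open import Algebra.Properties.CommutativeSemigroup R.*-commutativeSemigroup using (interchange)
  import Relation.Binary.Reasoning.Setoid R.setoid as Eq

  private variable n k : ℕ

  opaque
    ∑ : (Fin n → A) → A
    ∑ = sum

    ∑-empty : (f : Fin 0 → A) → ∑ f ≈ 0#
    ∑-empty f = R.refl

    ∑-suc : (f : Fin (suc n) → A) → ∑ f ≈ f Fin.zero ⊹ ∑ (λ x → f (Fin.suc x))
    ∑-suc f = R.refl

    ∑-cong : {f g : Fin n → A} → (∀ x → f x ≈ g x) → ∑ f ≈ ∑ g
    ∑-cong = sum-cong-≋

    ∑-+ : {f g : Fin n → A} → ∑ (λ x → f x ⊹ g x) ≈ ∑ f ⊹ ∑ g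
    ∑-+ {f = f} {g} = ∑-distrib-+ f g

    ∑-swap : {f : Fin n → Fin k → A} → ∑ (λ x → ∑ (f x)) ≈ ∑ (λ y → ∑ (λ x → f x y))
    ∑-swap {f = f} = ∑-comm f

    ∑-*ˡ : ∀ a {f : Fin n → A} → ∑ (λ x → a · f x) ≈ a · ∑ f
    ∑-*ˡ a {f} = R.sym (*-distribˡ-sum a f)

    ∑-*ʳ : ∀ a {f : Fin n → A} → ∑ (λ x → f x · a) ≈ ∑ f · a
    ∑-*ʳ a {f} = R.sym (*-distribʳ-sum a f)

    ∑-reindex : (σ τ : Fin n → Fin n) → (∀ x → σ (τ x) ≡ x) → (∀ x → τ (σ x) ≡ x) →
                {f : Fin n → A} → ∑ (λ x → f (σ x)) ≈ ∑ f
    ∑-reindex σ τ στ τσ {f} = R.sym (sum-permute f (permutation σ τ στ τσ))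

    ∑-mono : {f g : Fin n → A} → (∀ x → f x ≼ g x) → ∑ f ≼ ∑ g
    ∑-mono {n = zero}  e = ≼-reflexive R.refl
    ∑-mono {n = suc n} e = ⊹-mono (e Fin.zero) (∑-mono (λ x → e (Fin.suc x)))

    ∑-zero : ∑ {n} (λ _ → 0#) ≈ 0#
    ∑-zero {n} = sum-replicate-zero n

  ∑-cong₂ : {f g : Fin n → Fin k → A} → (∀ x y → f x y ≈ g x y) → ∑ (λ x → ∑ (f x)) ≈ ∑ (λ x → ∑ (g x))
  ∑-cong₂ e = ∑-cong λ x → ∑-cong (e x)

  ∑-prod : {f : Fin n → A} {g : Fin k → A} → ∑ f · ∑ g ≈ ∑ (λ x → ∑ (λ y → f x · g y))
  ∑-prod {f = f} {g} = R.trans (R.sym (∑-*ʳ (∑ g))) (∑-cong λ x → R.sym (∑-*ˡ (f x)))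

  -- The inequality `amgm` for f x g y and f y g x, summed over all pairs (x, y). Both sides stay
  -- doubled because a semiring offers no halving; each instance removes the factor by its own
  -- order.
  cauchy-schwarz₂ : (f g : Fin n → A) →
    (∑ (λ x → f x · g x) · ∑ (λ x → f x · g x) ⊹ ∑ (λ x → f x · g x) · ∑ (λ x → f x · g x))
      ≼ (∑ (λ x → f x · f x) · ∑ (λ x → g x · g x) ⊹ ∑ (λ x → f x · f x) · ∑ (λ x → g x · g x))
  cauchy-schwarz₂ f g = ≼-trans (≼-reflexive lhs) (≼-trans
      (∑-mono λ x → ∑-mono λ y → ⊹-pair x y) (≼-reflexive rhs))
    where
    fg = ∑ (λ x → f x · g x)
    u : _ → _ → A
    u x y = f x · g y
    cross : ∀ x y → (f x · g x) · (f y · g y) ≈ u x y · u y x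
    cross x y = begin
      (f x · g x) · (f y · g y) ≈⟨ R.*-congˡ (R.*-comm (f y) (g y)) ⟩
      (f x · g x) · (g y · f y) ≈⟨ interchange (f x) (g x) (g y) (f y) ⟩
      (f x · g y) · (g x · f y) ≈⟨ R.*-congˡ (R.*-comm (g x) (f y)) ⟩
      u x y · u y x ∎ where open Eq
    ⊹-pair : ∀ x y → (u x y · u y x ⊹ u x y · u y x) ≼ (u x y · u x y ⊹ u y x · u y x)
    ⊹-pair x y = amgm (u x y) (u y x)
    half : fg · fg ≈ ∑ (λ x → ∑ λ y → u x y · u y x)
    half = R.trans ∑-prod (∑-cong₂ cross)
    lhs : fg · fg ⊹ fg · fg ≈ ∑ (λ x → ∑ λ y → u x y · u y x ⊹ u x y · u y x)
    lhs = begin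
      fg · fg ⊹ fg · fg ≈⟨ R.+-cong half half ⟩
      _ ≈⟨ R.sym ∑-+ ⟩
      ∑ (λ x → ∑ (λ y → u x y · u y x) ⊹ ∑ (λ y → u x y · u y x)) ≈⟨ ∑-cong (λ x → R.sym ∑-+) ⟩
      _ ∎ where open Eq
    ff = ∑ (λ x → f x · f x)
    gg = ∑ (λ x → g x · g x)
    sq : ff · gg ≈ ∑ (λ x → ∑ λ y → u x y · u x y)
    sq = R.trans ∑-prod (∑-cong₂ λ x y → interchange (f x) (f x) (g y) (g y))
    rhs : ∑ (λ x → ∑ λ y → u x y · u x y ⊹ u y x · u y x) ≈ ff · gg ⊹ ff · gg
    rhs = begin
      ∑ (λ x → ∑ λ y → u x y · u x y ⊹ u y x · u y x) ≈⟨ ∑-cong (λ x → ∑-+) ⟩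
      _ ≈⟨ ∑-+ ⟩
      ∑ (λ x → ∑ λ y → u x y · u x y) ⊹ ∑ (λ x → ∑ λ y → u y x · u y x) ≈⟨ R.+-cong (R.sym sq) (R.trans ∑-swap (R.sym sq)) ⟩
      ff · gg ⊹ ff · gg ∎ where open Eq

opaque
  amgm-ℕ : ∀ a b → a * b + a * b ≤ a * a + b * b
  amgm-ℕ a b with ℕₚ.≤-total a b
  ... | inj₁ a≤b = go a (b ∸ a) b (ℕₚ.m+[n∸m]≡n a≤b)
    where
    go : ∀ a d b → a + d ≡ b → a * b + a * b ≤ a * a + b * b
    go a d _ refl = subst (a * (a + d) + a * (a + d) ≤_) (eq a d) (ℕₚ.m≤m+n _ (d * d))
      where eq : ∀ a d → (a * (a + d) + a * (a + d)) + d * d ≡ a * a + (a + d) * (a + d)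
            eq = solve-∀
  ... | inj₂ b≤a = go b (a ∸ b) a (ℕₚ.m+[n∸m]≡n b≤a)
    where
    go : ∀ b d a → b + d ≡ a → a * b + a * b ≤ a * a + b * b
    go b d _ refl = subst ((b + d) * b + (b + d) * b ≤_) (eq b d) (ℕₚ.m≤m+n _ (d * d))
      where eq : ∀ b d → ((b + d) * b + (b + d) * b) + d * d ≡ (b + d) * (b + d) + b * b
            eq = solve-∀

  0≤i*i : ∀ i → ℤ.0ℤ ℤ.≤ i ℤ.* i
  0≤i*i (+ n)    = subst (ℤ.0ℤ ℤ.≤_) (ℤₚ.pos-* n n) (ℤ.+≤+ z≤n)
  0≤i*i -[1+ n ] = ℤ.+≤+ z≤n

  amgm-ℤ : ∀ a b → a ℤ.* b ℤ.+ a ℤ.* b ℤ.≤ a ℤ.* a ℤ.+ b ℤ.* b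
  amgm-ℤ a b = ℤₚ.0≤i-j⇒j≤i (subst (ℤ.0ℤ ℤ.≤_) (eq a b) (0≤i*i (a ℤ.- b)))
    where
    eq : ∀ a b → (a ℤ.- b) ℤ.* (a ℤ.- b) ≡ a ℤ.* a ℤ.+ b ℤ.* b ℤ.- (a ℤ.* b ℤ.+ a ℤ.* b)
    eq = solve-∀ᶻ

open Summation ℕₚ.+-*-commutativeSemiring _≤_ ℕₚ.≤-isPreorder ℕₚ.+-mono-≤ amgm-ℕ public
module ∑ᶻ = Summation (CommutativeRing.commutativeSemiring ℤₚ.+-*-commutativeRing) ℤ._≤_ ℤₚ.≤-isPreorder ℤₚ.+-mono-≤ amgm-ℤ

-- The field with p elements

remainder-unique : ∀ {p r s} j → + r ≡ + s ℤ.+ j ℤ.* + p → r < p → s < p → r ≡ s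
remainder-unique {p} {r} {s} (+ zero) e _ _ = ℤₚ.+-injective (trans e (ℤₚ.+-identityʳ (+ s)))
remainder-unique {p} {r} {s} (+ suc j) e r<p _ = contradiction r<p (ℕₚ.≤⇒≯ (subst (p ≤_) (sym r≡) (ℕₚ.≤-trans (ℕₚ.m≤m+n p (j * p)) (ℕₚ.m≤n+m _ s))))
  where r≡ : r ≡ s + suc j * p
        r≡ = ℤₚ.+-injective (trans e (cong (ℤ._+_ (+ s)) (sym (ℤₚ.pos-* (suc j) p))))
remainder-unique {p} {r} {s} -[1+ j ] e _ s<p = contradiction s<p (ℕₚ.≤⇒≯ (subst (p ≤_) (sym s≡) (ℕₚ.≤-trans (ℕₚ.m≤m+n p (j * p)) (ℕₚ.m≤n+m _ r))))
  where
  move : ∀ s j p → s ≡ (s ℤ.+ (ℤ.- j) ℤ.* p) ℤ.+ j ℤ.* p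
  move = solve-∀ᶻ
  s≡ : s ≡ r + suc j * p
  s≡ = ℤₚ.+-injective (trans (move (+ s) (+ suc j) (+ p)) (cong₂ ℤ._+_ (sym e) (sym (ℤₚ.pos-* (suc j) p))))

module PrimeField (q : ℕ) (prime : Prime (suc q)) where

  open import Data.Integer.DivMod using (_%ℕ_; _/ℕ_; n%ℕd<d; a≡a%ℕn+[a/ℕn]*n)
  open import Data.Nat.Coprimality using (prime⇒coprime; coprime-Bézout; Coprime)
  open import Data.Nat.GCD using (module Bézout)
  import Data.Fin.Properties as Finₚ

  p : ℕ
  p = suc q

  F : Set
  F = Fin p

  infixl 6 _⊕_ _⊖_
  infixl 7 _⊗_
  infix 8 ⊝_

  private
    ⟦_⟧ : F → ℤ
    ⟦ x ⟧ = + toℕ x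

  opaque
    ι : ℤ → F
    ι a = Data.Fin.fromℕ< (n%ℕd<d a p)

    toℕ-ι : ∀ n → toℕ (ι (+ n)) ≡ modℕ n p
    toℕ-ι n = Finₚ.toℕ-fromℕ< _

    ι-cong : ∀ k {a b} → a ≡ b ℤ.+ k ℤ.* + p → ι a ≡ ι b
    ι-cong k {a} {b} e = Finₚ.fromℕ<-cong _ _ (remainder-unique (b/p ℤ.+ k ℤ.- a/p) eq (n%ℕd<d a p) (n%ℕd<d b p)) _ _
      where
      a/p b/p : ℤ
      a/p = a /ℕ p
      b/p = b /ℕ p
      move : ∀ r s x y k p → r ℤ.+ x ℤ.* p ≡ (s ℤ.+ y ℤ.* p) ℤ.+ k ℤ.* p → r ≡ s ℤ.+ (y ℤ.+ k ℤ.- x) ℤ.* p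
      move r s x y k p h = trans (sub r x p) (trans (cong (ℤ._- x ℤ.* p) h) (rearr s x y k p))
        where
        sub : ∀ r x p → r ≡ (r ℤ.+ x ℤ.* p) ℤ.- x ℤ.* p
        sub = solve-∀ᶻ
        rearr : ∀ s x y k p → ((s ℤ.+ y ℤ.* p) ℤ.+ k ℤ.* p) ℤ.- x ℤ.* p ≡ s ℤ.+ (y ℤ.+ k ℤ.- x) ℤ.* p
        rearr = solve-∀ᶻ
      eq : + (a %ℕ p) ≡ + (b %ℕ p) ℤ.+ (b/p ℤ.+ k ℤ.- a/p) ℤ.* + p
      eq = move (+ (a %ℕ p)) (+ (b %ℕ p)) a/p b/p k (+ p)
             (trans (sym (a≡a%ℕn+[a/ℕn]*n a p)) (trans e (cong (ℤ._+ k ℤ.* + p) (a≡a%ℕn+[a/ℕn]*n b p))))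

    ι-toℕ : ∀ x → ι (+ toℕ x) ≡ x
    ι-toℕ x = Finₚ.toℕ-injective (trans (Finₚ.toℕ-fromℕ< _) (m<n⇒m%n≡m (Finₚ.toℕ<n x)))
      where open import Data.Nat.DivMod using (m<n⇒m%n≡m)

    private
      toℕ-ι-residue : ∀ a → a ≡ ⟦ ι a ⟧ ℤ.+ (a /ℕ p) ℤ.* + p
      toℕ-ι-residue a = trans (a≡a%ℕn+[a/ℕn]*n a p) (cong (λ r → + r ℤ.+ (a /ℕ p) ℤ.* + p) (sym (Finₚ.toℕ-fromℕ< _)))

    _⊕_ _⊗_ : F → F → F
    x ⊕ y = ι (⟦ x ⟧ ℤ.+ ⟦ y ⟧)
    x ⊗ y = ι (⟦ x ⟧ ℤ.* ⟦ y ⟧)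

    ⊝_ : F → F
    ⊝ x = ι (ℤ.- ⟦ x ⟧)

    ι-⊕ : ∀ a b → ι (a ℤ.+ b) ≡ ι a ⊕ ι b
    ι-⊕ a b = ι-cong (k ℤ.+ l) {a ℤ.+ b} {⟦ ι a ⟧ ℤ.+ ⟦ ι b ⟧} (trans (cong₂ ℤ._+_ (toℕ-ι-residue a) (toℕ-ι-residue b)) (eq ⟦ ι a ⟧ ⟦ ι b ⟧ k l (+ p)))
      where
      k : ℤ
      k = a /ℕ p
      l : ℤ
      l = b /ℕ p
      eq : ∀ x y k l p → (x ℤ.+ k ℤ.* p) ℤ.+ (y ℤ.+ l ℤ.* p) ≡ (x ℤ.+ y) ℤ.+ (k ℤ.+ l) ℤ.* p
      eq = solve-∀ᶻ

    ι-⊗ : ∀ a b → ι (a ℤ.* b) ≡ ι a ⊗ ι b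
    ι-⊗ a b = ι-cong (⟦ ι a ⟧ ℤ.* l ℤ.+ ⟦ ι b ⟧ ℤ.* k ℤ.+ k ℤ.* l ℤ.* + p) {a ℤ.* b} {⟦ ι a ⟧ ℤ.* ⟦ ι b ⟧}
                (trans (cong₂ ℤ._*_ (toℕ-ι-residue a) (toℕ-ι-residue b)) (eq ⟦ ι a ⟧ ⟦ ι b ⟧ k l (+ p)))
      where
      k : ℤ
      k = a /ℕ p
      l : ℤ
      l = b /ℕ p
      eq : ∀ x y k l p → (x ℤ.+ k ℤ.* p) ℤ.* (y ℤ.+ l ℤ.* p) ≡ (x ℤ.* y) ℤ.+ (x ℤ.* l ℤ.+ y ℤ.* k ℤ.+ k ℤ.* l ℤ.* p) ℤ.* p
      eq = solve-∀ᶻ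

    ι-⊝ : ∀ a → ι (ℤ.- a) ≡ ⊝ ι a
    ι-⊝ a = ι-cong (ℤ.- k) {ℤ.- a} {ℤ.- ⟦ ι a ⟧} (trans (cong ℤ.-_ (toℕ-ι-residue a)) (eq ⟦ ι a ⟧ k (+ p)))
      where
      k : ℤ
      k = a /ℕ p
      eq : ∀ x k p → ℤ.- (x ℤ.+ k ℤ.* p) ≡ (ℤ.- x) ℤ.+ (ℤ.- k) ℤ.* p
      eq = solve-∀ᶻ

  0ᶠ 1ᶠ : F
  0ᶠ = ι ℤ.0ℤ
  1ᶠ = ι ℤ.1ℤ

  _⊖_ : F → F → F
  x ⊖ y = x ⊕ ⊝ y

  -- Every ring law is the image of the same law of ℤ under the surjection ι.
  private
    lift-⊕ : ∀ a y → ι (a ℤ.+ ⟦ y ⟧) ≡ ι a ⊕ y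
    lift-⊕ a y = trans (ι-⊕ a ⟦ y ⟧) (cong (ι a ⊕_) (ι-toℕ y))
    lift-⊗ : ∀ a y → ι (a ℤ.* ⟦ y ⟧) ≡ ι a ⊗ y
    lift-⊗ a y = trans (ι-⊗ a ⟦ y ⟧) (cong (ι a ⊗_) (ι-toℕ y))
    lift-⊕₂ : ∀ x y → ι (⟦ x ⟧ ℤ.+ ⟦ y ⟧) ≡ x ⊕ y
    lift-⊕₂ x y = trans (lift-⊕ ⟦ x ⟧ y) (cong (_⊕ y) (ι-toℕ x))
    lift-⊗₂ : ∀ x y → ι (⟦ x ⟧ ℤ.* ⟦ y ⟧) ≡ x ⊗ y
    lift-⊗₂ x y = trans (lift-⊗ ⟦ x ⟧ y) (cong (_⊗ y) (ι-toℕ x))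

    ⊕-comm : ∀ x y → x ⊕ y ≡ y ⊕ x
    ⊕-comm x y = trans (sym (lift-⊕₂ x y)) (trans (cong ι (ℤₚ.+-comm ⟦ x ⟧ ⟦ y ⟧)) (lift-⊕₂ y x))
    ⊗-comm : ∀ x y → x ⊗ y ≡ y ⊗ x
    ⊗-comm x y = trans (sym (lift-⊗₂ x y)) (trans (cong ι (ℤₚ.*-comm ⟦ x ⟧ ⟦ y ⟧)) (lift-⊗₂ y x))
    ⊕-assoc : ∀ x y z → (x ⊕ y) ⊕ z ≡ x ⊕ (y ⊕ z)
    ⊕-assoc x y z = begin
      (x ⊕ y) ⊕ z ≡⟨ cong (_⊕ z) (lift-⊕₂ x y) ⟨
      ι (⟦ x ⟧ ℤ.+ ⟦ y ⟧) ⊕ z ≡⟨ lift-⊕ _ z ⟨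
      ι (⟦ x ⟧ ℤ.+ ⟦ y ⟧ ℤ.+ ⟦ z ⟧) ≡⟨ cong ι (ℤₚ.+-assoc ⟦ x ⟧ ⟦ y ⟧ ⟦ z ⟧) ⟩
      ι (⟦ x ⟧ ℤ.+ (⟦ y ⟧ ℤ.+ ⟦ z ⟧)) ≡⟨ ι-⊕ ⟦ x ⟧ _ ⟩
      ι ⟦ x ⟧ ⊕ ι (⟦ y ⟧ ℤ.+ ⟦ z ⟧) ≡⟨ cong₂ _⊕_ (ι-toℕ x) (lift-⊕₂ y z) ⟩
      x ⊕ (y ⊕ z) ∎ where open ≡-Reasoning
    ⊗-assoc : ∀ x y z → (x ⊗ y) ⊗ z ≡ x ⊗ (y ⊗ z)
    ⊗-assoc x y z = begin
      (x ⊗ y) ⊗ z ≡⟨ cong (_⊗ z) (lift-⊗₂ x y) ⟨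
      ι (⟦ x ⟧ ℤ.* ⟦ y ⟧) ⊗ z ≡⟨ lift-⊗ _ z ⟨
      ι (⟦ x ⟧ ℤ.* ⟦ y ⟧ ℤ.* ⟦ z ⟧) ≡⟨ cong ι (ℤₚ.*-assoc ⟦ x ⟧ ⟦ y ⟧ ⟦ z ⟧) ⟩
      ι (⟦ x ⟧ ℤ.* (⟦ y ⟧ ℤ.* ⟦ z ⟧)) ≡⟨ ι-⊗ ⟦ x ⟧ _ ⟩
      ι ⟦ x ⟧ ⊗ ι (⟦ y ⟧ ℤ.* ⟦ z ⟧) ≡⟨ cong₂ _⊗_ (ι-toℕ x) (lift-⊗₂ y z) ⟩
      x ⊗ (y ⊗ z) ∎ where open ≡-Reasoning
    ⊗-distribʳ : ∀ z x y → (x ⊕ y) ⊗ z ≡ x ⊗ z ⊕ y ⊗ z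
    ⊗-distribʳ z x y = begin
      (x ⊕ y) ⊗ z ≡⟨ cong (_⊗ z) (lift-⊕₂ x y) ⟨
      ι (⟦ x ⟧ ℤ.+ ⟦ y ⟧) ⊗ z ≡⟨ lift-⊗ _ z ⟨
      ι ((⟦ x ⟧ ℤ.+ ⟦ y ⟧) ℤ.* ⟦ z ⟧) ≡⟨ cong ι (ℤₚ.*-distribʳ-+ ⟦ z ⟧ ⟦ x ⟧ ⟦ y ⟧) ⟩
      ι (⟦ x ⟧ ℤ.* ⟦ z ⟧ ℤ.+ ⟦ y ⟧ ℤ.* ⟦ z ⟧) ≡⟨ ι-⊕ _ _ ⟩
      ι (⟦ x ⟧ ℤ.* ⟦ z ⟧) ⊕ ι (⟦ y ⟧ ℤ.* ⟦ z ⟧) ≡⟨ cong₂ _⊕_ (lift-⊗₂ x z) (lift-⊗₂ y z) ⟩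
      x ⊗ z ⊕ y ⊗ z ∎ where open ≡-Reasoning
    ⊕-identityˡ : ∀ x → 0ᶠ ⊕ x ≡ x
    ⊕-identityˡ x = trans (sym (lift-⊕ ℤ.0ℤ x)) (trans (cong ι (ℤₚ.+-identityˡ ⟦ x ⟧)) (ι-toℕ x))
    ⊗-identityˡ : ∀ x → 1ᶠ ⊗ x ≡ x
    ⊗-identityˡ x = trans (sym (lift-⊗ ℤ.1ℤ x)) (trans (cong ι (ℤₚ.*-identityˡ ⟦ x ⟧)) (ι-toℕ x))
    ⊝-inverseˡ : ∀ x → ⊝ x ⊕ x ≡ 0ᶠ
    ⊝-inverseˡ x = begin
      ⊝ x ⊕ x ≡⟨ cong (λ y → ⊝ y ⊕ x) (ι-toℕ x) ⟨
      ⊝ ι ⟦ x ⟧ ⊕ x ≡⟨ cong (_⊕ x) (ι-⊝ ⟦ x ⟧) ⟨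
      ι (ℤ.- ⟦ x ⟧) ⊕ x ≡⟨ lift-⊕ _ x ⟨
      ι (ℤ.- ⟦ x ⟧ ℤ.+ ⟦ x ⟧) ≡⟨ cong ι (ℤₚ.+-inverseˡ ⟦ x ⟧) ⟩
      0ᶠ ∎ where open ≡-Reasoning

  isCommutativeRing : IsCommutativeRing _≡_ _⊕_ _⊗_ ⊝_ 0ᶠ 1ᶠ
  isCommutativeRing = record
    { isRing = record
      { +-isAbelianGroup = record
        { isGroup = record
          { isMonoid = record
            { isSemigroup = record
              { isMagma = record { isEquivalence = Relation.Binary.PropositionalEquality.isEquivalence ; ∙-cong = cong₂ _⊕_ }
              ; assoc = ⊕-assoc }
            ; identity = ⊕-identityˡ , λ x → trans (⊕-comm x 0ᶠ) (⊕-identityˡ x) }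
          ; inverse = ⊝-inverseˡ , λ x → trans (⊕-comm x (⊝ x)) (⊝-inverseˡ x)
          ; ⁻¹-cong = cong ⊝_ }
        ; comm = ⊕-comm }
      ; *-cong = cong₂ _⊗_
      ; *-assoc = ⊗-assoc
      ; *-identity = ⊗-identityˡ , λ x → trans (⊗-comm x 1ᶠ) (⊗-identityˡ x)
      ; distrib = (λ z x y → trans (⊗-comm z (x ⊕ y)) (trans (⊗-distribʳ z x y) (cong₂ _⊕_ (⊗-comm x z) (⊗-comm y z)))) , ⊗-distribʳ }
    ; *-comm = ⊗-comm }

  commutativeRing : CommutativeRing 0ℓ 0ℓ
  commutativeRing = record { isCommutativeRing = isCommutativeRing }

  import Algebra.Solver.Ring as RingSolver
  import Algebra.Solver.Ring.AlmostCommutativeRing as ACR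
  open import Data.Maybe using (Maybe; just; nothing)

  private
    ι-≟ : ∀ a b → Maybe (ι a ≡ ι b)
    ι-≟ a b with a ℤ.≟ b
    ... | yes e = just (cong ι e)
    ... | no _  = nothing

    ι-morphism : CommutativeRing.rawRing ℤₚ.+-*-commutativeRing ACR.-Raw-AlmostCommutative⟶ ACR.fromCommutativeRing commutativeRing
    ι-morphism = record { ⟦_⟧ = ι ; +-homo = ι-⊕ ; *-homo = ι-⊗ ; -‿homo = ι-⊝ ; 0-homo = refl ; 1-homo = refl }

  module Solver = RingSolver
    (CommutativeRing.rawRing ℤₚ.+-*-commutativeRing) (ACR.fromCommutativeRing commutativeRing) ι-morphism ι-≟
  open Solver public using (solve; _:=_; con; _:+_; _:*_; _:-_; :-_)

  open IsCommutativeRing isCommutativeRing public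
    using (zeroˡ; zeroʳ)
    renaming (+-identityˡ to ⊕-idˡ; +-identityʳ to ⊕-idʳ; *-identityˡ to ⊗-idˡ)

  0ᶠ≡zero : 0ᶠ ≡ Fin.zero
  0ᶠ≡zero = ι-toℕ Fin.zero

  0ᶠ≢1ᶠ : 0ᶠ ≢ 1ᶠ
  0ᶠ≢1ᶠ e = 0≢1-mod prime (trans (trans (sym (toℕ-ι 0)) (cong toℕ e)) (toℕ-ι 1))
    where
    0≢1-mod : ∀ {n} → Prime n → modℕ 0 n ≢ modℕ 1 n
    0≢1-mod {zero} _ ()
    0≢1-mod {suc zero} pr = ⊥-elim (Data.Nat.Primality.¬prime[1] pr)
    0≢1-mod {suc (suc n)} _ ()

  private
    coprime-p : ∀ x → x ≢ 0ᶠ → Coprime p (toℕ x)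
    coprime-p Fin.zero x≢0 = ⊥-elim (x≢0 (sym 0ᶠ≡zero))
    coprime-p x@(Fin.suc _) _ = prime⇒coprime prime (Finₚ.toℕ<n x)

    inverse : ∀ x → x ≢ 0ᶠ → ∃ λ y → y ⊗ x ≡ 1ᶠ
    inverse x x≢0 with coprime-Bézout (coprime-p x x≢0)
    ... | Bézout.+- a b e = ι (ℤ.- + b) , trans (sym (lift-⊗ _ x)) (ι-cong (ℤ.- + a) eq)
      where
      e′ : + 1 ℤ.+ + b ℤ.* ⟦ x ⟧ ≡ + a ℤ.* + p
      e′ = trans (cong (ℤ._+_ (+ 1)) (sym (ℤₚ.pos-* b (toℕ x)))) (trans (cong +_ e) (ℤₚ.pos-* a p))
      move : ∀ b x → ℤ.- b ℤ.* x ≡ + 1 ℤ.+ (ℤ.- (+ 1 ℤ.+ b ℤ.* x))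
      move = solve-∀ᶻ
      eq : ℤ.- + b ℤ.* ⟦ x ⟧ ≡ + 1 ℤ.+ (ℤ.- + a) ℤ.* + p
      eq = trans (move (+ b) ⟦ x ⟧) (cong (ℤ._+_ (+ 1)) (trans (cong ℤ.-_ e′) (ℤₚ.neg-distribˡ-* (+ a) (+ p))))
    ... | Bézout.-+ a b e = ι (+ b) , trans (sym (lift-⊗ _ x)) (ι-cong (+ a) eq)
      where
      eq : + b ℤ.* ⟦ x ⟧ ≡ + 1 ℤ.+ + a ℤ.* + p
      eq = trans (sym (ℤₚ.pos-* b (toℕ x))) (trans (cong +_ (sym e)) (cong (ℤ._+_ (+ 1)) (ℤₚ.pos-* a p)))

  -- 0 ⁻¹ = 0.
  infix 9 _⁻¹
  opaque
    _⁻¹ : F → F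
    x ⁻¹ with x ≟ᶠ 0ᶠ
    ... | yes _ = 0ᶠ
    ... | no x≢0 = proj₁ (inverse x x≢0)

    ⁻¹-inverseˡ : ∀ {x} → x ≢ 0ᶠ → x ⁻¹ ⊗ x ≡ 1ᶠ
    ⁻¹-inverseˡ {x} x≢0 with x ≟ᶠ 0ᶠ
    ... | yes x≡0 = ⊥-elim (x≢0 x≡0)
    ... | no x≢0′ = proj₂ (inverse x x≢0′)

  ⁻¹-cancelˡ : ∀ {x} → x ≢ 0ᶠ → ∀ y → x ⁻¹ ⊗ (x ⊗ y) ≡ y
  ⁻¹-cancelˡ {x} x≢0 y = trans (sym (⊗-assoc (x ⁻¹) x y)) (trans (cong (_⊗ y) (⁻¹-inverseˡ x≢0)) (⊗-idˡ y))

  ⁻¹-cancelʳ : ∀ {x} → x ≢ 0ᶠ → ∀ y → x ⊗ (x ⁻¹ ⊗ y) ≡ y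
  ⁻¹-cancelʳ {x} x≢0 y = trans (solve 3 (λ a b c → a :* (b :* c) := b :* (a :* c)) refl x (x ⁻¹) y) (⁻¹-cancelˡ x≢0 y)

  ⊗-cancelˡ : ∀ {x y z} → x ≢ 0ᶠ → x ⊗ y ≡ x ⊗ z → y ≡ z
  ⊗-cancelˡ {x} {y} {z} x≢0 e = trans (sym (⁻¹-cancelˡ x≢0 y)) (trans (cong (x ⁻¹ ⊗_) e) (⁻¹-cancelˡ x≢0 z))

  ⊗-nonzero : ∀ {x y} → x ≢ 0ᶠ → y ≢ 0ᶠ → x ⊗ y ≢ 0ᶠ
  ⊗-nonzero {x} x≢0 y≢0 e = y≢0 (⊗-cancelˡ x≢0 (trans e (sym (zeroʳ x))))

  ⁻¹-nonzero : ∀ {x} → x ≢ 0ᶠ → x ⁻¹ ≢ 0ᶠ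
  ⁻¹-nonzero {x} x≢0 e = 0ᶠ≢1ᶠ (trans (sym (zeroˡ x)) (trans (cong (_⊗ x) (sym e)) (⁻¹-inverseˡ x≢0)))

  ⊖≡0⇒≡ : ∀ {x y} → x ⊖ y ≡ 0ᶠ → x ≡ y
  ⊖≡0⇒≡ {x} {y} e = trans (solve 2 (λ x y → x := (x :- y) :+ y) refl x y) (trans (cong (_⊕ y) e) (⊕-idˡ y))

  -- Adding 1 repeatedly to 0 reaches every element, so a property that holds at 0 but not
  -- everywhere must be lost at some single step. The sum-product argument needs exactly such a
  -- step.
  successor-walk : {P : F → Set} → (∀ x → Dec (P x)) → P 0ᶠ →
                   (∀ x → P x) ⊎ (∃ λ x → P x × ¬ P (x ⊕ 1ᶠ))
  successor-walk {P} P? P0 with any? (λ x → P? x ×-dec ¬? (P? (x ⊕ 1ᶠ)))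
  ... | yes w = inj₂ w
  ... | no none = inj₁ λ x → subst P (ι-toℕ x) (walk (toℕ x))
    where
    walk : ∀ n → P (ι (+ n))
    walk zero = P0
    walk (suc n) with P? (ι (+ n) ⊕ 1ᶠ)
    ... | yes h = subst P (trans (sym (ι-⊕ (+ n) ℤ.1ℤ)) (cong (λ k → ι (+ k)) (ℕₚ.+-comm n 1))) h
    ... | no h = ⊥-elim (none (ι (+ n) , walk n , h))

-- Inequalities and pigeonholes for sums of natural numbers

does-intro : ∀ {P : Set} (d : Dec P) → P → T (does d)
does-intro (yes _) _ = tt
does-intro (no ¬p) p = ¬p p

does-elim : ∀ {P : Set} (d : Dec P) → T (does d) → P
does-elim (yes p) _ = p

halve-≤ : ∀ {a b} → a + a ≤ b + b → a ≤ b
halve-≤ {a} {b} h with a ≤? b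
... | yes a≤b = a≤b
... | no a≰b = contradiction h (ℕₚ.<⇒≱ (ℕₚ.+-mono-< (ℕₚ.≰⇒> a≰b) (ℕₚ.≰⇒> a≰b)))

opaque
  cauchy-schwarz : ∀ {n} (f g : Fin n → ℕ) →
    ∑ (λ x → f x * g x) * ∑ (λ x → f x * g x) ≤ ∑ (λ x → f x * f x) * ∑ (λ x → g x * g x)
  cauchy-schwarz f g = halve-≤ (cauchy-schwarz₂ f g)

∑-const : ∀ n c → ∑ {n} (λ _ → c) ≡ n * c
∑-const zero c = ∑-empty _
∑-const (suc n) c = trans (∑-suc _) (cong (_+_ c) (∑-const n c))

term≤∑ : ∀ {n} (f : Fin n → ℕ) (x : Fin n) → f x ≤ ∑ f
term≤∑ f Fin.zero = subst (f Fin.zero ≤_) (sym (∑-suc f)) (ℕₚ.m≤m+n _ _)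
term≤∑ f (Fin.suc x) = subst (f (Fin.suc x) ≤_) (sym (∑-suc f)) (ℕₚ.≤-trans (term≤∑ (λ y → f (Fin.suc y)) x) (ℕₚ.m≤n+m _ _))

opaque
  ∑-<⇒∃ : ∀ {n} (f g : Fin n → ℕ) → ∑ f < ∑ g → ∃ λ x → f x < g x
  ∑-<⇒∃ f g h with any? (λ x → f x <? g x)
  ... | yes w = w
  ... | no none = contradiction h (ℕₚ.≤⇒≯ (∑-mono λ x → ℕₚ.≮⇒≥ λ lt → none (x , lt)))

opaque
  ∑-pos⇒∃ : ∀ {n} (f : Fin n → ℕ) → 0 < ∑ f → ∃ λ x → 0 < f x
  ∑-pos⇒∃ {n} f h = ∑-<⇒∃ (λ _ → 0) f (subst (_< ∑ f) (sym (∑-zero {n = n})) h)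

∑≤const : ∀ {n} (f : Fin n → ℕ) {c : ℕ} → (∀ x → f x ≤ c) → ∑ f ≤ n * c
∑≤const {n} f {c} h = subst (∑ f ≤_) (∑-const n c) (∑-mono h)

opaque
  ∑-unique : ∀ {n} (f : Fin n → ℕ) → (∀ x → f x ≤ 1) → (∀ x y → 0 < f x → 0 < f y → x ≡ y) → ∑ f ≤ 1
  ∑-unique {zero} f _ _ = subst (_≤ 1) (sym (∑-empty f)) z≤n
  ∑-unique {suc n} f ≤1 uniq = subst (_≤ 1) (sym (∑-suc f)) (split (f Fin.zero) refl)
    where
    tail : Fin n → ℕ
    tail = λ y → f (Fin.suc y)
    split : ∀ a → f Fin.zero ≡ a → f Fin.zero + ∑ tail ≤ 1
    split zero e = subst (λ a → a + ∑ tail ≤ 1) (sym e)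
      (∑-unique tail (λ x → ≤1 _) λ x y hx hy → Data.Fin.Properties.suc-injective (uniq _ _ hx hy))
    split (suc a) e = ℕₚ.≤-trans (ℕₚ.+-mono-≤ (≤1 Fin.zero) (ℕₚ.≤-reflexive tail≡0)) ℕₚ.≤-refl
      where
      tail≡0 : ∑ tail ≡ 0
      tail≡0 = trans (∑-cong λ y → ℕₚ.n≤0⇒n≡0 (ℕₚ.≮⇒≥ λ pos → case uniq Fin.zero (Fin.suc y) (subst (0 <_) (sym e) (s≤s z≤n)) pos of λ ()))
                 (∑-zero {n = n})

-- Subsets of the field and coverings by translates

module Counting (q : ℕ) (prime : Prime (suc q)) where

  open PrimeField q prime public

  module Reindex
    (R : CommutativeSemiring 0ℓ 0ℓ)
    (S : (F → CommutativeSemiring.Carrier R) → CommutativeSemiring.Carrier R)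
    (S-reindex : (σ τ : F → F) → (∀ x → σ (τ x) ≡ x) → (∀ x → τ (σ x) ≡ x) → {f : F → CommutativeSemiring.Carrier R} →
                 CommutativeSemiring._≈_ R (S (λ x → f (σ x))) (S f)) where

    open CommutativeSemiring R using (_≈_) renaming (Carrier to A)

    ∑-⊕ : ∀ a (f : F → A) → S (λ x → f (x ⊕ a)) ≈ S f
    ∑-⊕ a f = S-reindex (_⊕ a) (_⊖ a)
      (solve 2 (λ a x → x :- a :+ a := x) refl a) (solve 2 (λ a x → x :+ a :- a := x) refl a)

    ∑-⊖ : ∀ a (f : F → A) → S (λ x → f (x ⊖ a)) ≈ S f
    ∑-⊖ a f = S-reindex (_⊖ a) (_⊕ a)
      (solve 2 (λ a x → x :+ a :- a := x) refl a) (solve 2 (λ a x → x :- a :+ a := x) refl a)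

    ∑-reflect : ∀ a (f : F → A) → S (λ x → f (a ⊖ x)) ≈ S f
    ∑-reflect a f = S-reindex (a ⊖_) (a ⊖_) inv inv
      where inv = solve 2 (λ a x → a :- (a :- x) := x) refl a

    ∑-⊗ : ∀ {a} → a ≢ 0ᶠ → (f : F → A) → S (λ x → f (a ⊗ x)) ≈ S f
    ∑-⊗ {a} a≢0 f = S-reindex (a ⊗_) (a ⁻¹ ⊗_) (⁻¹-cancelʳ a≢0) (⁻¹-cancelˡ a≢0)

  open Reindex ℕₚ.+-*-commutativeSemiring ∑ (λ σ τ → ∑-reindex σ τ) public
  module Reindexᶻ = Reindex (CommutativeRing.commutativeSemiring ℤₚ.+-*-commutativeRing) ∑ᶻ.∑ (λ σ τ → ∑ᶻ.∑-reindex σ τ)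

  FSet : Set
  FSet = F → Bool

  infix 4 _∈_ _∈?_
  _∈_ : F → FSet → Set
  x ∈ A = T (A x)

  _∈?_ : ∀ x A → Dec (x ∈ A)
  x ∈? A = T? (A x)

  opaque
    𝟙 : FSet → F → ℕ
    𝟙 A x = if A x then 1 else 0

    𝟙-∈ : ∀ A {x} → x ∈ A → 𝟙 A x ≡ 1
    𝟙-∈ A {x} h with A x
    ... | true = refl

    𝟙-∉ : ∀ A {x} → ¬ x ∈ A → 𝟙 A x ≡ 0
    𝟙-∉ A {x} h with A x
    ... | true = ⊥-elim (h tt)
    ... | false = refl

    𝟙≤1 : ∀ A x → 𝟙 A x ≤ 1
    𝟙≤1 A x with A x
    ... | true = s≤s z≤n
    ... | false = z≤n

    0<𝟙⇒∈ : ∀ A {x} → 0 < 𝟙 A x → x ∈ A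
    0<𝟙⇒∈ A {x} h with A x
    ... | true = tt

    𝟙*-≤ : ∀ A {x a b} → (x ∈ A → a ≤ b) → 𝟙 A x * a ≤ b
    𝟙*-≤ A {x} {a} h with A x
    ... | true = ℕₚ.≤-trans (ℕₚ.≤-reflexive (ℕₚ.*-identityˡ a)) (h tt)
    ... | false = z≤n

    𝟙-mono : ∀ A B {x y} → (x ∈ A → y ∈ B) → 𝟙 A x ≤ 𝟙 B y
    𝟙-mono A B {x} {y} h with A x
    ... | false = z≤n
    ... | true = ℕₚ.≤-reflexive (sym (𝟙-∈ B (h tt)))

    𝟙-idem : ∀ A x → 𝟙 A x * 𝟙 A x ≡ 𝟙 A x
    𝟙-idem A x with A x
    ... | true = refl
    ... | false = refl

  card : FSet → ℕ
  card A = ∑ (𝟙 A)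

  card-mono : ∀ A B → (∀ x → x ∈ A → x ∈ B) → card A ≤ card B
  card-mono A B h = ∑-mono λ x → 𝟙-mono A B (h x)

  opaque
    0<card⇒∃∈ : ∀ A → 0 < card A → ∃ λ x → x ∈ A
    0<card⇒∃∈ A h with ∑-pos⇒∃ (𝟙 A) h
    ... | x , 0<𝟙 = x , 0<𝟙⇒∈ A 0<𝟙

  card≤p : ∀ A → card A ≤ p
  card≤p A = ℕₚ.≤-trans (∑≤const (𝟙 A) (𝟙≤1 A)) (ℕₚ.≤-reflexive (ℕₚ.*-identityʳ p))

  card-unique : ∀ A → (∀ x y → x ∈ A → y ∈ A → x ≡ y) → card A ≤ 1
  card-unique A uniq = ∑-unique (𝟙 A) (𝟙≤1 A) λ x y hx hy → uniq x y (0<𝟙⇒∈ A hx) (0<𝟙⇒∈ A hy)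

  opaque
    2≤card⇒distinct : ∀ A → 2 ≤ card A → ∃₂ λ x y → x ∈ A × y ∈ A × x ≢ y
    2≤card⇒distinct A 2≤A with any? (λ x → any? λ y → (x ∈? A) ×-dec (y ∈? A) ×-dec ¬? (x ≟ᶠ y))
    ... | yes (x , y , w) = x , y , w
    ... | no none = contradiction 2≤A (ℕₚ.<⇒≱ (s≤s (card-unique A λ x y x∈ y∈ → case x ≟ᶠ y of λ
          { (yes e) → e ; (no x≢y) → ⊥-elim (none (x , y , x∈ , y∈ , x≢y)) })))

  opaque
    -- Double counting: a pair (u, v) determines e = u + v, while each e has at least r / k such
    -- pairs. All triangle inequalities of Ruzsa type below are instances of this.
    card-representations : ∀ E U V r k → (∀ e → e ∈ E → r ≤ k * ∑ (λ u → 𝟙 U u * 𝟙 V (e ⊖ u))) →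
                           card E * r ≤ k * (card U * card V)
    card-representations E U V r k h = begin
      card E * r ≡⟨ ∑-*ʳ r ⟨
      ∑ (λ e → 𝟙 E e * r) ≤⟨ ∑-mono (λ e → 𝟙*-≤ E (h e)) ⟩
      ∑ (λ e → k * ∑ λ u → 𝟙 U u * 𝟙 V (e ⊖ u)) ≡⟨ ∑-*ˡ k ⟩
      k * ∑ (λ e → ∑ λ u → 𝟙 U u * 𝟙 V (e ⊖ u)) ≡⟨ cong (k *_) ∑-swap ⟩
      k * ∑ (λ u → ∑ λ e → 𝟙 U u * 𝟙 V (e ⊖ u)) ≡⟨ cong (k *_) (∑-cong λ u → trans (∑-*ˡ (𝟙 U u)) (cong (𝟙 U u *_) (∑-⊖ u (𝟙 V)))) ⟩
      k * ∑ (λ u → 𝟙 U u * card V) ≡⟨ cong (k *_) (∑-*ʳ (card V)) ⟩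
      k * (card U * card V) ∎
      where open ℕₚ.≤-Reasoning

  opaque
    -- Cauchy-Schwarz against the indicator of a set that contains the support.
    ∑²≤card*∑² : ∀ A (f : F → ℕ) → (∀ x → 0 < f x → x ∈ A) → ∑ f * ∑ f ≤ card A * ∑ (λ x → f x * f x)
    ∑²≤card*∑² A f supp = begin
      ∑ f * ∑ f ≡⟨ cong (λ s → s * s) (∑-cong restrict) ⟨
      ∑ (λ x → 𝟙 A x * f x) * ∑ (λ x → 𝟙 A x * f x) ≤⟨ cauchy-schwarz (𝟙 A) f ⟩
      ∑ (λ x → 𝟙 A x * 𝟙 A x) * ∑ (λ x → f x * f x) ≡⟨ cong (_* ∑ (λ x → f x * f x)) (∑-cong (𝟙-idem A)) ⟩
      card A * ∑ (λ x → f x * f x) ∎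
      where
      open ℕₚ.≤-Reasoning
      restrict : ∀ x → 𝟙 A x * f x ≡ f x
      restrict x with f x in fx
      ... | zero = ℕₚ.*-zeroʳ (𝟙 A x)
      ... | suc c = trans (cong (_* suc c) (𝟙-∈ A (supp x (subst (0 <_) (sym fx) (s≤s z≤n))))) (ℕₚ.*-identityˡ (suc c))

  -- At most n translates of W cover X. `X` is a predicate so that sums and dilates can be covered
  -- without being turned into decidable sets.
  Cover : ℕ → (F → Set) → FSet → Set
  Cover n X W = ∃ λ (ts : List F) → length ts ≤ n × (∀ x → X x → ∃ λ t → t ∈ₗ ts × x ⊖ t ∈ W)

  opaque
    cover-card : ∀ W ts Y → (∀ y → y ∈ Y → ∃ λ t → t ∈ₗ ts × y ⊖ t ∈ W) → card Y ≤ length ts * card W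
    cover-card W [] Y h = ℕₚ.≮⇒≥ λ 0<Y → case h _ (proj₂ (0<card⇒∃∈ Y 0<Y)) of λ { (_ , () , _) }
    cover-card W (t ∷ ts) Y h = begin
      card Y ≤⟨ ∑-mono split ⟩
      ∑ (λ y → 𝟙 W (y ⊖ t) + 𝟙 Y′ y) ≡⟨ ∑-+ ⟩
      ∑ (λ y → 𝟙 W (y ⊖ t)) + card Y′ ≡⟨ cong (_+ card Y′) (∑-⊖ t (𝟙 W)) ⟩
      card W + card Y′ ≤⟨ ℕₚ.+-monoʳ-≤ (card W) (cover-card W ts Y′ rest) ⟩
      card W + length ts * card W ∎
      where
      open ℕₚ.≤-Reasoning
      Y′? : ∀ y → Dec (y ∈ Y × ¬ y ⊖ t ∈ W)
      Y′? y = (y ∈? Y) ×-dec ¬? (y ⊖ t ∈? W)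
      Y′ : FSet
      Y′ y = does (Y′? y)
      split : ∀ y → 𝟙 Y y ≤ 𝟙 W (y ⊖ t) + 𝟙 Y′ y
      split y with y ⊖ t ∈? W
      ... | yes w = ℕₚ.≤-trans (𝟙≤1 Y y) (ℕₚ.≤-trans (ℕₚ.≤-reflexive (sym (𝟙-∈ W w))) (ℕₚ.m≤m+n _ _))
      ... | no ¬w = ℕₚ.≤-trans (𝟙-mono Y Y′ λ y∈ → does-intro (Y′? y) (y∈ , ¬w)) (ℕₚ.m≤n+m _ (𝟙 W (y ⊖ t)))
      rest : ∀ y → y ∈ Y′ → ∃ λ s → s ∈ₗ ts × y ⊖ s ∈ W
      rest y y∈ with does-elim (Y′? y) y∈
      ... | y∈Y , ¬w with h y y∈Y
      ... | _ , here refl , w = ⊥-elim (¬w w)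
      ... | s , there s∈ , w = s , s∈ , w

  -- Ruzsa's covering lemma: greedily pick elements of X with disjoint translates of S.
  opaque
    ruzsa-covering : ∀ S W (Sdiff : ∀ s t → s ∈ S → t ∈ S → s ⊖ t ∈ W) n R X →
      (∀ x s → x ∈ X → s ∈ S → x ⊕ s ∈ R) → card R < suc n * card S → Cover n (_∈ X) W
    ruzsa-covering S W Sdiff n R X X+S⊆R small with any? (λ x → x ∈? X)
    ... | no empty = [] , z≤n , λ x x∈ → ⊥-elim (empty (x , x∈))
    ruzsa-covering S W Sdiff zero R X X+S⊆R small | yes (x₀ , x₀∈) =
      contradiction small (ℕₚ.≤⇒≯ (ℕₚ.≤-trans (ℕₚ.≤-reflexive (ℕₚ.*-identityˡ (card S)))
        (ℕₚ.≤-trans (ℕₚ.≤-reflexive (sym (∑-⊖ x₀ (𝟙 S)))) (∑-mono λ y → 𝟙-mono S R λ s∈ →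
          subst (_∈ R) (solve 2 (λ x y → x :+ (y :- x) := y) refl x₀ y) (X+S⊆R x₀ _ x₀∈ s∈)))))
    ruzsa-covering S W Sdiff (suc n) R X X+S⊆R small | yes (x₀ , x₀∈)
      with ruzsa-covering S W Sdiff n R′ X′ X′+S⊆R′ small′
      where
      R′? : ∀ y → Dec (y ∈ R × ¬ y ⊖ x₀ ∈ S)
      R′? y = (y ∈? R) ×-dec ¬? (y ⊖ x₀ ∈? S)
      R′ : FSet
      R′ y = does (R′? y)
      -- X′ keeps the x for which x + S misses x₀ + S; their translates of S lie in what remains of
      -- R once x₀ + S is removed, and R shrinks by a full `card S`.
      X′? : ∀ x → Dec (x ∈ X × ¬ ∃ λ s → s ∈ S × x ⊕ s ⊖ x₀ ∈ S)
      X′? x = (x ∈? X) ×-dec ¬? (any? λ s → (s ∈? S) ×-dec (x ⊕ s ⊖ x₀ ∈? S))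
      X′ : FSet
      X′ x = does (X′? x)
      X′+S⊆R′ : ∀ x s → x ∈ X′ → s ∈ S → x ⊕ s ∈ R′
      X′+S⊆R′ x s x∈ s∈ with does-elim (X′? x) x∈
      ... | x∈X , disjoint = does-intro (R′? _) (X+S⊆R x s x∈X s∈ , λ w → disjoint (s , s∈ , w))
      split : ∀ y → 𝟙 S (y ⊖ x₀) + 𝟙 R′ y ≤ 𝟙 R y
      split y with y ⊖ x₀ ∈? S
      ... | yes s∈ = ℕₚ.≤-reflexive (trans (cong₂ _+_ (𝟙-∈ S s∈) (𝟙-∉ R′ λ r∈ → proj₂ (does-elim (R′? y) r∈) s∈))
              (sym (𝟙-∈ R (subst (_∈ R) (solve 2 (λ x y → x :+ (y :- x) := y) refl x₀ y) (X+S⊆R x₀ _ x₀∈ s∈)))))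
      ... | no s∉ = ℕₚ.≤-trans (ℕₚ.≤-reflexive (cong (_+ 𝟙 R′ y) (𝟙-∉ S s∉))) (𝟙-mono R′ R λ r∈ → proj₁ (does-elim (R′? y) r∈))
      small′ : card R′ < suc n * card S
      small′ = ℕₚ.+-cancelˡ-< (card S) _ _ (ℕₚ.≤-<-trans (ℕₚ.≤-trans (ℕₚ.≤-reflexive
        (trans (cong (_+ card R′) (sym (∑-⊖ x₀ (𝟙 S)))) (sym ∑-+))) (∑-mono split)) small)
    ... | ts , len , cov = x₀ ∷ ts , s≤s len , cover
      where
      cover : ∀ x → x ∈ X → ∃ λ t → t ∈ₗ x₀ ∷ ts × x ⊖ t ∈ W
      cover x x∈ with any? (λ s → (s ∈? S) ×-dec (x ⊕ s ⊖ x₀ ∈? S))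
      -- Here x + s = x₀ + s′, so x - x₀ = s′ - s is a difference of elements of S.
      ... | yes (s , s∈ , s′∈) = x₀ , here refl ,
            subst (_∈ W) (solve 3 (λ x s y → (x :+ s :- y) :- s := x :- y) refl x s x₀) (Sdiff _ _ s′∈ s∈)
      ... | no disjoint with cov x (does-intro ((x ∈? X) ×-dec ¬? (any? λ s → (s ∈? S) ×-dec (x ⊕ s ⊖ x₀ ∈? S))) (x∈ , disjoint))
      ... | t , t∈ , w = t , there t∈ , w

0<m*n⇒0<n : ∀ m n → 0 < m * n → 0 < n
0<m*n⇒0<n m zero h = contradiction h (ℕₚ.≤⇒≯ (ℕₚ.≤-reflexive (ℕₚ.*-zeroʳ m)))
0<m*n⇒0<n m (suc n) h = s≤s z≤n

-- Autocorrelation and the Balog-Szemerédi-Gowers argument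

module Correlation (q : ℕ) (prime : Prime (suc q)) where

  open Counting q prime public

  opaque
    cor : (F → ℕ) → F → ℕ
    cor f z = ∑ λ c → f c * f (c ⊖ z)

    cor-def : ∀ f z → cor f z ≡ ∑ (λ c → f c * f (c ⊖ z))
    cor-def f z = refl

  ∑-cor : ∀ f → ∑ (cor f) ≡ ∑ f * ∑ f
  ∑-cor f = begin
    ∑ (cor f) ≡⟨ ∑-cong (cor-def f) ⟩
    ∑ (λ z → ∑ λ c → f c * f (c ⊖ z)) ≡⟨ ∑-swap ⟩
    ∑ (λ c → ∑ λ z → f c * f (c ⊖ z)) ≡⟨ ∑-cong (λ c → trans (∑-*ˡ (f c)) (cong (f c *_) (∑-reflect c f))) ⟩
    ∑ (λ c → f c * ∑ f) ≡⟨ ∑-*ʳ (∑ f) ⟩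
    ∑ f * ∑ f ∎
    where open ≡-Reasoning

  cor-translates : ∀ f x y → ∑ (λ z → f (x ⊖ z) * f (y ⊖ z)) ≡ cor f (x ⊖ y)
  cor-translates f x y = begin
    ∑ (λ z → f (x ⊖ z) * f (y ⊖ z)) ≡⟨ ∑-cong (λ z → cong (λ t → f (x ⊖ z) * f t) (solve 3 (λ x y z → y :- z := x :- z :- (x :- y)) refl x y z)) ⟩
    ∑ (λ z → f (x ⊖ z) * f (x ⊖ z ⊖ (x ⊖ y))) ≡⟨ ∑-reflect x (λ c → f c * f (c ⊖ (x ⊖ y))) ⟩
    ∑ (λ c → f c * f (c ⊖ (x ⊖ y))) ≡⟨ cor-def f _ ⟨
    cor f (x ⊖ y) ∎
    where open ≡-Reasoning

  cor≤∑² : ∀ f z → cor f z ≤ ∑ (λ c → f c * f c)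
  cor≤∑² f z = halve-≤ (begin
    cor f z + cor f z ≡⟨ cong₂ _+_ (cor-def f z) (cor-def f z) ⟩
    _ ≡⟨ ∑-+ ⟨
    ∑ (λ c → f c * f (c ⊖ z) + f c * f (c ⊖ z)) ≤⟨ ∑-mono (λ c → amgm-ℕ (f c) (f (c ⊖ z))) ⟩
    ∑ (λ c → f c * f c + f (c ⊖ z) * f (c ⊖ z)) ≡⟨ ∑-+ ⟩
    _ ≡⟨ cong (_+_ _) (∑-⊖ z (λ c → f c * f c)) ⟩
    ∑ (λ c → f c * f c) + ∑ (λ c → f c * f c) ∎)
    where open ℕₚ.≤-Reasoning

  cor-0 : ∀ f → cor f 0ᶠ ≡ ∑ (λ c → f c * f c)
  cor-0 f = trans (cor-def f 0ᶠ) (∑-cong λ c → cong (λ t → f c * f t) (solve 1 (λ c → c :- con ℤ.0ℤ := c) refl c))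

  cor-max : ∀ f z → cor f z ≤ cor f 0ᶠ
  cor-max f z = subst (cor f z ≤_) (sym (cor-0 f)) (cor≤∑² f z)

  cor-dilate : ∀ {h} → h ≢ 0ᶠ → ∀ f → (∀ x → f (h ⊗ x) ≡ f x) → ∀ z → cor f (h ⊗ z) ≡ cor f z
  cor-dilate {h} h≢0 f inv z = begin
    cor f (h ⊗ z) ≡⟨ cor-def f _ ⟩
    ∑ (λ c → f c * f (c ⊖ h ⊗ z)) ≡⟨ ∑-⊗ h≢0 (λ c → f c * f (c ⊖ h ⊗ z)) ⟨
    ∑ (λ c → f (h ⊗ c) * f (h ⊗ c ⊖ h ⊗ z)) ≡⟨ ∑-cong (λ c → cong₂ _*_ (inv c)
         (trans (cong f (solve 3 (λ h c z → h :* c :- h :* z := h :* (c :- z)) refl h c z)) (inv _))) ⟩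
    ∑ (λ c → f c * f (c ⊖ z)) ≡⟨ cor-def f z ⟨
    cor f z ∎
    where open ≡-Reasoning

  -- A pair (x , y) is bad if x ⊖ y has few representations.  Restricting to the
  -- neighbourhood x ↦ f x * f (x ⊖ z) of a random z makes bad pairs rare.
  module BalogSzemerédiGowers
    (f : F → ℕ) (m₀ K L : ℕ) (L≡32K : L ≡ 32 * K) (f≤m₀ : ∀ x → f x ≤ m₀) (0<K : 0 < K) (0<m₀ : 0 < m₀) (0<∑f : 0 < ∑ f)
    (energetic : ∑ f * ∑ f * ∑ f * m₀ ≤ K * ∑ (λ x → cor f x * cor f x)) where

    private
      M = ∑ f
      f₂ = cor f

      Bad : F → FSet
      Bad x y = does (L * f₂ (x ⊖ y) <? M * m₀)

      a : F → F → ℕ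
      a z x = f x * f (x ⊖ z)

      ∑a : ∀ z → ∑ (a z) ≡ f₂ z
      ∑a z = sym (cor-def f z)

      badAt : F → F → ℕ
      badAt z x = ∑ λ y → 𝟙 (Bad x) y * a z y

      bad : F → ℕ
      bad z = ∑ λ x → a z x * badAt z x

      pull : ∀ x fx y fy b → x * fx * (b * (y * fy)) ≡ x * y * b * (fx * fy)
      pull = solve-∀

      -- Summing over z turns the product of the two shifted factors f (x - z) f (y - z) into the
      -- autocorrelation at x - y, which is small on bad pairs by definition.
      ∑bad≡ : ∑ bad ≡ ∑ (λ x → ∑ λ y → f x * f y * 𝟙 (Bad x) y * f₂ (x ⊖ y))
      ∑bad≡ = begin
        ∑ bad ≡⟨ ∑-cong (λ z → ∑-cong λ x → sym (∑-*ˡ (a z x))) ⟩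
        ∑ (λ z → ∑ λ x → ∑ λ y → a z x * (𝟙 (Bad x) y * a z y)) ≡⟨ ∑-swap ⟩
        ∑ (λ x → ∑ λ z → ∑ λ y → a z x * (𝟙 (Bad x) y * a z y)) ≡⟨ ∑-cong (λ x → ∑-swap) ⟩
        ∑ (λ x → ∑ λ y → ∑ λ z → a z x * (𝟙 (Bad x) y * a z y)) ≡⟨ ∑-cong₂ (λ x y → ∑-cong λ z →
             pull (f x) (f (x ⊖ z)) (f y) (f (y ⊖ z)) (𝟙 (Bad x) y)) ⟩
        ∑ (λ x → ∑ λ y → ∑ λ z → f x * f y * 𝟙 (Bad x) y * (f (x ⊖ z) * f (y ⊖ z))) ≡⟨ ∑-cong₂ (λ x y →
             trans (∑-*ˡ (f x * f y * 𝟙 (Bad x) y)) (cong (f x * f y * 𝟙 (Bad x) y *_) (cor-translates f x y))) ⟩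
        ∑ (λ x → ∑ λ y → f x * f y * 𝟙 (Bad x) y * f₂ (x ⊖ y)) ∎
        where open ≡-Reasoning

      ∑bad-small : L * ∑ bad ≤ M * M * M * m₀
      ∑bad-small = begin
        L * ∑ bad ≡⟨ cong (L *_) ∑bad≡ ⟩
        L * ∑ (λ x → ∑ λ y → f x * f y * 𝟙 (Bad x) y * f₂ (x ⊖ y)) ≡⟨ ∑-*ˡ L ⟨
        ∑ (λ x → L * ∑ λ y → f x * f y * 𝟙 (Bad x) y * f₂ (x ⊖ y)) ≡⟨ ∑-cong (λ x → sym (∑-*ˡ L)) ⟩
        ∑ (λ x → ∑ λ y → L * (f x * f y * 𝟙 (Bad x) y * f₂ (x ⊖ y))) ≤⟨ ∑-mono (λ x → ∑-mono λ y → each x y) ⟩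
        ∑ (λ x → ∑ λ y → f x * f y * (M * m₀)) ≡⟨ ∑-cong (λ x → ∑-*ʳ (M * m₀)) ⟩
        ∑ (λ x → ∑ (λ y → f x * f y) * (M * m₀)) ≡⟨ ∑-*ʳ (M * m₀) ⟩
        ∑ (λ x → ∑ (λ y → f x * f y)) * (M * m₀) ≡⟨ cong (_* (M * m₀)) ∑-prod ⟨
        M * M * (M * m₀) ≡⟨ ℕₚ.*-assoc (M * M) M m₀ ⟨
        M * M * M * m₀ ∎
        where
        open ℕₚ.≤-Reasoning
        move : ∀ L u b c → L * (u * b * c) ≡ u * (b * (L * c))
        move = solve-∀
        each : ∀ x y → L * (f x * f y * 𝟙 (Bad x) y * f₂ (x ⊖ y)) ≤ f x * f y * (M * m₀)
        each x y = ℕₚ.≤-trans (ℕₚ.≤-reflexive (move L (f x * f y) (𝟙 (Bad x) y) (f₂ (x ⊖ y))))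
          (ℕₚ.*-monoʳ-≤ (f x * f y) (𝟙*-≤ (Bad x) λ b → ℕₚ.<⇒≤ (does-elim (L * f₂ (x ⊖ y) <? M * m₀) b)))

      energy = ∑ λ z → f₂ z * f₂ z

      0<energy : 0 < energy
      0<energy = 0<m*n⇒0<n K energy (ℕₚ.<-≤-trans (ℕₚ.*-mono-< (ℕₚ.*-mono-< (ℕₚ.*-mono-< 0<∑f 0<∑f) 0<∑f) 0<m₀) energetic)

      -- The left side is at most three copies of M³m₀, hence at most 3 K times the energy; the
      -- fourth K makes the inequality strict. The first term then keeps the bad weight of the
      -- chosen z small, and the second keeps its neighbourhood large.
      ∑-choice : ∑ (λ z → 2 * L * bad z + M * m₀ * f₂ z) < ∑ (λ z → 4 * K * (f₂ z * f₂ z))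
      ∑-choice = begin-strict
        ∑ (λ z → 2 * L * bad z + M * m₀ * f₂ z) ≡⟨ ∑-+ ⟩
        ∑ (λ z → 2 * L * bad z) + ∑ (λ z → M * m₀ * f₂ z) ≡⟨ cong₂ _+_ (∑-*ˡ (2 * L)) (∑-*ˡ (M * m₀)) ⟩
        2 * L * ∑ bad + M * m₀ * ∑ f₂ ≡⟨ cong₂ _+_ (ℕₚ.*-assoc 2 L _) (cong (M * m₀ *_) (∑-cor f)) ⟩
        2 * (L * ∑ bad) + M * m₀ * (M * M) ≤⟨ ℕₚ.+-mono-≤ (ℕₚ.*-monoʳ-≤ 2 ∑bad-small) (ℕₚ.≤-reflexive (cube M m₀)) ⟩
        2 * (M * M * M * m₀) + M * M * M * m₀ ≤⟨ ℕₚ.+-mono-≤ (ℕₚ.*-monoʳ-≤ 2 energetic) energetic ⟩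
        2 * (K * energy) + K * energy <⟨ ℕₚ.m<m+n _ (ℕₚ.*-mono-< 0<K 0<energy) ⟩
        2 * (K * energy) + K * energy + K * energy ≡⟨ four K energy ⟩
        4 * K * energy ≡⟨ ∑-*ˡ (4 * K) ⟨
        ∑ (λ z → 4 * K * (f₂ z * f₂ z)) ∎
        where
        open ℕₚ.≤-Reasoning
        cube : ∀ M m → M * m * (M * M) ≡ M * M * M * m
        cube = solve-∀
        four : ∀ K e → 2 * (K * e) + K * e + K * e ≡ 4 * K * e
        four = solve-∀

      choice : ∃ λ z → 2 * L * bad z + M * m₀ * f₂ z < 4 * K * (f₂ z * f₂ z)
      choice = ∑-<⇒∃ _ _ ∑-choice

    module Neighbourhood (z : F) (chosen : 2 * L * bad z + M * m₀ * f₂ z < 4 * K * (f₂ z * f₂ z)) where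

      private
        t = f₂ z

        instance
          K≢0 : NonZero K
          K≢0 = >-nonZero 0<K

        0<t : 0 < t
        0<t = 0<m*n⇒0<n t t (0<m*n⇒0<n (4 * K) (t * t) (ℕₚ.≤-<-trans z≤n chosen))

        instance
          t≢0 : NonZero t
          t≢0 = >-nonZero 0<t

        -- The value L = 32 K is made for this bound: points x with `badAt z x` above t / 4 then
        -- carry at most a quarter of the weight t.
        16bad≤t² : 16 * bad z ≤ t * t
        16bad≤t² = ℕₚ.*-cancelˡ-≤ (4 * K) {{ℕₚ.m*n≢0 4 K}} (begin
          4 * K * (16 * bad z) ≡⟨ eq K (bad z) ⟩
          2 * (32 * K) * bad z ≡⟨ cong (λ l → 2 * l * bad z) L≡32K ⟨
          2 * L * bad z ≤⟨ ℕₚ.m≤m+n _ _ ⟩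
          2 * L * bad z + M * m₀ * t ≤⟨ ℕₚ.<⇒≤ chosen ⟩
          4 * K * (t * t) ∎)
          where
          open ℕₚ.≤-Reasoning
          eq : ∀ K b → 4 * K * (16 * b) ≡ 2 * (32 * K) * b
          eq = solve-∀

        Mm₀≤4Kt : M * m₀ ≤ 4 * K * t
        Mm₀≤4Kt = ℕₚ.*-cancelʳ-≤ _ _ t (begin
          M * m₀ * t ≤⟨ ℕₚ.m≤n+m _ (2 * L * bad z) ⟩
          2 * L * bad z + M * m₀ * t ≤⟨ ℕₚ.<⇒≤ chosen ⟩
          4 * K * (t * t) ≡⟨ ℕₚ.*-assoc (4 * K) t t ⟨
          4 * K * t * t ∎)
          where open ℕₚ.≤-Reasoning

        a≤m₀² : ∀ x → a z x ≤ m₀ * m₀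
        a≤m₀² x = ℕₚ.*-mono-≤ (f≤m₀ x) (f≤m₀ _)

      good : FSet
      good x = does (4 * badAt z x ≤? t)

      -- At least three quarters of the weight t lies on good points, and each point carries at most
      -- m₀²; moreover t is at least M m₀ / (4 K).
      good-large : 3 * M ≤ 16 * K * (m₀ * card good)
      good-large = ℕₚ.*-cancelʳ-≤ _ _ m₀ {{>-nonZero 0<m₀}} (begin
        3 * M * m₀ ≡⟨ ℕₚ.*-assoc 3 M m₀ ⟩
        3 * (M * m₀) ≤⟨ ℕₚ.*-monoʳ-≤ 3 Mm₀≤4Kt ⟩
        3 * (4 * K * t) ≡⟨ e₁ K t ⟩
        4 * K * (3 * t) ≤⟨ ℕₚ.*-monoʳ-≤ (4 * K) 3t≤ ⟩
        4 * K * (4 * (card good * (m₀ * m₀))) ≡⟨ e₂ K m₀ (card good) ⟩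
        16 * K * (m₀ * card good) * m₀ ∎)
        where
        open ℕₚ.≤-Reasoning
        e₁ : ∀ K t → 3 * (4 * K * t) ≡ 4 * K * (3 * t)
        e₁ = solve-∀
        e₂ : ∀ K m g → 4 * K * (4 * (g * (m * m))) ≡ 16 * K * (m * g) * m
        e₂ = solve-∀
        each : ∀ x → t * a z x ≤ t * (𝟙 good x * (m₀ * m₀)) + 4 * (a z x * badAt z x)
        each x with 4 * badAt z x ≤? t
        ... | yes g = ℕₚ.m≤n⇒m≤n+o (4 * (a z x * badAt z x)) (ℕₚ.*-monoʳ-≤ t (begin
          a z x ≤⟨ a≤m₀² x ⟩
          m₀ * m₀ ≡⟨ ℕₚ.*-identityˡ (m₀ * m₀) ⟨
          1 * (m₀ * m₀) ≡⟨ cong (_* (m₀ * m₀)) (𝟙-∈ good (does-intro (4 * badAt z x ≤? t) g)) ⟨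
          𝟙 good x * (m₀ * m₀) ∎))
        ... | no b = ℕₚ.m≤n⇒m≤o+n (t * (𝟙 good x * (m₀ * m₀))) (begin
          t * a z x ≤⟨ ℕₚ.*-monoˡ-≤ (a z x) (ℕₚ.<⇒≤ (ℕₚ.≰⇒> b)) ⟩
          4 * badAt z x * a z x ≡⟨ e (badAt z x) (a z x) ⟩
          4 * (a z x * badAt z x) ∎)
          where e : ∀ b a → 4 * b * a ≡ 4 * (a * b)
                e = solve-∀
        t²≤ : t * t ≤ t * (card good * (m₀ * m₀)) + 4 * bad z
        t²≤ = begin
          t * t ≡⟨ cong (t *_) (∑a z) ⟨
          t * ∑ (a z) ≡⟨ ∑-*ˡ t ⟨
          ∑ (λ x → t * a z x) ≤⟨ ∑-mono each ⟩
          ∑ (λ x → t * (𝟙 good x * (m₀ * m₀)) + 4 * (a z x * badAt z x)) ≡⟨ ∑-+ ⟩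
          _ ≡⟨ cong₂ _+_ (trans (∑-*ˡ t) (cong (t *_) (∑-*ʳ (m₀ * m₀)))) (∑-*ˡ 4) ⟩
          t * (card good * (m₀ * m₀)) + 4 * bad z ∎
        3t≤ : 3 * t ≤ 4 * (card good * (m₀ * m₀))
        3t≤ = ℕₚ.*-cancelʳ-≤ _ _ t (ℕₚ.+-cancelʳ-≤ (t * t) _ _ (begin
          3 * t * t + t * t ≡⟨ e₃ t ⟩
          4 * (t * t) ≤⟨ ℕₚ.*-monoʳ-≤ 4 t²≤ ⟩
          4 * (t * (card good * (m₀ * m₀)) + 4 * bad z) ≡⟨ e₄ t (card good * (m₀ * m₀)) (bad z) ⟩
          4 * (card good * (m₀ * m₀)) * t + 16 * bad z ≤⟨ ℕₚ.+-monoʳ-≤ (4 * (card good * (m₀ * m₀)) * t) 16bad≤t² ⟩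
          4 * (card good * (m₀ * m₀)) * t + t * t ∎))
          where
          e₃ : ∀ t → 3 * t * t + t * t ≡ 4 * (t * t)
          e₃ = solve-∀
          e₄ : ∀ t g b → 4 * (t * g + 4 * b) ≡ 4 * g * t + 16 * b
          e₄ = solve-∀

      -- Each of x and x′ spoils at most a quarter of the weight. On the remaining half both
      -- `f₂ (x ⊖ y)` and `f₂ (x′ ⊖ y)` are at least M m₀ / L, and their product summed over y is
      -- the autocorrelation of f₂ at (x - y) - (x′ - y) = x - x′.
      good-differences : ∀ x x′ → x ∈ good → x′ ∈ good → M * M * M * m₀ ≤ 8 * K * (L * L) * cor f₂ (x ⊖ x′)
      good-differences x x′ gx gx′ = ℕₚ.*-cancelʳ-≤ _ _ m₀ {{>-nonZero 0<m₀}} (ℕₚ.*-cancelʳ-≤ _ _ m₀ {{>-nonZero 0<m₀}} (begin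
        M * M * M * m₀ * m₀ * m₀ ≡⟨ e₁ M m₀ ⟩
        M * m₀ * N² ≤⟨ ℕₚ.*-monoˡ-≤ N² Mm₀≤4Kt ⟩
        4 * K * t * N² ≡⟨ ℕₚ.*-assoc (4 * K) t N² ⟩
        4 * K * (t * N²) ≤⟨ ℕₚ.*-monoʳ-≤ (4 * K) tN²≤ ⟩
        4 * K * (2 * (L * L * (m₀ * m₀) * f₄)) ≡⟨ e₂ K L m₀ f₄ ⟩
        8 * K * (L * L) * f₄ * m₀ * m₀ ∎))
        where
        open ℕₚ.≤-Reasoning
        f₄ = cor f₂ (x ⊖ x′)
        N² = M * m₀ * (M * m₀)
        e₁ : ∀ M m → M * M * M * m * m * m ≡ M * m * (M * m * (M * m))
        e₁ = solve-∀
        e₂ : ∀ K L m g → 4 * K * (2 * (L * L * (m * m) * g)) ≡ 8 * K * (L * L) * g * m * m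
        e₂ = solve-∀
        F₄ : F → ℕ
        F₄ y = f₂ (x ⊖ y) * f₂ (x′ ⊖ y)
        badWeight : ∀ w y → L * f₂ (w ⊖ y) < M * m₀ → a z y ≡ 𝟙 (Bad w) y * a z y
        badWeight w y b = sym (trans (cong (_* a z y) (𝟙-∈ (Bad w) (does-intro (L * f₂ (w ⊖ y) <? M * m₀) b))) (ℕₚ.*-identityˡ (a z y)))
        each : ∀ y → a z y * N² ≤ (𝟙 (Bad x) y * a z y + 𝟙 (Bad x′) y * a z y) * N² + L * L * (m₀ * m₀) * F₄ y
        each y = split (L * f₂ (x ⊖ y) <? M * m₀) (L * f₂ (x′ ⊖ y) <? M * m₀)
          where
          e₃ : ∀ m L u v → m * m * (L * u * (L * v)) ≡ L * L * (m * m) * (u * v)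
          e₃ = solve-∀
          split : Dec (L * f₂ (x ⊖ y) < M * m₀) → Dec (L * f₂ (x′ ⊖ y) < M * m₀) →
            a z y * N² ≤ (𝟙 (Bad x) y * a z y + 𝟙 (Bad x′) y * a z y) * N² + L * L * (m₀ * m₀) * F₄ y
          split (yes b) _ = ℕₚ.m≤n⇒m≤n+o (L * L * (m₀ * m₀) * F₄ y) (ℕₚ.*-monoˡ-≤ N²
              (ℕₚ.m≤n⇒m≤n+o (𝟙 (Bad x′) y * a z y) (ℕₚ.≤-reflexive (badWeight x y b))))
          split (no _) (yes b) = ℕₚ.m≤n⇒m≤n+o (L * L * (m₀ * m₀) * F₄ y) (ℕₚ.*-monoˡ-≤ N²
              (ℕₚ.m≤n⇒m≤o+n (𝟙 (Bad x) y * a z y) (ℕₚ.≤-reflexive (badWeight x′ y b))))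
          split (no g) (no g′) = ℕₚ.m≤n⇒m≤o+n ((𝟙 (Bad x) y * a z y + 𝟙 (Bad x′) y * a z y) * N²) (begin
            a z y * N² ≤⟨ ℕₚ.*-mono-≤ (a≤m₀² y) (ℕₚ.*-mono-≤ (ℕₚ.≮⇒≥ g) (ℕₚ.≮⇒≥ g′)) ⟩
            m₀ * m₀ * (L * f₂ (x ⊖ y) * (L * f₂ (x′ ⊖ y))) ≡⟨ e₃ m₀ L (f₂ (x ⊖ y)) (f₂ (x′ ⊖ y)) ⟩
            L * L * (m₀ * m₀) * F₄ y ∎)
        tN²₁ : t * N² ≤ (badAt z x + badAt z x′) * N² + L * L * (m₀ * m₀) * f₄
        tN²₁ = begin
          t * N² ≡⟨ cong (_* N²) (∑a z) ⟨
          ∑ (a z) * N² ≡⟨ ∑-*ʳ N² ⟨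
          ∑ (λ y → a z y * N²) ≤⟨ ∑-mono each ⟩
          ∑ (λ y → (𝟙 (Bad x) y * a z y + 𝟙 (Bad x′) y * a z y) * N² + L * L * (m₀ * m₀) * F₄ y) ≡⟨ ∑-+ ⟩
          ∑ (λ y → (𝟙 (Bad x) y * a z y + 𝟙 (Bad x′) y * a z y) * N²) + ∑ (λ y → L * L * (m₀ * m₀) * F₄ y) ≡⟨ cong₂ _+_ (trans (∑-*ʳ N²) (cong (_* N²) ∑-+)) (trans (∑-*ˡ (L * L * (m₀ * m₀))) (cong (L * L * (m₀ * m₀) *_) (cor-translates f₂ x x′))) ⟩
          (badAt z x + badAt z x′) * N² + L * L * (m₀ * m₀) * f₄ ∎
        tN²≤ : t * N² ≤ 2 * (L * L * (m₀ * m₀) * f₄)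
        tN²≤ = ℕₚ.*-cancelˡ-≤ 2 (ℕₚ.+-cancelˡ-≤ (2 * (t * N²)) _ _ (begin
          2 * (t * N²) + 2 * (t * N²) ≡⟨ e₄ (t * N²) ⟩
          4 * (t * N²) ≤⟨ ℕₚ.*-monoʳ-≤ 4 tN²₁ ⟩
          4 * ((badAt z x + badAt z x′) * N² + L * L * (m₀ * m₀) * f₄) ≡⟨ e₅ (badAt z x) (badAt z x′) N² (L * L * (m₀ * m₀) * f₄) ⟩
          (4 * badAt z x + 4 * badAt z x′) * N² + 4 * (L * L * (m₀ * m₀) * f₄)
            ≤⟨ ℕₚ.+-monoˡ-≤ _ (ℕₚ.*-monoˡ-≤ N² (ℕₚ.+-mono-≤ (does-elim (4 * badAt z x ≤? t) gx) (does-elim (4 * badAt z x′ ≤? t) gx′))) ⟩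
          (t + t) * N² + 4 * (L * L * (m₀ * m₀) * f₄) ≡⟨ e₆ t N² (L * L * (m₀ * m₀) * f₄) ⟩
          2 * (t * N²) + 2 * (2 * (L * L * (m₀ * m₀) * f₄)) ∎))
          where
          e₄ : ∀ u → 2 * u + 2 * u ≡ 4 * u
          e₄ = solve-∀
          e₅ : ∀ b c n f → 4 * ((b + c) * n + f) ≡ (4 * b + 4 * c) * n + 4 * f
          e₅ = solve-∀
          e₆ : ∀ t n f → (t + t) * n + 4 * f ≡ 2 * (t * n) + 2 * (2 * f)
          e₆ = solve-∀

    large-set-of-popular-differences : ∃ λ A → 3 * M ≤ 16 * K * (m₀ * card A) ×
      (∀ x x′ → x ∈ A → x′ ∈ A → M * M * M * m₀ ≤ 8 * K * (L * L) * cor f₂ (x ⊖ x′))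
    large-set-of-popular-differences =
      Neighbourhood.good (proj₁ choice) (proj₂ choice) ,
      Neighbourhood.good-large (proj₁ choice) (proj₂ choice) ,
      Neighbourhood.good-differences (proj₁ choice) (proj₂ choice)

-- Overlapping dilates of a set inside an invariant set

opaque
  -- If f exceeded g wherever w is positive, the weighted sums would differ by at least the total
  -- weight.
  ∑-weighted : ∀ {n} (w f g : Fin n → ℕ) → 0 < ∑ w → ∑ (λ x → w x * f x) ≤ ∑ (λ x → w x * g x) → ∃ λ x → 0 < w x × f x ≤ g x
  ∑-weighted w f g 0<∑w h with any? (λ x → (0 <? w x) ×-dec (f x ≤? g x))
  ... | yes found = found
  ... | no none = contradiction h (ℕₚ.<⇒≱ (begin-strict
      ∑ (λ x → w x * g x) <⟨ ℕₚ.m<m+n _ 0<∑w ⟩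
      ∑ (λ x → w x * g x) + ∑ w ≡⟨ ∑-+ ⟨
      ∑ (λ x → w x * g x + w x) ≤⟨ ∑-mono each ⟩
      ∑ (λ x → w x * f x) ∎))
    where
    open ℕₚ.≤-Reasoning
    each : ∀ x → w x * g x + w x ≤ w x * f x
    each x with w x in wx
    ... | zero = z≤n
    ... | suc v = ℕₚ.≤-trans (ℕₚ.≤-reflexive (trans (ℕₚ.+-comm _ (suc v)) (sym (ℕₚ.*-suc (suc v) (g x)))))
                    (ℕₚ.*-monoʳ-≤ (suc v) (ℕₚ.≰⇒> λ f≤g → none (x , subst (0 <_) (sym wx) (s≤s z≤n) , f≤g)))

module Dilates (q : ℕ) (prime : Prime (suc q)) where

  open Correlation q prime public

  ⁻¹-⊗ : ∀ {x y} → x ≢ 0ᶠ → y ≢ 0ᶠ → (x ⊗ y) ⁻¹ ≡ x ⁻¹ ⊗ y ⁻¹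
  ⁻¹-⊗ {x} {y} x≢0 y≢0 = ⊗-cancelˡ (⊗-nonzero x≢0 y≢0) (begin
    x ⊗ y ⊗ (x ⊗ y) ⁻¹ ≡⟨ solve 2 (λ a b → a :* b := b :* a) refl (x ⊗ y) _ ⟩
    (x ⊗ y) ⁻¹ ⊗ (x ⊗ y) ≡⟨ ⁻¹-inverseˡ (⊗-nonzero x≢0 y≢0) ⟩
    1ᶠ ≡⟨ ⊗-idˡ 1ᶠ ⟨
    1ᶠ ⊗ 1ᶠ ≡⟨ cong₂ _⊗_ (⁻¹-inverseˡ x≢0) (⁻¹-inverseˡ y≢0) ⟨
    x ⁻¹ ⊗ x ⊗ (y ⁻¹ ⊗ y) ≡⟨ solve 4 (λ a b c d → c :* a :* (d :* b) := a :* b :* (c :* d)) refl x y (x ⁻¹) (y ⁻¹) ⟩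
    x ⊗ y ⊗ (x ⁻¹ ⊗ y ⁻¹) ∎)
    where open ≡-Reasoning

  module _
    (A P H : FSet) (K₁ : ℕ) (0<A : 0 < card A) (0<H : 0 < card H)
    (A-A⊆P : ∀ x y → x ∈ A → y ∈ A → x ⊖ y ∈ P) (P-small : card P ≤ K₁ * card A)
    (H≢0 : ∀ {h} → h ∈ H → h ≢ 0ᶠ) (HP : ∀ {h} → h ∈ H → ∀ x → x ∈ P → h ⊗ x ∈ P) where

    private
      instance
        A≢0 : NonZero (card A)
        A≢0 = >-nonZero 0<A

      x₀ : F
      x₀ = proj₁ (0<card⇒∃∈ A 0<A)
      x₀∈A : x₀ ∈ A
      x₀∈A = proj₂ (0<card⇒∃∈ A 0<A)

      -- Indicator of h (A - x₀). Subtracting x₀ ∈ A puts A inside `P`, and `P` is invariant under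
      -- H, so all these dilates share the one small set `P`.
      τ : F → F → ℕ
      τ h x = 𝟙 A (h ⁻¹ ⊗ x ⊕ x₀)

      ∑τ : ∀ {h} → h ≢ 0ᶠ → ∑ (τ h) ≡ card A
      ∑τ h≢0 = trans (∑-⊗ (⁻¹-nonzero h≢0) (λ y → 𝟙 A (y ⊕ x₀))) (∑-⊕ x₀ (𝟙 A))

      φ : F → ℕ
      φ x = ∑ λ h → 𝟙 H h * τ h x

      common : F → F → ℕ
      common h h′ = ∑ λ x → τ h x * τ h′ x

      ψ : F → ℕ
      ψ h′ = ∑ λ h → 𝟙 H h * common h h′

      φ-support : ∀ x → 0 < φ x → x ∈ P
      φ-support x 0<φ with ∑-pos⇒∃ _ 0<φ
      ... | h , pos = subst (_∈ P) (⁻¹-cancelʳ (H≢0 h∈) x) (HP h∈ _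
              (subst (_∈ P) (solve 2 (λ y x → y :+ x :- x := y) refl (h ⁻¹ ⊗ x) x₀)
                (A-A⊆P _ x₀ (0<𝟙⇒∈ A (0<m*n⇒0<n (𝟙 H h) _ pos)) x₀∈A)))
        where
        h∈ : h ∈ H
        h∈ = 0<𝟙⇒∈ H (0<m*n⇒0<n (τ h x) (𝟙 H h) (subst (0 <_) (ℕₚ.*-comm (𝟙 H h) (τ h x)) pos))

      ∑φ : ∑ φ ≡ card H * card A
      ∑φ = begin
        ∑ (λ x → ∑ λ h → 𝟙 H h * τ h x) ≡⟨ ∑-swap ⟩
        ∑ (λ h → ∑ λ x → 𝟙 H h * τ h x) ≡⟨ ∑-cong (λ h → trans (∑-*ˡ (𝟙 H h)) (each h)) ⟩
        ∑ (λ h → 𝟙 H h * card A) ≡⟨ ∑-*ʳ (card A) ⟩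
        card H * card A ∎
        where
        open ≡-Reasoning
        each : ∀ h → 𝟙 H h * ∑ (τ h) ≡ 𝟙 H h * card A
        each h with h ∈? H
        ... | yes h∈ = cong (𝟙 H h *_) (∑τ (H≢0 h∈))
        ... | no h∉ = trans (cong (_* ∑ (τ h)) (𝟙-∉ H h∉)) (sym (cong (_* card A) (𝟙-∉ H h∉)))

      ∑φ² : ∑ (λ x → φ x * φ x) ≡ ∑ (λ h′ → 𝟙 H h′ * ψ h′)
      ∑φ² = begin
        ∑ (λ x → φ x * φ x) ≡⟨ ∑-cong (λ x → ∑-prod) ⟩
        ∑ (λ x → ∑ λ h′ → ∑ λ h → 𝟙 H h′ * τ h′ x * (𝟙 H h * τ h x)) ≡⟨ ∑-swap ⟩
        ∑ (λ h′ → ∑ λ x → ∑ λ h → 𝟙 H h′ * τ h′ x * (𝟙 H h * τ h x)) ≡⟨ ∑-cong (λ h′ → ∑-swap) ⟩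
        ∑ (λ h′ → ∑ λ h → ∑ λ x → 𝟙 H h′ * τ h′ x * (𝟙 H h * τ h x)) ≡⟨ ∑-cong₂ (λ h′ h → trans (∑-cong λ x → move (𝟙 H h′) (τ h′ x) (𝟙 H h) (τ h x)) (∑-*ˡ (𝟙 H h′))) ⟩
        ∑ (λ h′ → ∑ λ h → 𝟙 H h′ * ∑ λ x → 𝟙 H h * (τ h x * τ h′ x)) ≡⟨ ∑-cong (λ h′ → trans (∑-*ˡ (𝟙 H h′)) (cong (𝟙 H h′ *_) (∑-cong λ h → ∑-*ˡ (𝟙 H h)))) ⟩
        ∑ (λ h′ → 𝟙 H h′ * ψ h′) ∎
        where
        open ≡-Reasoning
        move : ∀ a b c d → a * b * (c * d) ≡ a * (c * (d * b))
        move = solve-∀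

      -- The sets h (A - x₀) have `card A` elements each and lie in a set only K₁ times larger, so
      -- by Cauchy-Schwarz two of them meet on average in at least `card A` / K₁ points. The pivot
      -- h′ does at least as well as this average.
      pivot : ∃ λ h′ → 0 < 𝟙 H h′ × card H * card A ≤ K₁ * ψ h′
      pivot = ∑-weighted (𝟙 H) (λ _ → card H * card A) (λ h′ → K₁ * ψ h′) 0<H (ℕₚ.*-cancelʳ-≤ _ _ (card A) (begin
        ∑ (λ h′ → 𝟙 H h′ * (card H * card A)) * card A ≡⟨ cong (_* card A) (∑-*ʳ (card H * card A)) ⟩
        card H * (card H * card A) * card A ≡⟨ e₁ (card H) (card A) ⟩
        card H * card A * (card H * card A) ≡⟨ cong₂ _*_ ∑φ ∑φ ⟨
        ∑ φ * ∑ φ ≤⟨ ∑²≤card*∑² P φ φ-support ⟩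
        card P * ∑ (λ x → φ x * φ x) ≤⟨ ℕₚ.*-mono-≤ P-small (ℕₚ.≤-reflexive ∑φ²) ⟩
        K₁ * card A * ∑ (λ h′ → 𝟙 H h′ * ψ h′) ≡⟨ e₂ K₁ (card A) _ ⟩
        K₁ * ∑ (λ h′ → 𝟙 H h′ * ψ h′) * card A ≡⟨ cong (_* card A) (∑-*ˡ K₁) ⟨
        ∑ (λ h′ → K₁ * (𝟙 H h′ * ψ h′)) * card A ≡⟨ cong (_* card A) (∑-cong λ h′ → e₃ K₁ (𝟙 H h′) (ψ h′)) ⟩
        ∑ (λ h′ → 𝟙 H h′ * (K₁ * ψ h′)) * card A ∎))
        where
        open ℕₚ.≤-Reasoning
        e₁ : ∀ h a → h * (h * a) * a ≡ h * a * (h * a)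
        e₁ = solve-∀
        e₂ : ∀ k a s → k * a * s ≡ k * s * a
        e₂ = solve-∀
        e₃ : ∀ k a s → k * (a * s) ≡ a * (k * s)
        e₃ = solve-∀

      h′ : F
      h′ = proj₁ pivot
      h′≢0 : h′ ≢ 0ᶠ
      h′≢0 = H≢0 (0<𝟙⇒∈ H (proj₁ (proj₂ pivot)))

      H₀? : ∀ h → Dec (h ∈ H × card A ≤ 2 * K₁ * common h h′)
      H₀? h = (h ∈? H) ×-dec (card A ≤? 2 * K₁ * common h h′)
      H₀ : FSet
      H₀ h = does (H₀? h)

      -- The h below half of the average overlap with h′ account for at most half of the total
      -- overlap.
      H₀-large : card H ≤ 2 * K₁ * card H₀
      H₀-large = ℕₚ.*-cancelʳ-≤ _ _ (card A) (ℕₚ.+-cancelʳ-≤ (card H * card A) _ _ (begin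
        card H * card A + card H * card A ≡⟨ e₁ (card H * card A) ⟩
        2 * (card H * card A) ≤⟨ ℕₚ.*-monoʳ-≤ 2 (proj₂ (proj₂ pivot)) ⟩
        2 * (K₁ * ψ h′) ≡⟨ ℕₚ.*-assoc 2 K₁ (ψ h′) ⟨
        2 * K₁ * ψ h′ ≡⟨ ∑-*ˡ (2 * K₁) ⟨
        ∑ (λ h → 2 * K₁ * (𝟙 H h * common h h′)) ≤⟨ ∑-mono each ⟩
        ∑ (λ h → 𝟙 H₀ h * (2 * K₁ * card A) + 𝟙 H h * card A) ≡⟨ ∑-+ ⟩
        ∑ (λ h → 𝟙 H₀ h * (2 * K₁ * card A)) + ∑ (λ h → 𝟙 H h * card A) ≡⟨ cong₂ _+_ (∑-*ʳ (2 * K₁ * card A)) (∑-*ʳ (card A)) ⟩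
        card H₀ * (2 * K₁ * card A) + card H * card A ≡⟨ cong (_+ card H * card A) (e₂ (card H₀) K₁ (card A)) ⟩
        2 * K₁ * card H₀ * card A + card H * card A ∎))
        where
        open ℕₚ.≤-Reasoning
        e₁ : ∀ a → a + a ≡ 2 * a
        e₁ = solve-∀
        e₂ : ∀ h k a → h * (2 * k * a) ≡ 2 * k * h * a
        e₂ = solve-∀
        e₃ : ∀ k a c → 2 * k * (a * c) ≡ a * (2 * k * c)
        e₃ = solve-∀
        common≤ : ∀ h → common h h′ ≤ card A
        common≤ h = ℕₚ.≤-trans (∑-mono λ x → ℕₚ.≤-trans (ℕₚ.*-monoˡ-≤ (τ h′ x) (𝟙≤1 A _)) (ℕₚ.≤-reflexive (ℕₚ.*-identityˡ (τ h′ x)))) (ℕₚ.≤-reflexive (∑τ h′≢0))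
        each : ∀ h → 2 * K₁ * (𝟙 H h * common h h′) ≤ 𝟙 H₀ h * (2 * K₁ * card A) + 𝟙 H h * card A
        each h = split (H₀? h)
          where
          split : Dec (h ∈ H × card A ≤ 2 * K₁ * common h h′) → 2 * K₁ * (𝟙 H h * common h h′) ≤ 𝟙 H₀ h * (2 * K₁ * card A) + 𝟙 H h * card A
          split (yes in₀) = ℕₚ.m≤n⇒m≤n+o (𝟙 H h * card A) (begin
            2 * K₁ * (𝟙 H h * common h h′) ≤⟨ ℕₚ.*-monoʳ-≤ (2 * K₁) (ℕₚ.*-mono-≤ (𝟙≤1 H h) (common≤ h)) ⟩
            2 * K₁ * (1 * card A) ≡⟨ e₃ K₁ 1 (card A) ⟩
            1 * (2 * K₁ * card A) ≡⟨ cong (_* (2 * K₁ * card A)) (𝟙-∈ H₀ (does-intro (H₀? h) in₀)) ⟨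
            𝟙 H₀ h * (2 * K₁ * card A) ∎)
          split (no out) = ℕₚ.m≤n⇒m≤o+n (𝟙 H₀ h * (2 * K₁ * card A)) (begin
            2 * K₁ * (𝟙 H h * common h h′) ≡⟨ e₃ K₁ (𝟙 H h) (common h h′) ⟩
            𝟙 H h * (2 * K₁ * common h h′) ≤⟨ 𝟙*-≤ H (λ h∈ → ℕₚ.≤-trans (ℕₚ.≰⇒≥ (λ le → out (h∈ , le))) (ℕₚ.≤-reflexive (trans (sym (ℕₚ.*-identityˡ (card A))) (cong (_* card A) (sym (𝟙-∈ H h∈)))))) ⟩
            𝟙 H h * card A ∎)

      -- B is h′ (A - x₀) and A₀ is H₀ divided by h′, so that an overlap of two dilates of A - x₀
      -- becomes an overlap of ξ B with B itself.
      B A₀ : FSet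
      B x = A (h′ ⁻¹ ⊗ x ⊕ x₀)
      A₀ ξ = H₀ (h′ ⊗ ξ)

      𝟙-cong : ∀ X Y {x y} → X x ≡ Y y → 𝟙 X x ≡ 𝟙 Y y
      𝟙-cong X Y {x} {y} e = ℕₚ.≤-antisym (𝟙-mono X Y (subst T e)) (𝟙-mono Y X (subst T (sym e)))

      card-B : card B ≡ card A
      card-B = trans (∑-cong λ x → 𝟙-cong B A refl) (∑τ h′≢0)

      card-A₀ : card A₀ ≡ card H₀
      card-A₀ = trans (∑-cong λ x → 𝟙-cong A₀ H₀ refl) (∑-⊗ h′≢0 (𝟙 H₀))

      B-B⊆P : ∀ x y → x ∈ B → y ∈ B → x ⊖ y ∈ P
      B-B⊆P x y x∈ y∈ = subst (_∈ P) (begin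
        h′ ⊗ (h′ ⁻¹ ⊗ x ⊕ x₀ ⊖ (h′ ⁻¹ ⊗ y ⊕ x₀)) ≡⟨ solve 5 (λ h g x y z → h :* (g :* x :+ z :- (g :* y :+ z)) := h :* (g :* (x :- y))) refl h′ (h′ ⁻¹) x y x₀ ⟩
        h′ ⊗ (h′ ⁻¹ ⊗ (x ⊖ y)) ≡⟨ ⁻¹-cancelʳ h′≢0 _ ⟩
        x ⊖ y ∎) (HP (0<𝟙⇒∈ H (proj₁ (proj₂ pivot))) _ (A-A⊆P _ _ x∈ y∈))
        where open ≡-Reasoning

      A₀-nonzero : ∀ ξ → ξ ∈ A₀ → ξ ≢ 0ᶠ
      A₀-nonzero ξ ξ∈ refl = H≢0 (proj₁ (does-elim (H₀? (h′ ⊗ ξ)) ξ∈)) (zeroʳ h′)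

      A₀-overlap : ∀ ξ → ξ ∈ A₀ → card B ≤ 2 * K₁ * ∑ (λ x → 𝟙 B (ξ ⁻¹ ⊗ x) * 𝟙 B x)
      A₀-overlap ξ ξ∈ = ℕₚ.≤-trans (ℕₚ.≤-reflexive card-B) (ℕₚ.≤-trans (proj₂ (does-elim (H₀? (h′ ⊗ ξ)) ξ∈))
        (ℕₚ.≤-reflexive (cong (2 * K₁ *_) (∑-cong λ x → cong₂ _*_ (sym (𝟙-cong B A (cong A (cong (_⊕ x₀) (begin
            h′ ⁻¹ ⊗ (ξ ⁻¹ ⊗ x) ≡⟨ solve 3 (λ a b c → a :* (b :* c) := a :* b :* c) refl (h′ ⁻¹) (ξ ⁻¹) x ⟩
            h′ ⁻¹ ⊗ ξ ⁻¹ ⊗ x ≡⟨ cong (_⊗ x) (⁻¹-⊗ h′≢0 (A₀-nonzero ξ ξ∈)) ⟨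
            (h′ ⊗ ξ) ⁻¹ ⊗ x ∎))))) (sym (𝟙-cong B A refl))))))
        where open ≡-Reasoning

    opaque
      dilate-overlaps : ∃₂ λ B A₀ → card B ≡ card A × (∀ x y → x ∈ B → y ∈ B → x ⊖ y ∈ P) ×
        card H ≤ 2 * K₁ * card A₀ ×
        (∀ ξ → ξ ∈ A₀ → ξ ≢ 0ᶠ × card B ≤ 2 * K₁ * ∑ (λ x → 𝟙 B (ξ ⁻¹ ⊗ x) * 𝟙 B x))
      dilate-overlaps = B , A₀ , card-B , B-B⊆P , subst (λ c → card H ≤ 2 * K₁ * c) (sym card-A₀) H₀-large ,
        λ ξ ξ∈ → A₀-nonzero ξ ξ∈ , A₀-overlap ξ ξ∈

-- Popular differences and the construction of W

module DifferenceSets (q : ℕ) (prime : Prime (suc q)) where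

  open Dilates q prime public

  diff? : ∀ (X B : FSet) z → Dec (∃ λ b → b ∈ B × z ⊕ b ∈ X)
  diff? X B z = any? λ b → (b ∈? B) ×-dec (z ⊕ b ∈? X)

  sum? : ∀ (X S : FSet) z → Dec (∃ λ s → s ∈ S × z ⊖ s ∈ X)
  sum? X S z = any? λ s → (s ∈? S) ×-dec (z ⊖ s ∈? X)

  opaque
    diff sumset : FSet → FSet → FSet
    diff X B z = does (diff? X B z)
    sumset X S z = does (sum? X S z)

    ∈-diff : ∀ X B {x b} → x ∈ X → b ∈ B → x ⊖ b ∈ diff X B
    ∈-diff X B {x} {b} x∈ b∈ = does-intro (diff? X B (x ⊖ b)) (b , b∈ , subst (_∈ X) (solve 2 (λ x b → x := x :- b :+ b) refl x b) x∈)

    diff-∈ : ∀ X B {z} → z ∈ diff X B → ∃ λ b → b ∈ B × z ⊕ b ∈ X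
    diff-∈ X B {z} = does-elim (diff? X B z)

    ∈-sumset : ∀ X S {x s} → x ∈ X → s ∈ S → x ⊕ s ∈ sumset X S
    ∈-sumset X S {x} {s} x∈ s∈ = does-intro (sum? X S (x ⊕ s)) (s , s∈ , subst (_∈ X) (solve 2 (λ x s → x := x :+ s :- s) refl x s) x∈)

    sumset-∈ : ∀ X S {z} → z ∈ sumset X S → ∃ λ s → s ∈ S × z ⊖ s ∈ X
    sumset-∈ X S {z} = does-elim (sum? X S z)

  module _
    (B P : FSet) (K₁ : ℕ) (0<K₁ : 0 < K₁) (0<B : 0 < card B)
    (B-B⊆P : ∀ x y → x ∈ B → y ∈ B → x ⊖ y ∈ P) (P-small : card P ≤ K₁ * card B) where

    private
      b₀ : F
      b₀ = proj₁ (0<card⇒∃∈ B 0<B)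
      b₀∈B : b₀ ∈ B
      b₀∈B = proj₂ (0<card⇒∃∈ B 0<B)
      instance
        K₁≢0 : NonZero K₁
        K₁≢0 = >-nonZero 0<K₁
        B≢0 : NonZero (card B)
        B≢0 = >-nonZero 0<B

      r : F → ℕ
      r s = ∑ λ b → 𝟙 B b * 𝟙 B (b ⊕ s)

      r≤B : ∀ s → r s ≤ card B
      r≤B s = ∑-mono λ b → ℕₚ.≤-trans (ℕₚ.*-monoʳ-≤ (𝟙 B b) (𝟙≤1 B _)) (ℕₚ.≤-reflexive (ℕₚ.*-identityʳ _))

      r-support : ∀ s → 0 < r s → s ∈ P
      r-support s 0<r with ∑-pos⇒∃ _ 0<r
      ... | b , pos = subst (_∈ P) (solve 2 (λ b s → b :+ s :- b := s) refl b s)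
            (B-B⊆P _ b (0<𝟙⇒∈ B (0<m*n⇒0<n (𝟙 B b) _ pos))
              (0<𝟙⇒∈ B (0<m*n⇒0<n (𝟙 B (b ⊕ s)) _ (subst (0 <_) (ℕₚ.*-comm (𝟙 B b) _) pos))))

      ∑r : ∑ r ≡ card B * card B
      ∑r = trans ∑-swap (trans (∑-cong λ b → trans (∑-*ˡ (𝟙 B b)) (cong (𝟙 B b *_)
             (trans (∑-cong λ s → cong (𝟙 B) (solve 2 (λ b s → b :+ s := s :+ b) refl b s)) (∑-⊕ b (𝟙 B))))) (∑-*ʳ (card B)))

    -- The popular differences of B: sums of them are controlled for free by
    -- telescoping representations.
    S : FSet
    S s = does (card B ≤? 2 * K₁ * r s)

    private
      ∈S : ∀ {s} → card B ≤ 2 * K₁ * r s → s ∈ S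
      ∈S {s} = does-intro (card B ≤? 2 * K₁ * r s)
      S∈ : ∀ {s} → s ∈ S → card B ≤ 2 * K₁ * r s
      S∈ {s} = does-elim (card B ≤? 2 * K₁ * r s)

    -- The representation counts add up to |B|². An unpopular difference has fewer than |B| / (2 K₁)
    -- representations and there are at most K₁ |B| differences, so the unpopular ones hold at most
    -- half of the total.
    card-B≤2card-S : card B ≤ 2 * card S
    card-B≤2card-S = ℕₚ.*-cancelˡ-≤ (K₁ * card B) {{ℕₚ.m*n≢0 K₁ (card B)}} (ℕₚ.+-cancelʳ-≤ (K₁ * card B * card B) _ _ (begin
      K₁ * card B * card B + K₁ * card B * card B ≡⟨ e₁ K₁ (card B) ⟩
      2 * K₁ * (card B * card B) ≡⟨ cong (2 * K₁ *_) ∑r ⟨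
      2 * K₁ * ∑ r ≡⟨ ∑-*ˡ (2 * K₁) ⟨
      ∑ (λ s → 2 * K₁ * r s) ≤⟨ ∑-mono (λ s → each s (card B ≤? 2 * K₁ * r s)) ⟩
      ∑ (λ s → 𝟙 S s * (2 * K₁ * card B) + 𝟙 P s * card B) ≡⟨ ∑-+ ⟩
      ∑ (λ s → 𝟙 S s * (2 * K₁ * card B)) + ∑ (λ s → 𝟙 P s * card B) ≡⟨ cong₂ _+_ (∑-*ʳ (2 * K₁ * card B)) (∑-*ʳ (card B)) ⟩
      card S * (2 * K₁ * card B) + card P * card B ≤⟨ ℕₚ.+-monoʳ-≤ (card S * (2 * K₁ * card B)) (ℕₚ.*-monoˡ-≤ (card B) P-small) ⟩
      card S * (2 * K₁ * card B) + K₁ * card B * card B ≡⟨ cong (_+ K₁ * card B * card B) (e₂ (card S) K₁ (card B)) ⟩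
      K₁ * card B * (2 * card S) + K₁ * card B * card B ∎))
      where
      open ℕₚ.≤-Reasoning
      e₁ : ∀ k b → k * b * b + k * b * b ≡ 2 * k * (b * b)
      e₁ = solve-∀
      e₂ : ∀ s k b → s * (2 * k * b) ≡ k * b * (2 * s)
      e₂ = solve-∀
      each : ∀ s → Dec (card B ≤ 2 * K₁ * r s) → 2 * K₁ * r s ≤ 𝟙 S s * (2 * K₁ * card B) + 𝟙 P s * card B
      each s (yes h) = ℕₚ.m≤n⇒m≤n+o (𝟙 P s * card B) (begin
        2 * K₁ * r s ≤⟨ ℕₚ.*-monoʳ-≤ (2 * K₁) (r≤B s) ⟩
        2 * K₁ * card B ≡⟨ ℕₚ.*-identityˡ (2 * K₁ * card B) ⟨
        1 * (2 * K₁ * card B) ≡⟨ cong (_* (2 * K₁ * card B)) (𝟙-∈ S (∈S h)) ⟨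
        𝟙 S s * (2 * K₁ * card B) ∎)
      each s (no h) = ℕₚ.m≤n⇒m≤o+n (𝟙 S s * (2 * K₁ * card B)) (nonpopular (0 <? r s))
        where
        nonpopular : Dec (0 < r s) → 2 * K₁ * r s ≤ 𝟙 P s * card B
        nonpopular (yes pos) = begin
          2 * K₁ * r s ≤⟨ ℕₚ.≰⇒≥ h ⟩
          card B ≡⟨ ℕₚ.*-identityˡ (card B) ⟨
          1 * card B ≡⟨ cong (_* card B) (𝟙-∈ P (r-support s pos)) ⟨
          𝟙 P s * card B ∎
        nonpopular (no ¬pos) = begin
          2 * K₁ * r s ≡⟨ cong (2 * K₁ *_) (ℕₚ.n≤0⇒n≡0 (ℕₚ.≮⇒≥ ¬pos)) ⟩
          2 * K₁ * 0 ≡⟨ ℕₚ.*-zeroʳ (2 * K₁) ⟩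
          0 ≤⟨ z≤n ⟩
          𝟙 P s * card B ∎

    private
      0<S : 0 < card S
      0<S = 0<m*n⇒0<n 2 (card S) (ℕₚ.<-≤-trans 0<B card-B≤2card-S)

      S-sym : ∀ {s} → s ∈ S → ⊝ s ∈ S
      S-sym {s} s∈ = ∈S (subst (λ t → card B ≤ 2 * K₁ * t) r-sym (S∈ s∈))
        where
        r-sym : r s ≡ r (⊝ s)
        r-sym = trans (∑-cong λ b → trans (ℕₚ.*-comm (𝟙 B b) _) (cong (λ c → 𝟙 B (b ⊕ s) * 𝟙 B c) (solve 2 (λ b s → b := b :+ s :+ :- s) refl b s)))
                  (∑-⊕ s (λ b → 𝟙 B b * 𝟙 B (b ⊕ ⊝ s)))

      0∈S : 0ᶠ ∈ S
      0∈S = ∈S (begin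
        card B ≡⟨ ∑-cong (λ b → trans (sym (𝟙-idem B b)) (cong (λ c → 𝟙 B b * 𝟙 B c) (solve 1 (λ b → b := b :+ con ℤ.0ℤ) refl b))) ⟩
        r 0ᶠ ≡⟨ ℕₚ.*-identityˡ (r 0ᶠ) ⟨
        1 * r 0ᶠ ≤⟨ ℕₚ.*-monoˡ-≤ (r 0ᶠ) (ℕₚ.≤-trans 0<K₁ (ℕₚ.m≤n*m K₁ 2)) ⟩
        2 * K₁ * r 0ᶠ ∎)
        where open ℕₚ.≤-Reasoning

      -- Each b with b and b + s in B writes z + s - b′ as (z - b) + (b + s - b′), an element of Z -
      -- B plus a difference of B. A popular s has at least |B| / (2 K₁) such b, so a further
      -- summand S costs the factor 2 K₁² only. This takes the place of Plünnecke's inequality.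
      sumset-diff : ∀ Z → card (diff (sumset Z S) B) ≤ 2 * K₁ * K₁ * card (diff Z B)
      sumset-diff Z = ℕₚ.*-cancelʳ-≤ _ _ (card B) (begin
        card (diff (sumset Z S) B) * card B ≤⟨ card-representations (diff (sumset Z S) B) (diff Z B) P (card B) (2 * K₁) represent ⟩
        2 * K₁ * (card (diff Z B) * card P) ≤⟨ ℕₚ.*-monoʳ-≤ (2 * K₁) (ℕₚ.*-monoʳ-≤ (card (diff Z B)) P-small) ⟩
        2 * K₁ * (card (diff Z B) * (K₁ * card B)) ≡⟨ e K₁ (card (diff Z B)) (card B) ⟩
        2 * K₁ * K₁ * card (diff Z B) * card B ∎)
        where
        open ℕₚ.≤-Reasoning
        e : ∀ k d b → 2 * k * (d * (k * b)) ≡ 2 * k * k * d * b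
        e = solve-∀
        represent : ∀ e → e ∈ diff (sumset Z S) B → card B ≤ 2 * K₁ * ∑ (λ u → 𝟙 (diff Z B) u * 𝟙 P (e ⊖ u))
        represent e e∈ with diff-∈ (sumset Z S) B e∈
        ... | b′ , b′∈ , zs∈ with sumset-∈ Z S zs∈
        ... | s , s∈ , z∈ = ℕₚ.≤-trans (S∈ s∈) (ℕₚ.*-monoʳ-≤ (2 * K₁) (begin
            r s ≤⟨ ∑-mono each ⟩
            ∑ (λ b → 𝟙 (diff Z B) (z ⊖ b) * 𝟙 P (e ⊖ (z ⊖ b))) ≡⟨ ∑-reflect z (λ u → 𝟙 (diff Z B) u * 𝟙 P (e ⊖ u)) ⟩
            ∑ (λ u → 𝟙 (diff Z B) u * 𝟙 P (e ⊖ u)) ∎))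
          where
          z : F
          z = e ⊕ b′ ⊖ s
          each : ∀ b → 𝟙 B b * 𝟙 B (b ⊕ s) ≤ 𝟙 (diff Z B) (z ⊖ b) * 𝟙 P (e ⊖ (z ⊖ b))
          each b = 𝟙*-≤ B λ b∈ → ℕₚ.≤-trans (𝟙-mono B P λ bs∈ → subst (_∈ P)
              (solve 4 (λ b s b′ e → b :+ s :- b′ := e :- (e :+ b′ :- s :- b)) refl b s b′ e) (B-B⊆P _ b′ bs∈ b′∈))
            (ℕₚ.≤-reflexive (trans (sym (ℕₚ.*-identityˡ _)) (cong (_* 𝟙 P (e ⊖ (z ⊖ b))) (sym (𝟙-∈ (diff Z B) (∈-diff Z B z∈ b∈))))))

    multiple : ℕ → FSet
    multiple zero x = does (x ≟ᶠ 0ᶠ)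
    multiple (suc i) = sumset (multiple i) S

    opaque
      κ : ℕ
      κ = 2 * K₁ * K₁

      κ-def : κ ≡ 2 * K₁ * K₁
      κ-def = refl

    private
      0∈multiple : 0ᶠ ∈ multiple 0
      0∈multiple = does-intro (0ᶠ ≟ᶠ 0ᶠ) refl

      multiple-diff : ∀ i → card (diff (multiple i) B) ≤ κ ^ i * card B
      multiple-diff zero = ℕₚ.≤-trans (ℕₚ.≤-trans (∑-mono each) (ℕₚ.≤-reflexive (∑-reflect 0ᶠ (𝟙 B)))) (ℕₚ.≤-reflexive (sym (ℕₚ.*-identityˡ (card B))))
        where
        each : ∀ z → 𝟙 (diff (multiple 0) B) z ≤ 𝟙 B (0ᶠ ⊖ z)
        each z = 𝟙-mono (diff (multiple 0) B) B λ z∈ → case diff-∈ (multiple 0) B z∈ of λ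
          (b , b∈ , zb∈) → subst (_∈ B) (trans (solve 2 (λ z b → b := (z :+ b) :- z) refl z b) (cong (_⊖ z) (does-elim (z ⊕ b ≟ᶠ 0ᶠ) zb∈))) b∈
      multiple-diff (suc i) = begin
        card (diff (multiple (suc i)) B) ≤⟨ sumset-diff (multiple i) ⟩
        2 * K₁ * K₁ * card (diff (multiple i) B) ≡⟨ cong (_* card (diff (multiple i) B)) κ-def ⟨
        κ * card (diff (multiple i) B) ≤⟨ ℕₚ.*-monoʳ-≤ κ (multiple-diff i) ⟩
        κ * (κ ^ i * card B) ≡⟨ ℕₚ.*-assoc κ (κ ^ i) (card B) ⟨
        κ ^ suc i * card B ∎
        where open ℕₚ.≤-Reasoning

      card-multiple : ∀ i → card (multiple i) ≤ κ ^ i * card B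
      card-multiple i = ℕₚ.≤-trans (ℕₚ.≤-trans (∑-mono λ x → 𝟙-mono (multiple i) (diff (multiple i) B) λ x∈ → ∈-diff (multiple i) B x∈ b₀∈B)
        (ℕₚ.≤-reflexive (∑-⊖ b₀ (𝟙 (diff (multiple i) B))))) (multiple-diff i)

    -- S + S equals S - S because S is symmetric, and S - S is what the covering lemma produces
    -- translates of.
    W : FSet
    W = multiple 2

    private
      ∈W : ∀ {s t} → s ∈ S → t ∈ S → s ⊕ t ∈ W
      ∈W {s} {t} s∈ t∈ = subst (_∈ W) (cong (_⊕ t) (⊕-idˡ s)) (∈-sumset (multiple 1) S (∈-sumset (multiple 0) S 0∈multiple s∈) t∈)

      W∈ : ∀ {w} → w ∈ W → ∃₂ λ s t → s ∈ S × t ∈ S × w ≡ s ⊕ t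
      W∈ {w} w∈ with sumset-∈ (multiple 1) S w∈
      ... | t , t∈ , wt∈ with sumset-∈ (multiple 0) S wt∈
      ... | s , s∈ , wts∈ = s , t , s∈ , t∈ ,
            trans (solve 3 (λ w s t → w := w :- t :- s :+ (s :+ t)) refl w s t) (trans (cong (_⊕ (s ⊕ t)) (does-elim (w ⊖ t ⊖ s ≟ᶠ 0ᶠ) wts∈)) (⊕-idˡ _))

      S-S⊆W : ∀ s t → s ∈ S → t ∈ S → s ⊖ t ∈ W
      S-S⊆W s t s∈ t∈ = ∈W s∈ (S-sym t∈)

    W-sym : ∀ {w} → w ∈ W → ⊝ w ∈ W
    W-sym {w} w∈ = sym-of (W∈ w∈)
      where
      ⊝-⊕ : ∀ s t → ⊝ s ⊕ ⊝ t ≡ ⊝ (s ⊕ t)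
      ⊝-⊕ = solve 2 (λ s t → :- s :+ :- t := :- (s :+ t)) refl
      sym-of : (∃₂ λ s t → s ∈ S × t ∈ S × w ≡ s ⊕ t) → ⊝ w ∈ W
      sym-of (s , t , s∈ , t∈ , e) = subst (_∈ W) (trans (⊝-⊕ s t) (cong ⊝_ (sym e))) (∈W (S-sym s∈) (S-sym t∈))

    card-S≤card-W : card S ≤ card W
    card-S≤card-W = card-mono S W λ s s∈ → subst (_∈ W) (solve 1 (λ s → s :+ con ℤ.0ℤ := s) refl s) (∈W s∈ 0∈S)

    card-W≤ : card W ≤ κ ^ 2 * card B
    card-W≤ = card-multiple 2

    -- W + W is a fourfold sum of S and the covering lemma adds one more copy of S, whence the
    -- exponent 5; the factor 2 compares B with S.
    cover-W+W : Cover (2 * κ ^ 5) (λ z → ∃₂ λ w w′ → w ∈ W × w′ ∈ W × z ≡ w ⊕ w′) W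
    cover-W+W = proj₁ covering , proj₁ (proj₂ covering) , cover
      where
      open ℕₚ.≤-Reasoning
      small : card (multiple 5) < suc (2 * κ ^ 5) * card S
      small = begin-strict
        card (multiple 5) ≤⟨ card-multiple 5 ⟩
        κ ^ 5 * card B ≤⟨ ℕₚ.*-monoʳ-≤ (κ ^ 5) card-B≤2card-S ⟩
        κ ^ 5 * (2 * card S) ≡⟨ ℕₚ.*-assoc (κ ^ 5) 2 (card S) ⟨
        κ ^ 5 * 2 * card S ≡⟨ cong (_* card S) (ℕₚ.*-comm (κ ^ 5) 2) ⟩
        2 * κ ^ 5 * card S <⟨ ℕₚ.m<n+m (2 * κ ^ 5 * card S) 0<S ⟩
        card S + 2 * κ ^ 5 * card S ∎
      covering : Cover (2 * κ ^ 5) (_∈ multiple 4) W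
      covering = ruzsa-covering S W S-S⊆W (2 * κ ^ 5) (multiple 5) (multiple 4) (λ x s x∈ s∈ → ∈-sumset (multiple 4) S x∈ s∈) small
      assoc : ∀ w s t → w ⊕ s ⊕ t ≡ w ⊕ (s ⊕ t)
      assoc = solve 3 (λ w s t → w :+ s :+ t := w :+ (s :+ t)) refl
      ∈4W : ∀ z w w′ → w ∈ W → z ≡ w ⊕ w′ → (∃₂ λ s t → s ∈ S × t ∈ S × w′ ≡ s ⊕ t) → z ∈ multiple 4
      ∈4W z w w′ w∈ e (s , t , s∈ , t∈ , e′) = subst (_∈ multiple 4) (trans (assoc w s t) (trans (cong (w ⊕_) (sym e′)) (sym e)))
        (∈-sumset (multiple 3) S (∈-sumset W S w∈ s∈) t∈)
      cover : ∀ z → (∃₂ λ w w′ → w ∈ W × w′ ∈ W × z ≡ w ⊕ w′) → ∃ λ t → t ∈ₗ proj₁ covering × z ⊖ t ∈ W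
      cover z (w , w′ , w∈ , w′∈ , e) = proj₂ (proj₂ covering) z (∈4W z w w′ w∈ e (W∈ w′∈))

    module _ {ξ : F} (ξ≢0 : ξ ≢ 0ᶠ) (common : card B ≤ 2 * K₁ * ∑ (λ x → 𝟙 B (ξ ⁻¹ ⊗ x) * 𝟙 B x)) where

      private
        D : FSet
        D = diff (multiple 1) B

        ∈D : ∀ {s b} → s ∈ S → b ∈ B → s ⊖ b ∈ D
        ∈D {s} s∈ b∈ = ∈-diff (multiple 1) B (subst (_∈ multiple 1) (⊕-idˡ s) (∈-sumset (multiple 0) S 0∈multiple s∈)) b∈

        ξS U V : FSet
        ξS x = S (ξ ⁻¹ ⊗ x)
        U u = D (ξ ⁻¹ ⊗ u)
        V v = D (0ᶠ ⊖ v)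

        card-U : card U ≡ card D
        card-U = trans (∑-cong λ u → ℕₚ.≤-antisym (𝟙-mono U D id) (𝟙-mono D U id)) (∑-⊗ (⁻¹-nonzero ξ≢0) (𝟙 D))

        card-V : card V ≡ card D
        card-V = trans (∑-cong λ u → ℕₚ.≤-antisym (𝟙-mono V D id) (𝟙-mono D V id)) (∑-reflect 0ᶠ (𝟙 D))

        -- Ruzsa's triangle inequality through B ∩ ξ B.
        triangle : card (sumset ξS S) * card B ≤ 2 * K₁ * (card D * card D)
        triangle = ℕₚ.≤-trans (card-representations (sumset ξS S) U V (card B) (2 * K₁) represent) (ℕₚ.≤-reflexive (cong (2 * K₁ *_) (cong₂ _*_ card-U card-V)))
          where
          open ℕₚ.≤-Reasoning
          represent : ∀ e → e ∈ sumset ξS S → card B ≤ 2 * K₁ * ∑ (λ u → 𝟙 U u * 𝟙 V (e ⊖ u))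
          represent e e∈ with sumset-∈ ξS S e∈
          ... | s , s∈ , es∈ = ℕₚ.≤-trans common (ℕₚ.*-monoʳ-≤ (2 * K₁) (begin
              ∑ (λ x → 𝟙 B (ξ ⁻¹ ⊗ x) * 𝟙 B x) ≤⟨ ∑-mono each ⟩
              ∑ (λ x → 𝟙 U (e ⊖ s ⊖ x) * 𝟙 V (e ⊖ (e ⊖ s ⊖ x))) ≡⟨ ∑-reflect (e ⊖ s) (λ u → 𝟙 U u * 𝟙 V (e ⊖ u)) ⟩
              ∑ (λ u → 𝟙 U u * 𝟙 V (e ⊖ u)) ∎))
            where
            -- For x in the intersection of B and ξ B, e splits as (e - s - x) + (s + x). The first
            -- part is ξ times an element of S - B, since e - s ∈ ξ S and x ∈ ξ B; the second is
            -- minus an element of S - B by the symmetry of S.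
            each : ∀ x → 𝟙 B (ξ ⁻¹ ⊗ x) * 𝟙 B x ≤ 𝟙 U (e ⊖ s ⊖ x) * 𝟙 V (e ⊖ (e ⊖ s ⊖ x))
            each x = 𝟙*-≤ B λ ξx∈ → ℕₚ.≤-trans (𝟙-mono B V λ x∈ →
                subst (_∈ D) (solve 3 (λ e s x → :- s :- x := con ℤ.0ℤ :- (e :- (e :- s :- x))) refl e s x) (∈D (S-sym s∈) x∈))
              (ℕₚ.≤-reflexive (trans (sym (ℕₚ.*-identityˡ _)) (cong (_* 𝟙 V (e ⊖ (e ⊖ s ⊖ x))) (sym (𝟙-∈ U
                (subst (_∈ D) (solve 4 (λ g e s x → g :* (e :- s) :- g :* x := g :* (e :- s :- x)) refl (ξ ⁻¹) e s x) (∈D es∈ ξx∈)))))))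

      -- The triangle inequality gives 2 K₁, each of the two copies of S - B gives κ, and passing
      -- from B to S gives another 2.
      dilate-cover-size : ℕ
      dilate-cover-size = 4 * K₁ * κ ^ 2

      cover-ξS : Cover dilate-cover-size (_∈ ξS) W
      cover-ξS = ruzsa-covering S W S-S⊆W dilate-cover-size (sumset ξS S) ξS (λ x s x∈ s∈ → ∈-sumset ξS S x∈ s∈)
        (ℕₚ.≤-<-trans sumset≤ (ℕₚ.m<n+m (dilate-cover-size * card S) 0<S))
        where
        open ℕₚ.≤-Reasoning
        e₁ : ∀ k c b → 2 * k * (c * b * (c * b)) ≡ 2 * k * (c * c) * b * b
        e₁ = solve-∀
        e₂ : ∀ k c s → 2 * k * (c * c) * (2 * s) ≡ 4 * k * (c * (c * 1)) * s
        e₂ = solve-∀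
        D≤ : card D ≤ κ * card B
        D≤ = subst (λ c → card D ≤ c * card B) (ℕₚ.*-identityʳ κ) (multiple-diff 1)
        sumset≤ : card (sumset ξS S) ≤ dilate-cover-size * card S
        sumset≤ = begin
          card (sumset ξS S) ≤⟨ ℕₚ.*-cancelʳ-≤ _ _ (card B) (begin
            card (sumset ξS S) * card B ≤⟨ triangle ⟩
            2 * K₁ * (card D * card D) ≤⟨ ℕₚ.*-monoʳ-≤ (2 * K₁) (ℕₚ.*-mono-≤ D≤ D≤) ⟩
            2 * K₁ * (κ * card B * (κ * card B)) ≡⟨ e₁ K₁ κ (card B) ⟩
            2 * K₁ * (κ * κ) * card B * card B ∎) ⟩
          2 * K₁ * (κ * κ) * card B ≤⟨ ℕₚ.*-monoʳ-≤ (2 * K₁ * (κ * κ)) card-B≤2card-S ⟩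
          2 * K₁ * (κ * κ) * (2 * card S) ≡⟨ e₂ K₁ κ (card S) ⟩
          dilate-cover-size * card S ∎

      ξW⊆ξS+ξS : ∀ z → (∃ λ w → w ∈ W × z ≡ ξ ⊗ w) → ∃₂ λ x y → x ∈ ξS × y ∈ ξS × z ≡ x ⊕ y
      ξW⊆ξS+ξS z (w , w∈ , e) = split (W∈ w∈)
        where
        distrib : ∀ x s t → x ⊗ (s ⊕ t) ≡ x ⊗ s ⊕ x ⊗ t
        distrib = solve 3 (λ x s t → x :* (s :+ t) := x :* s :+ x :* t) refl
        split : (∃₂ λ s t → s ∈ S × t ∈ S × w ≡ s ⊕ t) → ∃₂ λ x y → x ∈ ξS × y ∈ ξS × z ≡ x ⊕ y
        split (s , t , s∈ , t∈ , e′) = ξ ⊗ s , ξ ⊗ t ,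
          subst (_∈ S) (sym (⁻¹-cancelˡ ξ≢0 s)) s∈ , subst (_∈ S) (sym (⁻¹-cancelˡ ξ≢0 t)) t∈ ,
          trans e (trans (cong (ξ ⊗_) e′) (distrib ξ s t))

-- Multipliers that nearly stabilise W, and the sum-product step

length-cartesianProductWith : ∀ {A B C : Set} (f : A → B → C) xs ys → length (cartesianProductWith f xs ys) ≡ length xs * length ys
length-cartesianProductWith f [] ys = refl
length-cartesianProductWith f (x ∷ xs) ys = trans (length-++ (map (f x) ys)) (cong₂ _+_ (length-map (f x) ys) (length-cartesianProductWith f xs ys))
  where open import Data.List.Properties using (length-++; length-map)

module Stabilizers (q : ℕ) (prime : Prime (suc q)) where

  open DifferenceSets q prime public
  open import Data.List.Membership.Propositional.Properties using (∈-cartesianProductWith⁺)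

  Sum : (F → Set) → (F → Set) → F → Set
  Sum X Y z = ∃₂ λ x y → X x × Y y × z ≡ x ⊕ y

  Dilate : F → FSet → F → Set
  Dilate ξ W z = ∃ λ w → w ∈ W × z ≡ ξ ⊗ w

  cover-mono : ∀ {m n X W} → m ≤ n → Cover m X W → Cover n X W
  cover-mono m≤n (ts , len , cov) = ts , ℕₚ.≤-trans len m≤n , cov

  cover-⊆ : ∀ {n X Y W} → (∀ z → Y z → X z) → Cover n X W → Cover n Y W
  cover-⊆ Y⊆X (ts , len , cov) = ts , len , λ z y → cov z (Y⊆X z y)

  module _ (W : FSet) (c : ℕ) (W+W : Cover c (Sum (_∈ W) (_∈ W)) W) where

    -- After subtracting the centres t and u the two summands lie in W, and their sum is within W of
    -- a centre v of the covering of W + W; the new centres are t + u + v.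
    cover-sum : ∀ {a b X Y} → Cover a X W → Cover b Y W → Cover (a * b * c) (Sum X Y) W
    cover-sum {a} {b} {X} {Y} (ts , lt , covX) (us , lu , covY) = list , len , cov
      where
      vs : List F
      vs = proj₁ W+W
      tus list : List F
      tus = cartesianProductWith _⊕_ ts us
      list = cartesianProductWith _⊕_ tus vs
      len : length list ≤ a * b * c
      len = ℕₚ.≤-trans (ℕₚ.≤-reflexive (trans (length-cartesianProductWith _⊕_ tus vs) (cong (_* length vs) (length-cartesianProductWith _⊕_ ts us))))
              (ℕₚ.*-mono-≤ (ℕₚ.*-mono-≤ lt lu) (proj₁ (proj₂ W+W)))
      regroup : ∀ x y t u v → (x ⊖ t) ⊕ (y ⊖ u) ⊖ v ≡ x ⊕ y ⊖ (t ⊕ u ⊕ v)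
      regroup = solve 5 (λ x y t u v → (x :- t) :+ (y :- u) :- v := x :+ y :- (t :+ u :+ v)) refl
      cov : ∀ z → Sum X Y z → ∃ λ t → t ∈ₗ list × z ⊖ t ∈ W
      cov z (x , y , x∈ , y∈ , e) = proj₁ τ ⊕ proj₁ U ⊕ proj₁ V ,
        ∈-cartesianProductWith⁺ _⊕_ (∈-cartesianProductWith⁺ _⊕_ (proj₁ (proj₂ τ)) (proj₁ (proj₂ U))) (proj₁ (proj₂ V)) ,
        subst (_∈ W) (trans (regroup x y (proj₁ τ) (proj₁ U) (proj₁ V)) (cong (_⊖ (proj₁ τ ⊕ proj₁ U ⊕ proj₁ V)) (sym e))) (proj₂ (proj₂ V))
        where
        τ : ∃ λ t → t ∈ₗ ts × x ⊖ t ∈ W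
        τ = covX x x∈
        U : ∃ λ u → u ∈ₗ us × y ⊖ u ∈ W
        U = covY y y∈
        V : ∃ λ v → v ∈ₗ vs × (x ⊖ proj₁ τ) ⊕ (y ⊖ proj₁ U) ⊖ v ∈ W
        V = proj₂ (proj₂ W+W) _ (_ , _ , proj₂ (proj₂ τ) , proj₂ (proj₂ U) , refl)

    module _ (W-sym : ∀ {w} → w ∈ W → ⊝ w ∈ W) (0<W : 0 < card W) where

      Stab : ℕ → F → Set
      Stab n ξ = Cover n (Dilate ξ W) W

      stab-mono : ∀ {m n ξ} → m ≤ n → Stab m ξ → Stab n ξ
      stab-mono {ξ = ξ} m≤n = cover-mono {X = Dilate ξ W} {W = W} m≤n

      stab-⊕ : ∀ {a b ξ η} → Stab a ξ → Stab b η → Stab (a * b * c) (ξ ⊕ η)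
      stab-⊕ {a} {b} {ξ} {η} Sξ Sη = cover-⊆ {X = Sum (Dilate ξ W) (Dilate η W)} {Y = Dilate (ξ ⊕ η) W} {W = W} split (cover-sum {X = Dilate ξ W} {Y = Dilate η W} Sξ Sη)
        where
        distrib : ∀ ξ η w → (ξ ⊕ η) ⊗ w ≡ ξ ⊗ w ⊕ η ⊗ w
        distrib = solve 3 (λ ξ η w → (ξ :+ η) :* w := ξ :* w :+ η :* w) refl
        split : ∀ z → Dilate (ξ ⊕ η) W z → Sum (Dilate ξ W) (Dilate η W) z
        split z (w , w∈ , e) = ξ ⊗ w , η ⊗ w , (w , w∈ , refl) , (w , w∈ , refl) , trans e (distrib ξ η w)

      -- The covering of η W leaves η w - u in W, to which the covering of ξ W applies again; the
      -- centres are ξ u + t. No covering of W + W enters, so the factor c is saved.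
      stab-⊗ : ∀ {a b ξ η} → Stab a ξ → Stab b η → Stab (a * b) (ξ ⊗ η)
      stab-⊗ {a} {b} {ξ} {η} (ts , lt , covξ) (us , lu , covη) = cartesianProductWith f ts us ,
        ℕₚ.≤-trans (ℕₚ.≤-reflexive (length-cartesianProductWith f ts us)) (ℕₚ.*-mono-≤ lt lu) , cov
        where
        f : F → F → F
        f t u = ξ ⊗ u ⊕ t
        regroup : ∀ ξ η w t u → ξ ⊗ (η ⊗ w ⊖ u) ⊖ t ≡ ξ ⊗ η ⊗ w ⊖ (ξ ⊗ u ⊕ t)
        regroup = solve 5 (λ ξ η w t u → ξ :* (η :* w :- u) :- t := ξ :* η :* w :- (ξ :* u :+ t)) refl
        cov : ∀ z → Dilate (ξ ⊗ η) W z → ∃ λ t → t ∈ₗ cartesianProductWith f ts us × z ⊖ t ∈ W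
        cov z (w , w∈ , e) = f (proj₁ τ) (proj₁ U) , ∈-cartesianProductWith⁺ f (proj₁ (proj₂ τ)) (proj₁ (proj₂ U)) ,
            subst (_∈ W) (trans (regroup ξ η w (proj₁ τ) (proj₁ U)) (cong (_⊖ f (proj₁ τ) (proj₁ U)) (sym e))) (proj₂ (proj₂ τ))
          where
          U : ∃ λ u → u ∈ₗ us × η ⊗ w ⊖ u ∈ W
          U = covη _ (w , w∈ , refl)
          τ : ∃ λ t → t ∈ₗ ts × ξ ⊗ (η ⊗ w ⊖ proj₁ U) ⊖ t ∈ W
          τ = covξ _ (_ , proj₂ (proj₂ U) , refl)

      stab-⊝ : ∀ {a ξ} → Stab a ξ → Stab a (⊝ ξ)
      stab-⊝ {a} {ξ} (ts , len , covξ) = ts , len , λ z (w , w∈ , e) →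
          covξ z (⊝ w , W-sym w∈ , trans e (flip ξ w))
        where
        flip : ∀ ξ w → ⊝ ξ ⊗ w ≡ ξ ⊗ ⊝ w
        flip = solve 2 (λ ξ w → :- ξ :* w := ξ :* (:- w)) refl

      Quotients : ℕ → Set
      Quotients n = ∀ ξ → ∃₂ λ u v → Stab n u × Stab n v × v ≢ 0ᶠ × ξ ⊗ v ≡ u

      module _ (A : FSet) (2≤A : 2 ≤ card A) (n : ℕ) (0<n : 0 < n) (c≤n : c ≤ n) (A-stab : ∀ x → x ∈ A → Stab n x) where

        private
          instance
            n≢0 : NonZero n
            n≢0 = >-nonZero 0<n

          -- Two pairs (x, y) and (x′, y′) of A × A with the same value x + ξ y. It is enough to ask
          -- y ≠ y′, since equal y would force equal x.
          Collision : F → Set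
          Collision ξ = ∃₂ λ x x′ → ∃₂ λ y y′ → x ∈ A × x′ ∈ A × y ∈ A × y′ ∈ A × y ≢ y′ × x ⊖ x′ ≡ ξ ⊗ (y′ ⊖ y)

          collision? : ∀ ξ → Dec (Collision ξ)
          collision? ξ = any? λ x → any? λ x′ → any? λ y → any? λ y′ →
            (x ∈? A) ×-dec (x′ ∈? A) ×-dec (y ∈? A) ×-dec (y′ ∈? A) ×-dec ¬? (y ≟ᶠ y′) ×-dec (x ⊖ x′ ≟ᶠ ξ ⊗ (y′ ⊖ y))

          collision-0 : Collision 0ᶠ
          collision-0 = from (2≤card⇒distinct A 2≤A)
            where
            from : (∃₂ λ x y → x ∈ A × y ∈ A × x ≢ y) → Collision 0ᶠ
            from (y , y′ , y∈ , y′∈ , y≢y′) = y , y , y , y′ , y∈ , y∈ , y∈ , y′∈ , y≢y′ ,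
              solve 2 (λ y y′ → y :- y := con ℤ.0ℤ :* (y′ :- y)) refl y y′

          difference : ∀ {x y} → x ∈ A → y ∈ A → Stab (n * n * c) (x ⊖ y)
          difference {x} {y} x∈ y∈ = stab-⊕ {ξ = x} {η = ⊝ y} (A-stab x x∈) (stab-⊝ {ξ = y} (A-stab y y∈))

          nnc≤ : n * n * c ≤ n ^ 3
          nnc≤ = ℕₚ.≤-trans (ℕₚ.*-monoʳ-≤ (n * n) c≤n) (ℕₚ.≤-reflexive (cube n))
            where cube : ∀ n → n * n * n ≡ n * (n * (n * 1))
                  cube = solve-∀

          nᵏ≤n¹³ : ∀ k → k ≤ 13 → n ^ k ≤ n ^ 13
          nᵏ≤n¹³ k k≤ = ℕₚ.^-monoʳ-≤ n k≤

          quotient : ∀ ξ → Collision ξ → ∃₂ λ u v → Stab (n * n * c) u × Stab (n * n * c) v × v ≢ 0ᶠ × ξ ⊗ v ≡ u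
          quotient ξ (x , x′ , y , y′ , x∈ , x′∈ , y∈ , y′∈ , y≢y′ , e) =
            x ⊖ x′ , y′ ⊖ y , difference x∈ x′∈ , difference y′∈ y∈ , (λ 0≡ → y≢y′ (sym (⊖≡0⇒≡ 0≡))) , sym e

          module Injective (ξ : F) (injective : ¬ Collision (ξ ⊕ 1ᶠ)) (u v : F) (u-stab : Stab (n ^ 3) u) (v-stab : Stab (n ^ 3) v) (v≢0 : v ≢ 0ᶠ) (ξv≡u : ξ ⊗ v ≡ u) where

            -- The map x + (ξ + 1) y, scaled by v, becomes v x + w y. The scaling matters because u
            -- and v, unlike ξ, are known to be good multipliers.
            w : F
            w = u ⊕ v

            A′? : ∀ z → Dec (∃₂ λ x y → x ∈ A × y ∈ A × z ≡ v ⊗ x ⊕ w ⊗ y)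
            A′? z = any? λ x → any? λ y → (x ∈? A) ×-dec (y ∈? A) ×-dec (z ≟ᶠ v ⊗ x ⊕ w ⊗ y)

            A′ : FSet
            A′ z = does (A′? z)

            coordinate : F → F → F
            coordinate z y = v ⁻¹ ⊗ (z ⊖ w ⊗ y)

            N : F → ℕ
            N z = ∑ λ y → 𝟙 A y * 𝟙 A (coordinate z y)

            N-term : ∀ z y → 0 < 𝟙 A y * 𝟙 A (coordinate z y) → y ∈ A × coordinate z y ∈ A
            N-term z y pos = 0<𝟙⇒∈ A (0<m*n⇒0<n (𝟙 A (coordinate z y)) _ (subst (0 <_) (ℕₚ.*-comm (𝟙 A y) _) pos)) ,
                             0<𝟙⇒∈ A (0<m*n⇒0<n (𝟙 A y) _ pos)

            recombine : ∀ z y → z ≡ v ⊗ coordinate z y ⊕ w ⊗ y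
            recombine z y = trans (sub z (w ⊗ y)) (cong (_⊕ w ⊗ y) (sym (⁻¹-cancelʳ v≢0 _)))
              where sub : ∀ z t → z ≡ z ⊖ t ⊕ t
                    sub = solve 2 (λ z t → z := z :- t :+ t) refl

            N-unique : ∀ z y y′ → 0 < 𝟙 A y * 𝟙 A (coordinate z y) → 0 < 𝟙 A y′ * 𝟙 A (coordinate z y′) → y ≡ y′
            N-unique z y y′ pos pos′ = decide (y ≟ᶠ y′)
              where
              x x′ : F
              x = coordinate z y
              x′ = coordinate z y′
              move : ∀ a b c d → a ⊕ b ≡ c ⊕ d → a ⊖ c ≡ d ⊖ b
              move a b c d e = trans (m₁ a b c) (trans (cong (λ s → s ⊖ c ⊖ b) e) (m₂ b c d))
                where
                m₁ : ∀ a b c → a ⊖ c ≡ a ⊕ b ⊖ c ⊖ b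
                m₁ = solve 3 (λ a b c → a :- c := a :+ b :- c :- b) refl
                m₂ : ∀ b c d → c ⊕ d ⊖ c ⊖ b ≡ d ⊖ b
                m₂ = solve 3 (λ b c d → c :+ d :- c :- b := d :- b) refl
              slope : v ⊗ (x ⊖ x′) ≡ v ⊗ ((ξ ⊕ 1ᶠ) ⊗ (y′ ⊖ y))
              slope = begin
                v ⊗ (x ⊖ x′) ≡⟨ s₁ v x x′ ⟩
                v ⊗ x ⊖ v ⊗ x′ ≡⟨ move (v ⊗ x) (w ⊗ y) (v ⊗ x′) (w ⊗ y′) (trans (sym (recombine z y)) (recombine z y′)) ⟩
                w ⊗ y′ ⊖ w ⊗ y ≡⟨ cong (λ u → (u ⊕ v) ⊗ y′ ⊖ (u ⊕ v) ⊗ y) (sym ξv≡u) ⟩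
                (ξ ⊗ v ⊕ v) ⊗ y′ ⊖ (ξ ⊗ v ⊕ v) ⊗ y ≡⟨ s₂ ξ v y′ y ⟩
                v ⊗ ((ξ ⊕ 1ᶠ) ⊗ (y′ ⊖ y)) ∎
                where
                open ≡-Reasoning
                s₁ : ∀ v x x′ → v ⊗ (x ⊖ x′) ≡ v ⊗ x ⊖ v ⊗ x′
                s₁ = solve 3 (λ v x x′ → v :* (x :- x′) := v :* x :- v :* x′) refl
                s₂ : ∀ ξ v y′ y → (ξ ⊗ v ⊕ v) ⊗ y′ ⊖ (ξ ⊗ v ⊕ v) ⊗ y ≡ v ⊗ ((ξ ⊕ 1ᶠ) ⊗ (y′ ⊖ y))
                s₂ = solve 4 (λ ξ v y′ y → (ξ :* v :+ v) :* y′ :- (ξ :* v :+ v) :* y := v :* ((ξ :+ con ℤ.1ℤ) :* (y′ :- y))) refl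
              decide : Dec (y ≡ y′) → y ≡ y′
              decide (yes e) = e
              decide (no y≢y′) = ⊥-elim (injective (x , x′ , y , y′ , proj₂ (N-term z y pos) , proj₂ (N-term z y′ pos′) ,
                proj₁ (N-term z y pos) , proj₁ (N-term z y′ pos′) , y≢y′ , ⊗-cancelˡ v≢0 slope))

            N≤𝟙 : ∀ z → N z ≤ 𝟙 A′ z
            N≤𝟙 z = decide (A′? z)
              where
              decide : Dec (∃₂ λ x y → x ∈ A × y ∈ A × z ≡ v ⊗ x ⊕ w ⊗ y) → N z ≤ 𝟙 A′ z
              decide (yes z∈) = ℕₚ.≤-trans (∑-unique _ (λ y → ℕₚ.*-mono-≤ (𝟙≤1 A y) (𝟙≤1 A _)) (N-unique z))
                (ℕₚ.≤-reflexive (sym (𝟙-∈ A′ (does-intro (A′? z) z∈))))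
              decide (no z∉) = ℕₚ.≮⇒≥ λ lt → from (∑-pos⇒∃ _ (ℕₚ.≤-<-trans z≤n lt))
                where
                from : (∃ λ y → 0 < 𝟙 A y * 𝟙 A (coordinate z y)) → ⊥
                from (y , pos) = z∉ (coordinate z y , y , proj₂ (N-term z y pos) , proj₁ (N-term z y pos) , recombine z y)

            card-A′ : card A * card A ≤ card A′
            card-A′ = begin
              card A * card A ≡⟨ ∑-*ʳ (card A) ⟨
              ∑ (λ y → 𝟙 A y * card A) ≡⟨ ∑-cong (λ y → cong (𝟙 A y *_) (trans (∑-⊖ (w ⊗ y) (λ z → 𝟙 A (v ⁻¹ ⊗ z))) (∑-⊗ (⁻¹-nonzero v≢0) (𝟙 A)))) ⟨
              ∑ (λ y → 𝟙 A y * ∑ (λ z → 𝟙 A (coordinate z y))) ≡⟨ ∑-cong (λ y → ∑-*ˡ (𝟙 A y)) ⟨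
              ∑ (λ y → ∑ λ z → 𝟙 A y * 𝟙 A (coordinate z y)) ≡⟨ ∑-swap ⟩
              ∑ N ≤⟨ ∑-mono N≤𝟙 ⟩
              card A′ ∎
              where open ℕₚ.≤-Reasoning

            w-stab : Stab (n ^ 3 * n ^ 3 * c) w
            w-stab = stab-⊕ {ξ = u} {η = v} u-stab v-stab

            -- The exponent 13: v costs 3 and w = u + v costs 3 + 3 + 1; the products with elements
            -- of A cost 4 and 8, and their sum costs one more c ≤ n.
            A′-stab : ∀ z → z ∈ A′ → Stab (n ^ 13) z
            A′-stab z z∈ = from (does-elim (A′? z) z∈)
              where
              from : (∃₂ λ x y → x ∈ A × y ∈ A × z ≡ v ⊗ x ⊕ w ⊗ y) → Stab (n ^ 13) z
              from (x , y , x∈ , y∈ , e) = subst (Stab (n ^ 13)) (sym e) (stab-mono {ξ = v ⊗ x ⊕ w ⊗ y} bound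
                  (stab-⊕ {ξ = v ⊗ x} {η = w ⊗ y} (stab-⊗ {ξ = v} {η = x} v-stab (A-stab x x∈)) (stab-⊗ {ξ = w} {η = y} w-stab (A-stab y y∈))))
                where
                open ℕₚ.≤-Reasoning
                powers : ∀ n → n * (n * (n * 1)) * n * (n * (n * (n * 1)) * (n * (n * (n * 1))) * n * n) * n ≡ n * (n * (n * (n * (n * (n * (n * (n * (n * (n * (n * (n * (n * 1))))))))))))
                powers = solve-∀
                bound : n ^ 3 * n * (n ^ 3 * n ^ 3 * c * n) * c ≤ n ^ 13
                bound = begin
                  n ^ 3 * n * (n ^ 3 * n ^ 3 * c * n) * c ≤⟨ ℕₚ.*-mono-≤ (ℕₚ.*-monoʳ-≤ (n ^ 3 * n) (ℕₚ.*-monoˡ-≤ n (ℕₚ.*-monoʳ-≤ (n ^ 3 * n ^ 3) c≤n))) c≤n ⟩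
                  n ^ 3 * n * (n ^ 3 * n ^ 3 * n * n) * n ≡⟨ powers n ⟩
                  n ^ 13 ∎

        opaque
          -- If x ↦ x + ξ y fails to be injective on A × A then ξ is a quotient of differences;
          -- otherwise some ξ fails while ξ + 1 does not, and v A + (u + v) A with ξ = u / v has |A|² elements.
          grow : Quotients (n ^ 13) ⊎ (∃ λ A′ → card A * card A ≤ card A′ × (∀ z → z ∈ A′ → Stab (n ^ 13) z))
          grow = from (successor-walk collision? collision-0)
            where
            small : n * n * c ≤ n ^ 13
            small = ℕₚ.≤-trans nnc≤ (nᵏ≤n¹³ 3 (s≤s (s≤s (s≤s z≤n))))
            enlarge : ∀ {ξ m} → n * n * c ≤ m → (∃₂ λ u v → Stab (n * n * c) u × Stab (n * n * c) v × v ≢ 0ᶠ × ξ ⊗ v ≡ u) →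
              ∃₂ λ u v → Stab m u × Stab m v × v ≢ 0ᶠ × ξ ⊗ v ≡ u
            enlarge le (u , v , su , sv , v≢0 , e) = u , v , stab-mono {ξ = u} le su , stab-mono {ξ = v} le sv , v≢0 , e
            expand : ∀ ξ → ¬ Collision (ξ ⊕ 1ᶠ) → (∃₂ λ u v → Stab (n ^ 3) u × Stab (n ^ 3) v × v ≢ 0ᶠ × ξ ⊗ v ≡ u) →
              ∃ λ A′ → card A * card A ≤ card A′ × (∀ z → z ∈ A′ → Stab (n ^ 13) z)
            expand ξ inj (u , v , su , sv , v≢0 , e) = Injective.A′ ξ inj u v su sv v≢0 e ,
              Injective.card-A′ ξ inj u v su sv v≢0 e , Injective.A′-stab ξ inj u v su sv v≢0 e
            from : (∀ ξ → Collision ξ) ⊎ (∃ λ ξ → Collision ξ × ¬ Collision (ξ ⊕ 1ᶠ)) →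
              Quotients (n ^ 13) ⊎ (∃ λ A′ → card A * card A ≤ card A′ × (∀ z → z ∈ A′ → Stab (n ^ 13) z))
            from (inj₁ all) = inj₁ λ ξ → enlarge small (quotient ξ (all ξ))
            from (inj₂ (ξ , col , inj)) = inj₂ (expand ξ inj (enlarge nnc≤ (quotient ξ col)))

      opaque
        -- As long as quotients do not fill the field the set of multipliers squares in size, so the
        -- exponent 2^i halves in each round; at i = 0 the hypothesis p < |A| is absurd.
        generate : ∀ i A n → 0 < n → c ≤ n → 2 ≤ card A → (∀ x → x ∈ A → Stab n x) → p < card A ^ (2 ^ i) → Quotients (n ^ (13 ^ i))
        generate zero A n 0<n c≤n 2≤A A-stab big = ⊥-elim (ℕₚ.<⇒≱ big (ℕₚ.≤-trans (ℕₚ.≤-reflexive (ℕₚ.*-identityʳ (card A))) (card≤p A)))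
        generate (suc i) A n 0<n c≤n 2≤A A-stab big = from (grow A 2≤A n 0<n c≤n A-stab)
          where
          instance
            n≢0 : NonZero n
            n≢0 = >-nonZero 0<n
          n≤n¹³ : n ≤ n ^ 13
          n≤n¹³ = ℕₚ.≤-trans (ℕₚ.≤-reflexive (sym (ℕₚ.*-identityʳ n))) (ℕₚ.^-monoʳ-≤ n {1} {13} (s≤s z≤n))
          from : Quotients (n ^ 13) ⊎ (∃ λ A′ → card A * card A ≤ card A′ × (∀ z → z ∈ A′ → Stab (n ^ 13) z)) → Quotients (n ^ (13 ^ suc i))
          from (inj₁ all) ξ = enlarge (all ξ)
            where
            le : n ^ 13 ≤ n ^ (13 ^ suc i)
            le = ℕₚ.^-monoʳ-≤ n (ℕₚ.m≤m*n 13 (13 ^ i) {{ℕₚ.m^n≢0 13 i}})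
            enlarge : (∃₂ λ u v → Stab (n ^ 13) u × Stab (n ^ 13) v × v ≢ 0ᶠ × ξ ⊗ v ≡ u) → ∃₂ λ u v → Stab (n ^ (13 ^ suc i)) u × Stab (n ^ (13 ^ suc i)) v × v ≢ 0ᶠ × ξ ⊗ v ≡ u
            enlarge (u , v , su , sv , v≢0 , e) = u , v , stab-mono {ξ = u} le su , stab-mono {ξ = v} le sv , v≢0 , e
          from (inj₂ (A′ , A²≤A′ , A′-stab)) = subst Quotients (ℕₚ.^-*-assoc n 13 (13 ^ i))
            (generate i A′ (n ^ 13) (ℕₚ.m^n>0 n 13) (ℕₚ.≤-trans c≤n n≤n¹³)
              (ℕₚ.≤-trans 2≤A (ℕₚ.≤-trans (ℕₚ.m≤n*m (card A) (card A) {{>-nonZero (ℕₚ.≤-trans (s≤s z≤n) 2≤A)}}) A²≤A′)) A′-stab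
              (ℕₚ.<-≤-trans big (ℕₚ.≤-trans (ℕₚ.≤-reflexive sq) (ℕₚ.^-monoˡ-≤ (2 ^ i) A²≤A′))))
            where
            sq : card A ^ (2 ^ suc i) ≡ (card A * card A) ^ (2 ^ i)
            sq = trans (sym (ℕₚ.^-*-assoc (card A) 2 (2 ^ i))) (cong (λ s → (card A * s) ^ (2 ^ i)) (ℕₚ.*-identityʳ (card A)))

      module _ (n : ℕ) (quotients : Quotients n) where

        private
          Q : ℕ
          Q = n * n * c

          ρ : F → F → ℕ
          ρ ξ y = ∑ λ a → 𝟙 W a * 𝟙 W (y ⊖ ξ ⊗ a)

          ∑ρ : ∀ ξ → ∑ (ρ ξ) ≡ card W * card W
          ∑ρ ξ = trans ∑-swap (trans (∑-cong λ a → trans (∑-*ˡ (𝟙 W a)) (cong (𝟙 W a *_) (∑-⊖ (ξ ⊗ a) (𝟙 W)))) (∑-*ʳ (card W)))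

          support : F → FSet
          support ξ y = does (0 <? ρ ξ y)

          -- The support is W + ξ W. The multiplier ξ itself is not controlled, but with ξ = u / v
          -- the scaled set is v W + u W, and both of these dilates are.
          support-small : ∀ ξ → card (support ξ) ≤ Q * card W
          support-small ξ = from (quotients ξ)
            where
            from : (∃₂ λ u v → Stab n u × Stab n v × v ≢ 0ᶠ × ξ ⊗ v ≡ u) → card (support ξ) ≤ Q * card W
            from (u , v , su , sv , v≢0 , ξv≡u) = begin
              card (support ξ) ≡⟨ ∑-⊗ (⁻¹-nonzero v≢0) (𝟙 (support ξ)) ⟨
              ∑ (λ z → 𝟙 (support ξ) (v ⁻¹ ⊗ z)) ≤⟨ ∑-mono (λ z → 𝟙-mono (support ξ) Y id) ⟩
              card Y ≤⟨ cover-card W (proj₁ covering) Y (λ z z∈ → proj₂ (proj₂ covering) z (Y-sum z z∈)) ⟩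
              length (proj₁ covering) * card W ≤⟨ ℕₚ.*-monoˡ-≤ (card W) (proj₁ (proj₂ covering)) ⟩
              Q * card W ∎
              where
              open ℕₚ.≤-Reasoning
              Y : FSet
              Y z = support ξ (v ⁻¹ ⊗ z)
              covering : Cover (n * n * c) (Sum (Dilate v W) (Dilate u W)) W
              covering = cover-sum {X = Dilate v W} {Y = Dilate u W} sv su
              Y-sum : ∀ z → z ∈ Y → Sum (Dilate v W) (Dilate u W) z
              Y-sum z z∈ = fromTerm (∑-pos⇒∃ _ (does-elim (0 <? ρ ξ (v ⁻¹ ⊗ z)) z∈))
                where
                fromTerm : (∃ λ a → 0 < 𝟙 W a * 𝟙 W (v ⁻¹ ⊗ z ⊖ ξ ⊗ a)) → Sum (Dilate v W) (Dilate u W) z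
                fromTerm (a , pos) = v ⊗ b , u ⊗ a , (b , 0<𝟙⇒∈ W (0<m*n⇒0<n (𝟙 W a) _ pos) , refl) ,
                    (a , 0<𝟙⇒∈ W (0<m*n⇒0<n (𝟙 W b) _ (subst (0 <_) (ℕₚ.*-comm (𝟙 W a) _) pos)) , refl) ,
                    trans (sym (⁻¹-cancelʳ v≢0 z)) (trans (split v (v ⁻¹ ⊗ z) ξ a) (cong (λ u → v ⊗ b ⊕ u ⊗ a) ξv≡u))
                  where
                  b : F
                  b = v ⁻¹ ⊗ z ⊖ ξ ⊗ a
                  split : ∀ v y ξ a → v ⊗ y ≡ v ⊗ (y ⊖ ξ ⊗ a) ⊕ ξ ⊗ v ⊗ a
                  split = solve 4 (λ v y ξ a → v :* y := v :* (y :- ξ :* a) :+ ξ :* v :* a) refl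

          J : F → F → ℕ
          J a b = ∑ λ ξ → ∑ λ y → 𝟙 W (y ⊖ ξ ⊗ a) * 𝟙 W (y ⊖ ξ ⊗ b)

          Diagonal : F → FSet
          Diagonal a b = does (a ≟ᶠ b)

          -- For a ≠ b, shifting y by ξ a leaves the conditions y ∈ W and y + (a - b) ξ ∈ W, and (a
          -- - b) ξ runs over the whole field. The diagonal gets the trivial bound.
          J≤ : ∀ a b → J a b ≤ card W * card W + 𝟙 (Diagonal a) b * (p * card W)
          J≤ a b = decide (a ≟ᶠ b)
            where
            open ℕₚ.≤-Reasoning
            decide : Dec (a ≡ b) → J a b ≤ card W * card W + 𝟙 (Diagonal a) b * (p * card W)
            decide (yes a≡b) = ℕₚ.m≤n⇒m≤o+n (card W * card W) (begin
              J a b ≤⟨ ∑-mono (λ ξ → ∑-mono λ y → ℕₚ.≤-trans (ℕₚ.*-monoʳ-≤ (𝟙 W (y ⊖ ξ ⊗ a)) (𝟙≤1 W (y ⊖ ξ ⊗ b))) (ℕₚ.≤-reflexive (ℕₚ.*-identityʳ _))) ⟩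
              ∑ (λ ξ → ∑ λ y → 𝟙 W (y ⊖ ξ ⊗ a)) ≡⟨ ∑-cong (λ ξ → ∑-⊖ (ξ ⊗ a) (𝟙 W)) ⟩
              ∑ (λ ξ → card W) ≡⟨ ∑-const p (card W) ⟩
              p * card W ≡⟨ ℕₚ.*-identityˡ (p * card W) ⟨
              1 * (p * card W) ≡⟨ cong (_* (p * card W)) (𝟙-∈ (Diagonal a) (does-intro (a ≟ᶠ b) a≡b)) ⟨
              𝟙 (Diagonal a) b * (p * card W) ∎)
            decide (no a≢b) = ℕₚ.m≤n⇒m≤n+o (𝟙 (Diagonal a) b * (p * card W)) (ℕₚ.≤-reflexive (begin-equality
              J a b ≡⟨ ∑-cong (λ ξ → ∑-⊕ (ξ ⊗ a) (λ y → 𝟙 W (y ⊖ ξ ⊗ a) * 𝟙 W (y ⊖ ξ ⊗ b))) ⟨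
              ∑ (λ ξ → ∑ λ y → 𝟙 W (y ⊕ ξ ⊗ a ⊖ ξ ⊗ a) * 𝟙 W (y ⊕ ξ ⊗ a ⊖ ξ ⊗ b)) ≡⟨ ∑-cong₂ (λ ξ y → cong₂ (λ s t → 𝟙 W s * 𝟙 W t) (e₁ y (ξ ⊗ a)) (e₂ y ξ a b)) ⟩
              ∑ (λ ξ → ∑ λ y → 𝟙 W y * 𝟙 W ((a ⊖ b) ⊗ ξ ⊕ y)) ≡⟨ ∑-swap ⟩
              ∑ (λ y → ∑ λ ξ → 𝟙 W y * 𝟙 W ((a ⊖ b) ⊗ ξ ⊕ y)) ≡⟨ ∑-cong (λ y → trans (∑-*ˡ (𝟙 W y)) (cong (𝟙 W y *_)
                    (trans (∑-⊗ (λ 0≡ → a≢b (⊖≡0⇒≡ 0≡)) (λ t → 𝟙 W (t ⊕ y))) (∑-⊕ y (𝟙 W))))) ⟩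
              ∑ (λ y → 𝟙 W y * card W) ≡⟨ ∑-*ʳ (card W) ⟩
              card W * card W ∎))
              where
              e₁ : ∀ y t → y ⊕ t ⊖ t ≡ y
              e₁ = solve 2 (λ y t → y :+ t :- t := y) refl
              e₂ : ∀ y ξ a b → y ⊕ ξ ⊗ a ⊖ ξ ⊗ b ≡ (a ⊖ b) ⊗ ξ ⊕ y
              e₂ = solve 4 (λ y ξ a b → y :+ ξ :* a :- ξ :* b := (a :- b) :* ξ :+ y) refl

          energy : ℕ
          energy = ∑ λ ξ → ∑ λ y → ρ ξ y * ρ ξ y

          energy≡ : energy ≡ ∑ (λ a → ∑ λ b → 𝟙 W a * 𝟙 W b * J a b)
          energy≡ = begin
            energy ≡⟨ ∑-cong₂ (λ ξ y → trans ∑-prod (∑-cong₂ λ a b → move (𝟙 W a) (𝟙 W (y ⊖ ξ ⊗ a)) (𝟙 W b) (𝟙 W (y ⊖ ξ ⊗ b)))) ⟩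
            ∑ (λ ξ → ∑ λ y → ∑ λ a → ∑ λ b → g ξ y a b) ≡⟨ ∑-cong (λ ξ → ∑-swap) ⟩
            ∑ (λ ξ → ∑ λ a → ∑ λ y → ∑ λ b → g ξ y a b) ≡⟨ ∑-swap ⟩
            ∑ (λ a → ∑ λ ξ → ∑ λ y → ∑ λ b → g ξ y a b) ≡⟨ ∑-cong (λ a → ∑-cong λ ξ → ∑-swap) ⟩
            ∑ (λ a → ∑ λ ξ → ∑ λ b → ∑ λ y → g ξ y a b) ≡⟨ ∑-cong (λ a → ∑-swap) ⟩
            ∑ (λ a → ∑ λ b → ∑ λ ξ → ∑ λ y → g ξ y a b) ≡⟨ ∑-cong₂ (λ a b → trans (∑-cong λ ξ → ∑-*ˡ (𝟙 W a * 𝟙 W b)) (∑-*ˡ (𝟙 W a * 𝟙 W b))) ⟩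
            ∑ (λ a → ∑ λ b → 𝟙 W a * 𝟙 W b * J a b) ∎
            where
            open ≡-Reasoning
            g : F → F → F → F → ℕ
            g ξ y a b = 𝟙 W a * 𝟙 W b * (𝟙 W (y ⊖ ξ ⊗ a) * 𝟙 W (y ⊖ ξ ⊗ b))
            move : ∀ a s b t → a * s * (b * t) ≡ a * b * (s * t)
            move = solve-∀

          energy≤ : energy ≤ card W * card W * (card W * card W) + p * card W * card W
          energy≤ = begin
            energy ≡⟨ energy≡ ⟩
            ∑ (λ a → ∑ λ b → 𝟙 W a * 𝟙 W b * J a b) ≤⟨ ∑-mono (λ a → ∑-mono λ b → each a b) ⟩
            ∑ (λ a → ∑ λ b → 𝟙 W a * 𝟙 W b * (card W * card W) + 𝟙 W a * (p * card W) * 𝟙 (Diagonal a) b) ≡⟨ ∑-cong (λ a → ∑-+) ⟩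
            ∑ (λ a → ∑ (λ b → 𝟙 W a * 𝟙 W b * (card W * card W)) + ∑ (λ b → 𝟙 W a * (p * card W) * 𝟙 (Diagonal a) b)) ≡⟨ ∑-+ ⟩
            ∑ (λ a → ∑ λ b → 𝟙 W a * 𝟙 W b * (card W * card W)) + ∑ (λ a → ∑ λ b → 𝟙 W a * (p * card W) * 𝟙 (Diagonal a) b)
              ≤⟨ ℕₚ.+-mono-≤ off-diagonal (∑-mono diagonal) ⟩
            card W * card W * (card W * card W) + ∑ (λ a → 𝟙 W a * (p * card W)) ≡⟨ cong (_+_ (card W * card W * (card W * card W))) (∑-*ʳ (p * card W)) ⟩
            card W * card W * (card W * card W) + card W * (p * card W) ≡⟨ cong (_+_ (card W * card W * (card W * card W))) (ℕₚ.*-comm (card W) (p * card W)) ⟩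
            card W * card W * (card W * card W) + p * card W * card W ∎
            where
            open ℕₚ.≤-Reasoning
            unique : ∀ a x y → x ∈ Diagonal a → y ∈ Diagonal a → x ≡ y
            unique a x y x∈ y∈ = trans (sym (does-elim (a ≟ᶠ x) x∈)) (does-elim (a ≟ᶠ y) y∈)
            off-diagonal : ∑ (λ a → ∑ λ b → 𝟙 W a * 𝟙 W b * (card W * card W)) ≤ card W * card W * (card W * card W)
            off-diagonal = begin
              ∑ (λ a → ∑ λ b → 𝟙 W a * 𝟙 W b * (card W * card W)) ≡⟨ ∑-cong (λ a → ∑-*ʳ (card W * card W)) ⟩
              ∑ (λ a → ∑ (λ b → 𝟙 W a * 𝟙 W b) * (card W * card W)) ≡⟨ ∑-*ʳ (card W * card W) ⟩
              ∑ (λ a → ∑ (λ b → 𝟙 W a * 𝟙 W b)) * (card W * card W) ≡⟨ cong (_* (card W * card W)) (∑-prod {f = 𝟙 W} {g = 𝟙 W}) ⟨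
              card W * card W * (card W * card W) ∎
            diagonal : ∀ a → ∑ (λ b → 𝟙 W a * (p * card W) * 𝟙 (Diagonal a) b) ≤ 𝟙 W a * (p * card W)
            diagonal a = begin
              ∑ (λ b → 𝟙 W a * (p * card W) * 𝟙 (Diagonal a) b) ≡⟨ ∑-*ˡ (𝟙 W a * (p * card W)) ⟩
              𝟙 W a * (p * card W) * card (Diagonal a) ≤⟨ ℕₚ.*-monoʳ-≤ (𝟙 W a * (p * card W)) (card-unique (Diagonal a) (unique a)) ⟩
              𝟙 W a * (p * card W) * 1 ≡⟨ ℕₚ.*-identityʳ (𝟙 W a * (p * card W)) ⟩
              𝟙 W a * (p * card W) ∎
            expand : ∀ a b w d r → a * b * (w + d * r) ≡ a * b * w + a * r * (b * d)
            expand = solve-∀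
            each : ∀ a b → 𝟙 W a * 𝟙 W b * J a b ≤ 𝟙 W a * 𝟙 W b * (card W * card W) + 𝟙 W a * (p * card W) * 𝟙 (Diagonal a) b
            each a b = begin
              𝟙 W a * 𝟙 W b * J a b ≤⟨ ℕₚ.*-monoʳ-≤ (𝟙 W a * 𝟙 W b) (J≤ a b) ⟩
              𝟙 W a * 𝟙 W b * (card W * card W + 𝟙 (Diagonal a) b * (p * card W)) ≡⟨ expand (𝟙 W a) (𝟙 W b) (card W * card W) (𝟙 (Diagonal a) b) (p * card W) ⟩
              𝟙 W a * 𝟙 W b * (card W * card W) + 𝟙 W a * (p * card W) * (𝟙 W b * 𝟙 (Diagonal a) b)
                ≤⟨ ℕₚ.+-monoʳ-≤ (𝟙 W a * 𝟙 W b * (card W * card W)) (ℕₚ.*-monoʳ-≤ (𝟙 W a * (p * card W)) (ℕₚ.≤-trans (ℕₚ.*-monoˡ-≤ (𝟙 (Diagonal a) b) (𝟙≤1 W b)) (ℕₚ.≤-reflexive (ℕₚ.*-identityˡ _)))) ⟩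
              𝟙 W a * 𝟙 W b * (card W * card W) + 𝟙 W a * (p * card W) * 𝟙 (Diagonal a) b ∎

        opaque
          -- For each ξ, Cauchy-Schwarz bounds |W|⁴ by the size of W + ξ W times the number of
          -- solutions of w₁ + ξ w₂ = w₃ + ξ w₄. Summed over all ξ those solutions number at most
          -- |W|⁴ + p |W|².
          stable-set-size : p * card W ≤ n * n * c * (p + card W * card W)
          stable-set-size = ℕₚ.*-cancelˡ-≤ (w * w * w) {{ℕₚ.m*n≢0 (w * w) w {{ℕₚ.m*n≢0 w w}}}} (begin
            w * w * w * (p * w) ≡⟨ e₁ w p ⟩
            p * (w * w * (w * w)) ≡⟨ ∑-const p (w * w * (w * w)) ⟨
            ∑ (λ (ξ : F) → w * w * (w * w)) ≤⟨ ∑-mono each ⟩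
            ∑ (λ ξ → Q * w * ∑ (λ y → ρ ξ y * ρ ξ y)) ≡⟨ ∑-*ˡ (Q * w) ⟩
            Q * w * energy ≤⟨ ℕₚ.*-monoʳ-≤ (Q * w) energy≤ ⟩
            Q * w * (w * w * (w * w) + p * w * w) ≡⟨ e₂ Q w p ⟩
            w * w * w * (Q * (p + w * w)) ∎)
            where
            open ℕₚ.≤-Reasoning
            w : ℕ
            w = card W
            instance
              w≢0 : NonZero w
              w≢0 = >-nonZero 0<W
            e₁ : ∀ w p → w * w * w * (p * w) ≡ p * (w * w * (w * w))
            e₁ = solve-∀
            e₂ : ∀ Q w p → Q * w * (w * w * (w * w) + p * w * w) ≡ w * w * w * (Q * (p + w * w))
            e₂ = solve-∀
            each : ∀ ξ → w * w * (w * w) ≤ Q * w * ∑ (λ y → ρ ξ y * ρ ξ y)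
            each ξ = begin
              w * w * (w * w) ≡⟨ cong₂ _*_ (∑ρ ξ) (∑ρ ξ) ⟨
              ∑ (ρ ξ) * ∑ (ρ ξ) ≤⟨ ∑²≤card*∑² (support ξ) (ρ ξ) (λ y pos → does-intro (0 <? ρ ξ y) pos) ⟩
              card (support ξ) * ∑ (λ y → ρ ξ y * ρ ξ y) ≤⟨ ℕₚ.*-monoˡ-≤ _ (support-small ξ) ⟩
              Q * w * ∑ (λ y → ρ ξ y * ρ ξ y) ∎

-- Bookkeeping of the losses as powers of K

module Exponents where

  -- Bounds on the losses at each stage of the sum-product argument, as exponents of the basic loss K.
  opaque
    eG : ℕ
    eG = 3 + 1 + (5 + 1 + (5 + 1))

  opaque
    eK₁ : ℕ
    eK₁ = eG + (4 + 1)

  opaque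
    eκ : ℕ
    eκ = 1 + eK₁ + eK₁

  opaque
    ec : ℕ
    ec = 1 + eκ * 5

  opaque
    eξ : ℕ
    eξ = 2 + eK₁ + eκ * 2

  opaque
    e₀ : ℕ
    e₀ = eξ + eξ + ec

  opaque
    -- The generation of quotients runs for d + 1 rounds, each of which raises the covering number
    -- to the power 13.
    eQ : ℕ → ℕ
    eQ d = e₀ * 13 ^ suc d + e₀ * 13 ^ suc d + ec

  opaque
    -- The three brackets answer three separate demands: enough multipliers in A₀, W large against
    -- Q, and the final comparison. Their sum dominates each of them.
    eTotal : ℕ → ℕ
    eTotal d = (3 + eK₁ + eK₁) + ((6 + 1 + eQ d) + (1 + eQ d + eκ * 2 + eG))

module PowerBounds (K : ℕ) (2≤K : 2 ≤ K) where

  open Exponents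

  private instance
    K≢0 : NonZero K
    K≢0 = >-nonZero (ℕₚ.≤-trans (s≤s z≤n) 2≤K)

  pow-* : ∀ {a b} i j → a ≤ K ^ i → b ≤ K ^ j → a * b ≤ K ^ (i + j)
  pow-* i j a≤ b≤ = ℕₚ.≤-trans (ℕₚ.*-mono-≤ a≤ b≤) (ℕₚ.≤-reflexive (sym (ℕₚ.^-distribˡ-+-* K i j)))

  pow-^ : ∀ {a} i n → a ≤ K ^ i → a ^ n ≤ K ^ (i * n)
  pow-^ i n a≤ = ℕₚ.≤-trans (ℕₚ.^-monoˡ-≤ n a≤) (ℕₚ.≤-reflexive (ℕₚ.^-*-assoc K i n))

  -- Absorbs numerical constants such as 8 and 32 into powers of K.
  pow-2 : ∀ i → 2 ^ i ≤ K ^ i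
  pow-2 i = ℕₚ.^-monoˡ-≤ i 2≤K

  pow-K : K ≤ K ^ 1
  pow-K = ℕₚ.≤-reflexive (sym (ℕₚ.*-identityʳ K))

  opaque
    unfolding eG

    bound-G : 8 * K * (32 * K * (32 * K)) ≤ K ^ eG
    bound-G = pow-* (3 + 1) (5 + 1 + (5 + 1)) (pow-* 3 1 (pow-2 3) pow-K)
                (pow-* (5 + 1) (5 + 1) (pow-* 5 1 (pow-2 5) pow-K) (pow-* 5 1 (pow-2 5) pow-K))

  opaque
    unfolding eK₁

    bound-K₁ : ∀ {G} → G ≤ K ^ eG → G * (16 * K) ≤ K ^ eK₁
    bound-K₁ G≤ = pow-* eG (4 + 1) G≤ (pow-* 4 1 (pow-2 4) pow-K)

  opaque
    unfolding eκ

    bound-κ : ∀ {K₁} → K₁ ≤ K ^ eK₁ → 2 * K₁ * K₁ ≤ K ^ eκ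
    bound-κ K₁≤ = pow-* (1 + eK₁) eK₁ (pow-* 1 eK₁ (pow-2 1) K₁≤) K₁≤

  opaque
    unfolding ec

    bound-c : ∀ {κ} → κ ≤ K ^ eκ → 2 * κ ^ 5 ≤ K ^ ec
    bound-c κ≤ = pow-* 1 (eκ * 5) (pow-2 1) (pow-^ eκ 5 κ≤)

  opaque
    unfolding eξ

    bound-ξ : ∀ {K₁ κ} → K₁ ≤ K ^ eK₁ → κ ≤ K ^ eκ → 4 * K₁ * κ ^ 2 ≤ K ^ eξ
    bound-ξ K₁≤ κ≤ = pow-* (2 + eK₁) (eκ * 2) (pow-* 2 eK₁ (pow-2 2) K₁≤) (pow-^ eκ 2 κ≤)

  opaque
    unfolding e₀

    bound-₀ : ∀ {n c} → n ≤ K ^ eξ → c ≤ K ^ ec → n * n * c ≤ K ^ e₀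
    bound-₀ n≤ c≤ = pow-* (eξ + eξ) ec (pow-* eξ eξ n≤ n≤) c≤

  opaque
    unfolding e₀

    c≤₀ : ∀ {c} → c ≤ K ^ ec → c ≤ K ^ e₀
    c≤₀ c≤ = ℕₚ.≤-trans c≤ (ℕₚ.^-monoʳ-≤ K (ℕₚ.m≤n+m ec (eξ + eξ)))

  opaque
    unfolding eQ

    bound-Q : ∀ d {n c} → n ≤ K ^ e₀ → c ≤ K ^ ec → n ^ (13 ^ suc d) * n ^ (13 ^ suc d) * c ≤ K ^ eQ d
    bound-Q d n≤ c≤ = pow-* (e₀ * 13 ^ suc d + e₀ * 13 ^ suc d) ec (pow-* (e₀ * 13 ^ suc d) (e₀ * 13 ^ suc d) (pow-^ e₀ (13 ^ suc d) n≤) (pow-^ e₀ (13 ^ suc d) n≤)) c≤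

  opaque
    unfolding eTotal

    total-K₁ : ∀ d {K₁} → K₁ ≤ K ^ eK₁ → 8 * K₁ * K₁ ≤ K ^ eTotal d
    total-K₁ d K₁≤ = ℕₚ.≤-trans (pow-* (3 + eK₁) eK₁ (pow-* 3 eK₁ (pow-2 3) K₁≤) K₁≤) (ℕₚ.^-monoʳ-≤ K (ℕₚ.m≤m+n (3 + eK₁ + eK₁) ((6 + 1 + eQ d) + (1 + eQ d + eκ * 2 + eG))))

  opaque
    unfolding eTotal

    total-Q : ∀ d {Q} → Q ≤ K ^ eQ d → 64 * K * Q ≤ K ^ eTotal d
    total-Q d Q≤ = ℕₚ.≤-trans (pow-* (6 + 1) (eQ d) (pow-* 6 1 (pow-2 6) pow-K) Q≤)
      (ℕₚ.^-monoʳ-≤ K (ℕₚ.≤-trans (ℕₚ.m≤m+n (6 + 1 + eQ d) (1 + eQ d + eκ * 2 + eG)) (ℕₚ.m≤n+m ((6 + 1 + eQ d) + (1 + eQ d + eκ * 2 + eG)) (3 + eK₁ + eK₁))))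

  opaque
    unfolding eTotal

    total : ∀ d {Q κ G} → Q ≤ K ^ eQ d → κ ≤ K ^ eκ → G ≤ K ^ eG → 2 * Q * κ ^ 2 * G ≤ K ^ eTotal d
    total d Q≤ κ≤ G≤ = ℕₚ.≤-trans (pow-* (1 + eQ d + eκ * 2) eG (pow-* (1 + eQ d) (eκ * 2) (pow-* 1 (eQ d) (pow-2 1) Q≤) (pow-^ eκ 2 κ≤)) G≤)
      (ℕₚ.^-monoʳ-≤ K (ℕₚ.≤-trans (ℕₚ.m≤n+m (1 + eQ d + eκ * 2 + eG) (6 + 1 + eQ d)) (ℕₚ.m≤n+m ((6 + 1 + eQ d) + (1 + eQ d + eκ * 2 + eG)) (3 + eK₁ + eK₁))))

-- A plateau function is nearly uniform

module Structure (q : ℕ) (prime : Prime (suc q)) where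

  open Stabilizers q prime public
  open Exponents

  module _
    (f : F → ℕ) (H : FSet) (m₀ K h d : ℕ) (2≤K : 2 ≤ K)
    (f≤m₀ : ∀ x → f x ≤ m₀) (0<m₀ : 0 < m₀)
    (H≢0 : ∀ {x} → x ∈ H → x ≢ 0ᶠ) (f-inv : ∀ {x} → x ∈ H → ∀ y → f (x ⊗ y) ≡ f y)
    (h≤H : h ≤ card H) (hm₀≤M : h * m₀ ≤ ∑ f)
    (large : K ^ eTotal d ≤ h) (p<hᵈ : p < (2 * h) ^ d)
    (energetic : ∑ f * ∑ f * ∑ f * m₀ ≤ K * ∑ (λ x → cor f x * cor f x)) where

    private
      open PowerBounds K 2≤K

      M G K₁ : ℕ
      M = ∑ f
      G = 8 * K * (32 * K * (32 * K))
      K₁ = G * (16 * K)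

      instance
        K≢0 : NonZero K
        K≢0 = >-nonZero (ℕₚ.≤-trans (s≤s z≤n) 2≤K)
        m₀≢0 : NonZero m₀
        m₀≢0 = >-nonZero 0<m₀

      0<K : 0 < K
      0<K = ℕₚ.≤-trans (s≤s z≤n) 2≤K
      0<h : 0 < h
      0<h = ℕₚ.<-≤-trans (ℕₚ.m^n>0 K (eTotal d)) large
      0<M : 0 < M
      0<M = ℕₚ.<-≤-trans (ℕₚ.*-mono-< 0<h 0<m₀) hm₀≤M
      0<K₁ : 0 < K₁
      0<K₁ = ℕₚ.*-mono-< (ℕₚ.*-mono-< (ℕₚ.*-mono-< {0} {8} (s≤s z≤n) 0<K) (ℕₚ.*-mono-< (ℕₚ.*-mono-< {0} {32} (s≤s z≤n) 0<K) (ℕₚ.*-mono-< {0} {32} (s≤s z≤n) 0<K))) (ℕₚ.*-mono-< {0} {16} (s≤s z≤n) 0<K)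

      instance
        M≢0 : NonZero M
        M≢0 = >-nonZero 0<M
        K₁≢0 : NonZero K₁
        K₁≢0 = >-nonZero 0<K₁

      f₄ : F → ℕ
      f₄ = cor (cor f)

      bsg : ∃ λ A → 3 * M ≤ 16 * K * (m₀ * card A) ×
        (∀ x x′ → x ∈ A → x′ ∈ A → M * M * M * m₀ ≤ 8 * K * (32 * K * (32 * K)) * f₄ (x ⊖ x′))
      bsg = BalogSzemerédiGowers.large-set-of-popular-differences f m₀ K (32 * K) refl f≤m₀ 0<K 0<m₀ 0<M energetic

      A : FSet
      A = proj₁ bsg

      M≤A : M ≤ 16 * K * (m₀ * card A)
      M≤A = ℕₚ.≤-trans (ℕₚ.m≤n*m M 3) (proj₁ (proj₂ bsg))

      0<A : 0 < card A
      0<A = 0<m*n⇒0<n m₀ (card A) (0<m*n⇒0<n (16 * K) (m₀ * card A) (ℕₚ.<-≤-trans 0<M M≤A))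

      P : FSet
      P s = does (M * M * M * m₀ ≤? G * f₄ s)

      -- Markov's inequality for f₄, whose total mass is M⁴.
      P-small₁ : card P * m₀ ≤ G * M
      P-small₁ = ℕₚ.*-cancelʳ-≤ _ _ (M * M * M) {{ℕₚ.m*n≢0 (M * M) M {{ℕₚ.m*n≢0 M M}}}} (begin
        card P * m₀ * (M * M * M) ≡⟨ e₁ (card P) m₀ M ⟩
        card P * (M * M * M * m₀) ≡⟨ ∑-*ʳ (M * M * M * m₀) ⟨
        ∑ (λ s → 𝟙 P s * (M * M * M * m₀)) ≤⟨ ∑-mono (λ s → 𝟙*-≤ P λ s∈ → does-elim (M * M * M * m₀ ≤? G * f₄ s) s∈) ⟩
        ∑ (λ s → G * f₄ s) ≡⟨ ∑-*ˡ G ⟩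
        G * ∑ f₄ ≡⟨ cong (G *_) (trans (∑-cor (cor f)) (cong₂ _*_ (∑-cor f) (∑-cor f))) ⟩
        G * (M * M * (M * M)) ≡⟨ e₂ G M ⟩
        G * M * (M * M * M) ∎)
        where
        open ℕₚ.≤-Reasoning
        e₁ : ∀ c m M → c * m * (M * M * M) ≡ c * (M * M * M * m)
        e₁ = solve-∀
        e₂ : ∀ G M → G * (M * M * (M * M)) ≡ G * M * (M * M * M)
        e₂ = solve-∀

      P-small : card P ≤ K₁ * card A
      P-small = ℕₚ.*-cancelʳ-≤ _ _ m₀ (begin
        card P * m₀ ≤⟨ P-small₁ ⟩
        G * M ≤⟨ ℕₚ.*-monoʳ-≤ G M≤A ⟩
        G * (16 * K * (m₀ * card A)) ≡⟨ e G (16 * K) m₀ (card A) ⟩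
        G * (16 * K) * card A * m₀ ∎)
        where
        open ℕₚ.≤-Reasoning
        e : ∀ G k m a → G * (k * (m * a)) ≡ G * k * a * m
        e = solve-∀

      HP : ∀ {x} → x ∈ H → ∀ y → y ∈ P → x ⊗ y ∈ P
      HP {x} x∈ y y∈ = does-intro (M * M * M * m₀ ≤? G * f₄ (x ⊗ y)) (subst (λ t → M * M * M * m₀ ≤ G * t)
        (sym (cor-dilate (H≢0 x∈) (cor f) (cor-dilate (H≢0 x∈) f (f-inv x∈)) y)) (does-elim (M * M * M * m₀ ≤? G * f₄ y) y∈))

      A-A⊆P : ∀ x y → x ∈ A → y ∈ A → x ⊖ y ∈ P
      A-A⊆P x y x∈ y∈ = does-intro (M * M * M * m₀ ≤? G * f₄ (x ⊖ y)) (proj₂ (proj₂ bsg) x y x∈ y∈)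

      overlaps : ∃₂ λ B A₀ → card B ≡ card A × (∀ x y → x ∈ B → y ∈ B → x ⊖ y ∈ P) ×
        card H ≤ 2 * K₁ * card A₀ ×
        (∀ ξ → ξ ∈ A₀ → ξ ≢ 0ᶠ × card B ≤ 2 * K₁ * ∑ (λ x → 𝟙 B (ξ ⁻¹ ⊗ x) * 𝟙 B x))
      overlaps = dilate-overlaps A P H K₁ 0<A (ℕₚ.<-≤-trans 0<h h≤H) A-A⊆P P-small H≢0 HP

      module Core (B A₀ : FSet) (B≡A : card B ≡ card A) (B-B⊆P : ∀ x y → x ∈ B → y ∈ B → x ⊖ y ∈ P)
        (H≤A₀ : card H ≤ 2 * K₁ * card A₀)
        (A₀-overlap : ∀ ξ → ξ ∈ A₀ → ξ ≢ 0ᶠ × card B ≤ 2 * K₁ * ∑ (λ x → 𝟙 B (ξ ⁻¹ ⊗ x) * 𝟙 B x)) where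

        0<B : 0 < card B
        0<B = subst (0 <_) (sym B≡A) 0<A

        P-small′ : card P ≤ K₁ * card B
        P-small′ = subst (λ a → card P ≤ K₁ * a) (sym B≡A) P-small

        V : FSet
        V = W B P K₁ 0<K₁ 0<B B-B⊆P P-small′
        k c nξ : ℕ
        k = κ B P K₁ 0<K₁ 0<B B-B⊆P P-small′
        c = 2 * k ^ 5
        nξ = 4 * K₁ * k ^ 2

        K₁≤ : K₁ ≤ K ^ eK₁
        K₁≤ = bound-K₁ bound-G
        k≤ : k ≤ K ^ eκ
        k≤ = ℕₚ.≤-trans (ℕₚ.≤-reflexive (κ-def B P K₁ 0<K₁ 0<B B-B⊆P P-small′)) (bound-κ K₁≤)
        c≤ : c ≤ K ^ ec
        c≤ = bound-c k≤

        V-cover : Cover c (Sum (_∈ V) (_∈ V)) V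
        V-cover = cover-W+W B P K₁ 0<K₁ 0<B B-B⊆P P-small′
        V-sym : ∀ {w} → w ∈ V → ⊝ w ∈ V
        V-sym = W-sym B P K₁ 0<K₁ 0<B B-B⊆P P-small′

        B≤2V : card B ≤ 2 * card V
        B≤2V = ℕₚ.≤-trans (card-B≤2card-S B P K₁ 0<K₁ 0<B B-B⊆P P-small′) (ℕₚ.*-monoʳ-≤ 2 (card-S≤card-W B P K₁ 0<K₁ 0<B B-B⊆P P-small′))
        V≤B : card V ≤ k ^ 2 * card B
        V≤B = card-W≤ B P K₁ 0<K₁ 0<B B-B⊆P P-small′
        0<V : 0 < card V
        0<V = 0<m*n⇒0<n 2 (card V) (ℕₚ.<-≤-trans 0<B B≤2V)

        n : ℕ
        n = K ^ e₀

        A₀-stab : ∀ ξ → ξ ∈ A₀ → Stab V c V-cover V-sym 0<V n ξ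
        A₀-stab ξ ξ∈ = stab-mono V c V-cover V-sym 0<V {ξ = ξ} (bound-₀ (bound-ξ K₁≤ k≤) c≤)
            (cover-⊆ {X = Sum (_∈ ξS) (_∈ ξS)} {Y = Dilate ξ V} {W = V} (ξW⊆ξS+ξS B P K₁ 0<K₁ 0<B B-B⊆P P-small′ (proj₁ (A₀-overlap ξ ξ∈)) (proj₂ (A₀-overlap ξ ξ∈)))
              (cover-sum V c V-cover {X = _∈ ξS} {Y = _∈ ξS} cov cov))
          where
          ξS : FSet
          ξS x = S B P K₁ 0<K₁ 0<B B-B⊆P P-small′ (ξ ⁻¹ ⊗ x)
          cov : Cover nξ (_∈ ξS) V
          cov = cover-ξS B P K₁ 0<K₁ 0<B B-B⊆P P-small′ (proj₁ (A₀-overlap ξ ξ∈)) (proj₂ (A₀-overlap ξ ξ∈))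

        -- Passing from H to A₀ loses the factor 2 K₁; since h is at least 8 K₁², this loss is no
        -- worse than a square root.
        2h≤A₀² : 2 * h ≤ card A₀ * card A₀
        2h≤A₀² = ℕₚ.*-cancelˡ-≤ (4 * K₁ * K₁) {{ℕₚ.m*n≢0 (4 * K₁) K₁ {{ℕₚ.m*n≢0 4 K₁}}}} (begin
          4 * K₁ * K₁ * (2 * h) ≡⟨ e₁ K₁ h ⟩
          8 * K₁ * K₁ * h ≤⟨ ℕₚ.*-monoˡ-≤ h (ℕₚ.≤-trans (total-K₁ d K₁≤) large) ⟩
          h * h ≤⟨ ℕₚ.*-mono-≤ h≤ h≤ ⟩
          2 * K₁ * card A₀ * (2 * K₁ * card A₀) ≡⟨ e₂ K₁ (card A₀) ⟩
          4 * K₁ * K₁ * (card A₀ * card A₀) ∎)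
          where
          open ℕₚ.≤-Reasoning
          h≤ : h ≤ 2 * K₁ * card A₀
          h≤ = ℕₚ.≤-trans h≤H H≤A₀
          e₁ : ∀ k h → 4 * k * k * (2 * h) ≡ 8 * k * k * h
          e₁ = solve-∀
          e₂ : ∀ k a → 2 * k * a * (2 * k * a) ≡ 4 * k * k * (a * a)
          e₂ = solve-∀

        2≤A₀ : 2 ≤ card A₀
        2≤A₀ = ℕₚ.≰⇒> λ A₀≤1 → ℕₚ.<⇒≱ (ℕₚ.≤-trans (ℕₚ.*-monoʳ-≤ 2 0<h) 2h≤A₀²) (ℕₚ.*-mono-≤ A₀≤1 A₀≤1)

        -- Using d ≤ 2^d, a power with exponent d becomes one that repeated squaring reaches; the
        -- square root lost in passing to A₀ costs the extra round in `suc d`.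
        p<A₀ : p < card A₀ ^ (2 ^ suc d)
        p<A₀ = begin-strict
          p <⟨ p<hᵈ ⟩
          (2 * h) ^ d ≤⟨ ℕₚ.^-monoʳ-≤ (2 * h) {{>-nonZero (ℕₚ.*-mono-< {0} {2} (s≤s z≤n) 0<h)}} (ℕₚ.<⇒≤ (n<2^n d)) ⟩
          (2 * h) ^ (2 ^ d) ≤⟨ ℕₚ.^-monoˡ-≤ (2 ^ d) 2h≤A₀² ⟩
          (card A₀ * card A₀) ^ (2 ^ d) ≡⟨ cong (λ s → (card A₀ * s) ^ (2 ^ d)) (ℕₚ.*-identityʳ (card A₀)) ⟨
          (card A₀ ^ 2) ^ (2 ^ d) ≡⟨ ℕₚ.^-*-assoc (card A₀) 2 (2 ^ d) ⟩
          card A₀ ^ (2 ^ suc d) ∎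
          where
          open ℕₚ.≤-Reasoning
          n<2^n : ∀ n → n < 2 ^ n
          n<2^n zero = s≤s z≤n
          n<2^n (suc n) = ℕₚ.≤-trans (ℕₚ.+-mono-≤ (ℕₚ.m^n>0 2 n) (n<2^n n)) (ℕₚ.≤-reflexive (cong (_+_ (2 ^ n)) (sym (ℕₚ.+-identityʳ (2 ^ n)))))

        N Q : ℕ
        N = n ^ (13 ^ suc d)
        Q = N * N * c

        quotients : Quotients V c V-cover V-sym 0<V N
        quotients = generate V c V-cover V-sym 0<V (suc d) A₀ n (ℕₚ.m^n>0 K e₀) (c≤₀ c≤) 2≤A₀ A₀-stab p<A₀

        size : p * card V ≤ Q * (p + card V * card V)
        size = stable-set-size V c V-cover V-sym 0<V N quotients

        Q≤ : Q ≤ K ^ eQ d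
        Q≤ = bound-Q d ℕₚ.≤-refl c≤

        2Q≤V : 2 * Q ≤ card V
        2Q≤V = ℕₚ.*-cancelˡ-≤ (32 * K) {{ℕₚ.m*n≢0 32 K}} (begin
          32 * K * (2 * Q) ≡⟨ e₁ K Q ⟩
          64 * K * Q ≤⟨ total-Q d Q≤ ⟩
          K ^ eTotal d ≤⟨ large ⟩
          h ≤⟨ ℕₚ.*-cancelʳ-≤ _ _ m₀ (begin
            h * m₀ ≤⟨ hm₀≤M ⟩
            M ≤⟨ M≤A ⟩
            16 * K * (m₀ * card A) ≡⟨ e₂ K m₀ (card A) ⟩
            16 * K * card A * m₀ ∎) ⟩
          16 * K * card A ≡⟨ cong (16 * K *_) B≡A ⟨
          16 * K * card B ≤⟨ ℕₚ.*-monoʳ-≤ (16 * K) B≤2V ⟩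
          16 * K * (2 * card V) ≡⟨ e₃ K (card V) ⟩
          32 * K * card V ∎)
          where
          open ℕₚ.≤-Reasoning
          e₁ : ∀ K Q → 32 * K * (2 * Q) ≡ 64 * K * Q
          e₁ = solve-∀
          e₂ : ∀ K m a → 16 * K * (m * a) ≡ 16 * K * a * m
          e₂ = solve-∀
          e₃ : ∀ K v → 16 * K * (2 * v) ≡ 32 * K * v
          e₃ = solve-∀

        -- In p |V| ≤ Q p + Q |V|² the term Q p is at most half of the left side, because 2 Q ≤ |V|;
        -- the lower bound on |V| exists for this absorption.
        p≤2QV : p ≤ 2 * Q * card V
        p≤2QV = ℕₚ.*-cancelʳ-≤ _ _ (card V) {{>-nonZero 0<V}} (ℕₚ.+-cancelˡ-≤ (p * card V) _ _ (absorb p (card V) Q size 2Q≤V))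
          where
          open ℕₚ.≤-Reasoning
          absorb : ∀ p v Q → p * v ≤ Q * (p + v * v) → 2 * Q ≤ v → p * v + p * v ≤ p * v + 2 * Q * v * v
          absorb p v Q h₁ h₂ = begin
            p * v + p * v ≤⟨ ℕₚ.+-mono-≤ h₁ h₁ ⟩
            Q * (p + v * v) + Q * (p + v * v) ≡⟨ e Q p v ⟩
            p * (2 * Q) + 2 * Q * v * v ≤⟨ ℕₚ.+-monoˡ-≤ (2 * Q * v * v) (ℕₚ.*-monoʳ-≤ p h₂) ⟩
            p * v + 2 * Q * v * v ∎
            where
            e : ∀ Q p v → Q * (p + v * v) + Q * (p + v * v) ≡ p * (2 * Q) + 2 * Q * v * v
            e = solve-∀

        B≤P : card B ≤ card P
        B≤P = from (0<card⇒∃∈ B 0<B)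
          where
          from : (∃ λ b → b ∈ B) → card B ≤ card P
          from (b , b∈) = ℕₚ.≤-trans (∑-mono λ x → 𝟙-mono B P λ x∈ → B-B⊆P x b x∈ b∈) (ℕₚ.≤-reflexive (∑-⊖ b (𝟙 P)))

        conclusion : p * m₀ ≤ K ^ eTotal d * M
        conclusion = begin
          p * m₀ ≤⟨ ℕₚ.*-monoˡ-≤ m₀ p≤2QV ⟩
          2 * Q * card V * m₀ ≤⟨ ℕₚ.*-monoˡ-≤ m₀ (ℕₚ.*-monoʳ-≤ (2 * Q) (ℕₚ.≤-trans V≤B (ℕₚ.*-monoʳ-≤ (k ^ 2) B≤P))) ⟩
          2 * Q * (k ^ 2 * card P) * m₀ ≡⟨ e (2 * Q) (k ^ 2) (card P) m₀ ⟩
          2 * Q * k ^ 2 * (card P * m₀) ≤⟨ ℕₚ.*-monoʳ-≤ (2 * Q * k ^ 2) P-small₁ ⟩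
          2 * Q * k ^ 2 * (G * M) ≡⟨ ℕₚ.*-assoc (2 * Q * k ^ 2) G M ⟨
          2 * Q * k ^ 2 * G * M ≤⟨ ℕₚ.*-monoˡ-≤ M (total d Q≤ k≤ bound-G) ⟩
          K ^ eTotal d * M ∎
          where
          open ℕₚ.≤-Reasoning
          e : ∀ a b c m → a * (b * c) * m ≡ a * b * (c * m)
          e = solve-∀

    opaque
      -- The quotient of mass by maximum is the effective size of the support of f. It bounds |P|
      -- from below up to G, |P| bounds |V| up to κ², and V fills the field up to 2 Q.
      nearly-uniform : p * m₀ ≤ K ^ eTotal d * ∑ f
      nearly-uniform = from overlaps
        where
        from : (∃₂ λ B A₀ → card B ≡ card A × (∀ x y → x ∈ B → y ∈ B → x ⊖ y ∈ P) × card H ≤ 2 * K₁ * card A₀ ×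
          (∀ ξ → ξ ∈ A₀ → ξ ≢ 0ᶠ × card B ≤ 2 * K₁ * ∑ (λ x → 𝟙 B (ξ ⁻¹ ⊗ x) * 𝟙 B x))) → p * m₀ ≤ K ^ eTotal d * ∑ f
        from (B , A₀ , B≡A , B-B⊆P , H≤A₀ , A₀-overlap) = Core.conclusion B A₀ B≡A B-B⊆P H≤A₀ A₀-overlap

-- Convolution operators on functions of mean zero

halve-≤ᶻ : ∀ {a b} → a ℤ.+ a ℤ.≤ b ℤ.+ b → a ℤ.≤ b
halve-≤ᶻ {a} {b} h with a ℤ.≤? b
... | yes a≤b = a≤b
... | no a≰b = contradiction h (ℤₚ.<⇒≱ (ℤₚ.+-mono-< (ℤₚ.≰⇒> a≰b) (ℤₚ.≰⇒> a≰b)))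

0≤* : ∀ {i j} → ℤ.0ℤ ℤ.≤ i → ℤ.0ℤ ℤ.≤ j → ℤ.0ℤ ℤ.≤ i ℤ.* j
0≤* {i} {j} 0≤i 0≤j = ℤₚ.*-monoʳ-≤-nonNeg j {{ℤ.nonNegative 0≤j}} 0≤i

pos-∑ : ∀ {n} (f : Fin n → ℕ) → + ∑ f ≡ ∑ᶻ.∑ (λ x → + f x)
pos-∑ {zero} f = trans (cong +_ (∑-empty f)) (sym (∑ᶻ.∑-empty (λ x → + f x)))
pos-∑ {suc n} f = begin
  + ∑ f ≡⟨ cong +_ (∑-suc f) ⟩
  + (f Fin.zero + ∑ (λ x → f (Fin.suc x))) ≡⟨ ℤₚ.pos-+ (f Fin.zero) _ ⟩
  + f Fin.zero ℤ.+ + ∑ (λ x → f (Fin.suc x)) ≡⟨ cong (ℤ._+_ (+ f Fin.zero)) (pos-∑ (λ x → f (Fin.suc x))) ⟩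
  + f Fin.zero ℤ.+ ∑ᶻ.∑ (λ x → + f (Fin.suc x)) ≡⟨ ∑ᶻ.∑-suc (λ x → + f x) ⟨
  ∑ᶻ.∑ (λ x → + f x) ∎
  where open ≡-Reasoning

∑′-const : ∀ n c → ∑ᶻ.∑ {n} (λ _ → c) ≡ + n ℤ.* c
∑′-const zero c = trans (∑ᶻ.∑-empty (λ _ → c)) (sym (ℤₚ.*-zeroˡ c))
∑′-const (suc n) c = trans (∑ᶻ.∑-suc _) (trans (cong (ℤ._+_ c) (∑′-const n c)) (sym (ℤₚ.suc-* (+ n) c)))

module Spectral (q : ℕ) (prime : Prime (suc q)) where

  open Structure q prime public
  open ∑ᶻ using () renaming (∑ to ∑′) public

  opaque
    acor : (F → ℤ) → F → ℤ
    acor g z = ∑′ λ c → g c ℤ.* g (c ⊖ z)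

    convolve : (F → ℕ) → (F → ℤ) → F → ℤ
    convolve φ g z = ∑′ λ c → + φ c ℤ.* g (z ⊖ c)

    -- The quadratic form of convolution with φ, that is, the inner product of g with φ ∗ g. Written
    -- through the autocorrelation of g, it lets a dilation of φ be moved onto g.
    pairing : (F → ℕ) → (F → ℤ) → ℤ
    pairing φ g = ∑′ λ s → + φ s ℤ.* acor g s

    acor-def : ∀ g z → acor g z ≡ ∑′ (λ c → g c ℤ.* g (c ⊖ z))
    acor-def g z = refl

    convolve-def : ∀ φ g z → convolve φ g z ≡ ∑′ (λ c → + φ c ℤ.* g (z ⊖ c))
    convolve-def φ g z = refl

    pairing-def : ∀ φ g → pairing φ g ≡ ∑′ (λ s → + φ s ℤ.* acor g s)
    pairing-def φ g = refl

  ‖_‖² : (F → ℤ) → ℤ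
  ‖ g ‖² = ∑′ λ x → g x ℤ.* g x

  0≤∑′ : {f : F → ℤ} → (∀ x → ℤ.0ℤ ℤ.≤ f x) → ℤ.0ℤ ℤ.≤ ∑′ f
  0≤∑′ {f} h = subst (ℤ._≤ ∑′ f) (∑ᶻ.∑-zero {n = p}) (∑ᶻ.∑-mono h)

  0≤‖‖² : ∀ g → ℤ.0ℤ ℤ.≤ ‖ g ‖²
  0≤‖‖² g = 0≤∑′ λ x → 0≤i*i (g x)

  acor-0 : ∀ g → acor g 0ᶠ ≡ ‖ g ‖²
  acor-0 g = trans (acor-def g 0ᶠ) (∑ᶻ.∑-cong λ c → cong (λ t → g c ℤ.* g t) (⊖0 c))
    where ⊖0 : ∀ c → c ⊖ 0ᶠ ≡ c
          ⊖0 = solve 1 (λ c → c :- con ℤ.0ℤ := c) refl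

  ∑acor : ∀ g → ∑′ (acor g) ≡ ∑′ g ℤ.* ∑′ g
  ∑acor g = begin
    ∑′ (acor g) ≡⟨ ∑ᶻ.∑-cong (acor-def g) ⟩
    ∑′ (λ z → ∑′ λ c → g c ℤ.* g (c ⊖ z)) ≡⟨ ∑ᶻ.∑-swap ⟩
    ∑′ (λ c → ∑′ λ z → g c ℤ.* g (c ⊖ z)) ≡⟨ ∑ᶻ.∑-cong (λ c → trans (∑ᶻ.∑-*ˡ (g c)) (cong (ℤ._*_ (g c)) (Reindexᶻ.∑-reflect c g))) ⟩
    ∑′ (λ c → g c ℤ.* ∑′ g) ≡⟨ ∑ᶻ.∑-*ʳ (∑′ g) ⟩
    ∑′ g ℤ.* ∑′ g ∎
    where open ≡-Reasoning

  acor-translates : ∀ g a b → ∑′ (λ c → g (c ⊕ a) ℤ.* g (c ⊕ b)) ≡ acor g (a ⊖ b)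
  acor-translates g a b = begin
    ∑′ (λ c → g (c ⊕ a) ℤ.* g (c ⊕ b)) ≡⟨ ∑ᶻ.∑-cong (λ c → cong (λ t → g (c ⊕ a) ℤ.* g t) (e a b c)) ⟩
    ∑′ (λ c → g (c ⊕ a) ℤ.* g (c ⊕ a ⊖ (a ⊖ b))) ≡⟨ Reindexᶻ.∑-⊕ a (λ y → g y ℤ.* g (y ⊖ (a ⊖ b))) ⟩
    ∑′ (λ y → g y ℤ.* g (y ⊖ (a ⊖ b))) ≡⟨ acor-def g (a ⊖ b) ⟨
    acor g (a ⊖ b) ∎
    where
    open ≡-Reasoning
    e : ∀ a b c → c ⊕ b ≡ c ⊕ a ⊖ (a ⊖ b)
    e = solve 3 (λ a b c → c :+ b := c :+ a :- (a :- b)) refl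

  pairing-convolve : ∀ φ g → pairing φ g ≡ ∑′ (λ z → g z ℤ.* convolve φ g z)
  pairing-convolve φ g = begin
    pairing φ g ≡⟨ pairing-def φ g ⟩
    ∑′ (λ s → + φ s ℤ.* acor g s) ≡⟨ ∑ᶻ.∑-cong (λ s → trans (cong (ℤ._*_ (+ φ s)) (acor-def g s)) (sym (∑ᶻ.∑-*ˡ (+ φ s)))) ⟩
    ∑′ (λ s → ∑′ λ z → + φ s ℤ.* (g z ℤ.* g (z ⊖ s))) ≡⟨ ∑ᶻ.∑-swap ⟩
    ∑′ (λ z → ∑′ λ s → + φ s ℤ.* (g z ℤ.* g (z ⊖ s))) ≡⟨ ∑ᶻ.∑-cong₂ (λ z s → move (+ φ s) (g z) (g (z ⊖ s))) ⟩
    ∑′ (λ z → ∑′ λ s → g z ℤ.* (+ φ s ℤ.* g (z ⊖ s))) ≡⟨ ∑ᶻ.∑-cong (λ z → trans (∑ᶻ.∑-*ˡ (g z)) (cong (ℤ._*_ (g z)) (sym (convolve-def φ g z)))) ⟩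
    ∑′ (λ z → g z ℤ.* convolve φ g z) ∎
    where
    open ≡-Reasoning
    move : ∀ a b c → a ℤ.* (b ℤ.* c) ≡ b ℤ.* (a ℤ.* c)
    move = solve-∀ᶻ

  -- Convolution with `cor φ` is convolution with φ composed with its adjoint.
  pairing-cor : ∀ φ g → pairing (cor φ) g ≡ ‖ convolve φ g ‖²
  pairing-cor φ g = begin
    pairing (cor φ) g ≡⟨ pairing-def (cor φ) g ⟩
    ∑′ (λ s → + cor φ s ℤ.* acor g s) ≡⟨ ∑ᶻ.∑-cong (λ s → trans (cong (λ t → + t ℤ.* acor g s) (cor-def φ s)) (trans (cong (ℤ._* acor g s) (+∑ (λ c → φ c * φ (c ⊖ s)))) (sym (∑ᶻ.∑-*ʳ (acor g s))))) ⟩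
    ∑′ (λ s → ∑′ λ c → + (φ c * φ (c ⊖ s)) ℤ.* acor g s) ≡⟨ ∑ᶻ.∑-swap ⟩
    ∑′ (λ c → ∑′ λ s → + (φ c * φ (c ⊖ s)) ℤ.* acor g s) ≡⟨ ∑ᶻ.∑-cong (λ c → sym (Reindexᶻ.∑-reflect c (λ s → + (φ c * φ (c ⊖ s)) ℤ.* acor g s))) ⟩
    ∑′ (λ c → ∑′ λ d → + (φ c * φ (c ⊖ (c ⊖ d))) ℤ.* acor g (c ⊖ d)) ≡⟨ ∑ᶻ.∑-cong₂ (λ c d → term c d) ⟩
    ∑′ (λ c → ∑′ λ d → ∑′ λ z → τ z d ℤ.* τ z c) ≡⟨ ∑ᶻ.∑-cong (λ c → ∑ᶻ.∑-swap) ⟩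
    ∑′ (λ c → ∑′ λ z → ∑′ λ d → τ z d ℤ.* τ z c) ≡⟨ ∑ᶻ.∑-swap ⟩
    ∑′ (λ z → ∑′ λ c → ∑′ λ d → τ z d ℤ.* τ z c) ≡⟨ ∑ᶻ.∑-cong (λ z → trans ∑ᶻ.∑-swap (sym (∑ᶻ.∑-prod {f = τ z} {g = τ z}))) ⟩
    ∑′ (λ z → ∑′ (τ z) ℤ.* ∑′ (τ z)) ≡⟨ ∑ᶻ.∑-cong (λ z → cong₂ ℤ._*_ (sym (convolve-def φ g z)) (sym (convolve-def φ g z))) ⟩
    ‖ convolve φ g ‖² ∎
    where
    open ≡-Reasoning
    +∑ : (f : F → ℕ) → + ∑ f ≡ ∑′ (λ x → + f x)
    +∑ = pos-∑
    τ : F → F → ℤ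
    τ z c = + φ c ℤ.* g (z ⊖ c)
    e : ∀ c d → c ⊖ (c ⊖ d) ≡ d
    e = solve 2 (λ c d → c :- (c :- d) := d) refl
    e′ : ∀ c d → ⊝ d ⊖ ⊝ c ≡ c ⊖ d
    e′ = solve 2 (λ c d → :- d :- (:- c) := c :- d) refl
    move : ∀ a b s t → a ℤ.* b ℤ.* (s ℤ.* t) ≡ b ℤ.* s ℤ.* (a ℤ.* t)
    move = solve-∀ᶻ
    term : ∀ c d → + (φ c * φ (c ⊖ (c ⊖ d))) ℤ.* acor g (c ⊖ d) ≡ ∑′ (λ z → τ z d ℤ.* τ z c)
    term c d = begin
      + (φ c * φ (c ⊖ (c ⊖ d))) ℤ.* acor g (c ⊖ d) ≡⟨ cong₂ ℤ._*_ (trans (cong (λ t → + (φ c * φ t)) (e c d)) (ℤₚ.pos-* (φ c) (φ d))) (cong (acor g) (sym (e′ c d))) ⟩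
      + φ c ℤ.* + φ d ℤ.* acor g (⊝ d ⊖ ⊝ c) ≡⟨ cong (ℤ._*_ (+ φ c ℤ.* + φ d)) (acor-translates g (⊝ d) (⊝ c)) ⟨
      + φ c ℤ.* + φ d ℤ.* ∑′ (λ z → g (z ⊖ d) ℤ.* g (z ⊖ c)) ≡⟨ ∑ᶻ.∑-*ˡ (+ φ c ℤ.* + φ d) ⟨
      ∑′ (λ z → + φ c ℤ.* + φ d ℤ.* (g (z ⊖ d) ℤ.* g (z ⊖ c))) ≡⟨ ∑ᶻ.∑-cong (λ z → move (+ φ c) (+ φ d) (g (z ⊖ d)) (g (z ⊖ c))) ⟩
      ∑′ (λ z → τ z d ℤ.* τ z c) ∎

  cauchy-schwarzᶻ : (f g : F → ℤ) → ∑′ (λ x → f x ℤ.* g x) ℤ.* ∑′ (λ x → f x ℤ.* g x) ℤ.≤ ‖ f ‖² ℤ.* ‖ g ‖²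
  cauchy-schwarzᶻ f g = halve-≤ᶻ (∑ᶻ.cauchy-schwarz₂ f g)

  -- Cauchy-Schwarz for g and φ ∗ g. Along iterated autocorrelations this is log-convexity, by which
  -- a bound for a late iterate descends to the first.
  pairing²≤ : ∀ φ g → pairing φ g ℤ.* pairing φ g ℤ.≤ ‖ g ‖² ℤ.* pairing (cor φ) g
  pairing²≤ φ g = subst₂ ℤ._≤_ (cong (λ t → t ℤ.* t) (sym (pairing-convolve φ g))) (cong (ℤ._*_ (‖ g ‖²)) (sym (pairing-cor φ g))) (cauchy-schwarzᶻ g (convolve φ g))

  module _ (g : F → ℤ) (mean-zero : ∑′ g ≡ ℤ.0ℤ) where

    private
      w : F → ℤ
      w = acor g

      overlap′ : F → F → ℤ
      overlap′ h ξ = ∑′ λ s → w (h ⊗ s) ℤ.* w (ξ ⊗ s)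

      -- The autocorrelation is positive definite, hence so is the pairing of two of its dilates.
      0≤overlap : ∀ {h} ξ → h ≢ 0ᶠ → ℤ.0ℤ ℤ.≤ overlap′ h ξ
      0≤overlap {h} ξ h≢0 = subst (ℤ.0ℤ ℤ.≤_) squares (0≤∑′ λ c → 0≤i*i (∑′ (Φ c)))
        where
        open ≡-Reasoning
        -- The squares of the sums over x of g (h x) g (c + ξ x), added up over c, expand to the
        -- overlap: both autocorrelations are then taken at dilates of the same difference x - y.
        Φ : F → F → ℤ
        Φ c x = g (h ⊗ x) ℤ.* g (c ⊕ ξ ⊗ x)
        move : ∀ a b c d → a ℤ.* b ℤ.* (c ℤ.* d) ≡ a ℤ.* c ℤ.* (b ℤ.* d)
        move = solve-∀ᶻ
        e₁ : ∀ ξ x y → ξ ⊗ x ⊖ ξ ⊗ y ≡ ξ ⊗ (x ⊖ y)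
        e₁ = solve 3 (λ ξ x y → ξ :* x :- ξ :* y := ξ :* (x :- y)) refl
        e₂ : ∀ x y → x ⊖ (x ⊖ y) ≡ y
        e₂ = solve 2 (λ x y → x :- (x :- y) := y) refl
        e₃ : ∀ h x y → h ⊗ (x ⊖ y) ≡ h ⊗ x ⊖ h ⊗ y
        e₃ = solve 3 (λ h x y → h :* (x :- y) := h :* x :- h :* y) refl
        pull : ∀ a b c → a ℤ.* b ℤ.* c ≡ c ℤ.* (a ℤ.* b)
        pull = solve-∀ᶻ
        squares : ∑′ (λ c → ∑′ (Φ c) ℤ.* ∑′ (Φ c)) ≡ overlap′ h ξ
        squares = begin
          ∑′ (λ c → ∑′ (Φ c) ℤ.* ∑′ (Φ c)) ≡⟨ ∑ᶻ.∑-cong (λ c → ∑ᶻ.∑-prod) ⟩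
          ∑′ (λ c → ∑′ λ x → ∑′ λ y → Φ c x ℤ.* Φ c y) ≡⟨ ∑ᶻ.∑-swap ⟩
          ∑′ (λ x → ∑′ λ c → ∑′ λ y → Φ c x ℤ.* Φ c y) ≡⟨ ∑ᶻ.∑-cong (λ x → ∑ᶻ.∑-swap) ⟩
          ∑′ (λ x → ∑′ λ y → ∑′ λ c → Φ c x ℤ.* Φ c y) ≡⟨ ∑ᶻ.∑-cong₂ (λ x y → begin
            ∑′ (λ c → Φ c x ℤ.* Φ c y) ≡⟨ ∑ᶻ.∑-cong (λ c → move (g (h ⊗ x)) (g (c ⊕ ξ ⊗ x)) (g (h ⊗ y)) (g (c ⊕ ξ ⊗ y))) ⟩
            ∑′ (λ c → g (h ⊗ x) ℤ.* g (h ⊗ y) ℤ.* (g (c ⊕ ξ ⊗ x) ℤ.* g (c ⊕ ξ ⊗ y))) ≡⟨ ∑ᶻ.∑-*ˡ (g (h ⊗ x) ℤ.* g (h ⊗ y)) ⟩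
            g (h ⊗ x) ℤ.* g (h ⊗ y) ℤ.* ∑′ (λ c → g (c ⊕ ξ ⊗ x) ℤ.* g (c ⊕ ξ ⊗ y)) ≡⟨ cong (ℤ._*_ (g (h ⊗ x) ℤ.* g (h ⊗ y))) (trans (acor-translates g (ξ ⊗ x) (ξ ⊗ y)) (cong w (e₁ ξ x y))) ⟩
            g (h ⊗ x) ℤ.* g (h ⊗ y) ℤ.* w (ξ ⊗ (x ⊖ y)) ∎) ⟩
          ∑′ (λ x → ∑′ λ y → g (h ⊗ x) ℤ.* g (h ⊗ y) ℤ.* w (ξ ⊗ (x ⊖ y))) ≡⟨ ∑ᶻ.∑-cong (λ x → Reindexᶻ.∑-reflect x (λ y → g (h ⊗ x) ℤ.* g (h ⊗ y) ℤ.* w (ξ ⊗ (x ⊖ y)))) ⟨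
          ∑′ (λ x → ∑′ λ y → g (h ⊗ x) ℤ.* g (h ⊗ (x ⊖ y)) ℤ.* w (ξ ⊗ (x ⊖ (x ⊖ y)))) ≡⟨ ∑ᶻ.∑-cong₂ (λ x y → trans (cong₂ (λ s t → g (h ⊗ x) ℤ.* g s ℤ.* w (ξ ⊗ t)) (e₃ h x y) (e₂ x y)) (pull (g (h ⊗ x)) (g (h ⊗ x ⊖ h ⊗ y)) (w (ξ ⊗ y)))) ⟩
          ∑′ (λ x → ∑′ λ y → w (ξ ⊗ y) ℤ.* (g (h ⊗ x) ℤ.* g (h ⊗ x ⊖ h ⊗ y))) ≡⟨ ∑ᶻ.∑-swap ⟩
          ∑′ (λ y → ∑′ λ x → w (ξ ⊗ y) ℤ.* (g (h ⊗ x) ℤ.* g (h ⊗ x ⊖ h ⊗ y))) ≡⟨ ∑ᶻ.∑-cong (λ y → trans (∑ᶻ.∑-*ˡ (w (ξ ⊗ y)))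
               (trans (cong (ℤ._*_ (w (ξ ⊗ y))) (trans (Reindexᶻ.∑-⊗ h≢0 (λ t → g t ℤ.* g (t ⊖ h ⊗ y))) (sym (acor-def g (h ⊗ y))))) (ℤₚ.*-comm (w (ξ ⊗ y)) (w (h ⊗ y))))) ⟩
          overlap′ h ξ ∎

      ∑w : ∑′ w ≡ ℤ.0ℤ
      ∑w = trans (∑acor g) (cong (λ s → s ℤ.* s) mean-zero)

      -- For s ≠ 0 the sum of w (ξ s) over all ξ is the total of w, which is the square of the total
      -- of g and hence 0. Only s = 0 survives.
      ∑overlap : ∀ h → ∑′ (overlap′ h) ≡ w 0ᶠ ℤ.* (+ p ℤ.* w 0ᶠ)
      ∑overlap h = begin
        ∑′ (λ ξ → ∑′ λ s → w (h ⊗ s) ℤ.* w (ξ ⊗ s)) ≡⟨ ∑ᶻ.∑-swap ⟩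
        ∑′ (λ s → ∑′ λ ξ → w (h ⊗ s) ℤ.* w (ξ ⊗ s)) ≡⟨ ∑ᶻ.∑-cong (λ s → ∑ᶻ.∑-*ˡ (w (h ⊗ s))) ⟩
        ∑′ (λ s → w (h ⊗ s) ℤ.* ∑′ (λ ξ → w (ξ ⊗ s))) ≡⟨ ∑ᶻ.∑-suc _ ⟩
        term Fin.zero ℤ.+ ∑′ (λ i → term (Fin.suc i)) ≡⟨ cong₂ ℤ._+_ (trans (cong term (sym 0ᶠ≡zero)) at-zero) (trans (∑ᶻ.∑-cong λ i → away (Fin.suc i) (λ e → case trans e 0ᶠ≡zero of λ ())) (∑ᶻ.∑-zero {n = q})) ⟩
        w 0ᶠ ℤ.* (+ p ℤ.* w 0ᶠ) ℤ.+ ℤ.0ℤ ≡⟨ ℤₚ.+-identityʳ _ ⟩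
        w 0ᶠ ℤ.* (+ p ℤ.* w 0ᶠ) ∎
        where
        open ≡-Reasoning
        term : F → ℤ
        term s = w (h ⊗ s) ℤ.* ∑′ (λ ξ → w (ξ ⊗ s))
        at-zero : term 0ᶠ ≡ w 0ᶠ ℤ.* (+ p ℤ.* w 0ᶠ)
        at-zero = cong₂ ℤ._*_ (cong w (zeroʳ h)) (trans (∑ᶻ.∑-cong λ ξ → cong w (zeroʳ ξ)) (∑′-const p (w 0ᶠ)))
        away : ∀ s → s ≢ 0ᶠ → term s ≡ ℤ.0ℤ
        away s s≢0 = trans (cong (ℤ._*_ (w (h ⊗ s))) (trans (∑ᶻ.∑-cong λ ξ → cong w (comm ξ s)) (trans (Reindexᶻ.∑-⊗ s≢0 w) ∑w))) (ℤₚ.*-zeroʳ (w (h ⊗ s)))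
          where comm : ∀ ξ s → ξ ⊗ s ≡ s ⊗ ξ
                comm = solve 2 (λ ξ s → ξ :* s := s :* ξ) refl

    module _ (H : FSet) (H≢0 : ∀ {x} → x ∈ H → x ≢ 0ᶠ) (φ : F → ℕ) (φ-inv : ∀ {x} → x ∈ H → ∀ y → φ (x ⊗ y) ≡ φ y) where

      private
        Ω : F → ℤ
        Ω s = ∑′ λ h → + 𝟙 H h ℤ.* w (h ⊗ s)

        𝟙-cases : ∀ (f f′ : F → ℤ) → (∀ x → x ∈ H → f x ≡ f′ x) → ∀ x → + 𝟙 H x ℤ.* f x ≡ + 𝟙 H x ℤ.* f′ x
        𝟙-cases f f′ e x with x ∈? H
        ... | yes x∈ = cong (ℤ._*_ (+ 𝟙 H x)) (e x x∈)
        ... | no x∉ = trans (cong (λ t → + t ℤ.* f x) (𝟙-∉ H x∉)) (sym (cong (λ t → + t ℤ.* f′ x) (𝟙-∉ H x∉)))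

        averaged : + card H ℤ.* pairing φ g ≡ ∑′ (λ s → + φ s ℤ.* Ω s)
        averaged = begin
          + card H ℤ.* pairing φ g ≡⟨ cong (ℤ._* pairing φ g) (pos-∑ (𝟙 H)) ⟩
          ∑′ (λ h → + 𝟙 H h) ℤ.* pairing φ g ≡⟨ ∑ᶻ.∑-*ʳ (pairing φ g) ⟨
          ∑′ (λ h → + 𝟙 H h ℤ.* pairing φ g) ≡⟨ ∑ᶻ.∑-cong (𝟙-cases (λ _ → pairing φ g) (λ h → ∑′ λ s → + φ s ℤ.* w (h ⊗ s)) dilated) ⟩
          ∑′ (λ h → + 𝟙 H h ℤ.* ∑′ λ s → + φ s ℤ.* w (h ⊗ s)) ≡⟨ ∑ᶻ.∑-cong (λ h → sym (∑ᶻ.∑-*ˡ (+ 𝟙 H h))) ⟩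
          ∑′ (λ h → ∑′ λ s → + 𝟙 H h ℤ.* (+ φ s ℤ.* w (h ⊗ s))) ≡⟨ ∑ᶻ.∑-swap ⟩
          ∑′ (λ s → ∑′ λ h → + 𝟙 H h ℤ.* (+ φ s ℤ.* w (h ⊗ s))) ≡⟨ ∑ᶻ.∑-cong₂ (λ s h → move (+ 𝟙 H h) (+ φ s) (w (h ⊗ s))) ⟩
          ∑′ (λ s → ∑′ λ h → + φ s ℤ.* (+ 𝟙 H h ℤ.* w (h ⊗ s))) ≡⟨ ∑ᶻ.∑-cong (λ s → ∑ᶻ.∑-*ˡ (+ φ s)) ⟩
          ∑′ (λ s → + φ s ℤ.* Ω s) ∎
          where
          open ≡-Reasoning
          move : ∀ a b c → a ℤ.* (b ℤ.* c) ≡ b ℤ.* (a ℤ.* c)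
          move = solve-∀ᶻ
          dilated : ∀ h → h ∈ H → pairing φ g ≡ ∑′ (λ s → + φ s ℤ.* w (h ⊗ s))
          dilated h h∈ = trans (pairing-def φ g) (trans (sym (Reindexᶻ.∑-⊗ (H≢0 h∈) (λ s → + φ s ℤ.* w s)))
            (∑ᶻ.∑-cong λ s → cong (λ t → + t ℤ.* w (h ⊗ s)) (φ-inv h∈ s)))

        -- The square expands into overlaps of pairs in H. Because overlaps with h ≠ 0 are
        -- nonnegative, the second member of the pair may range over the whole field, where the sum
        -- is known exactly; this leaves |H| where a termwise bound would leave |H|².
        ∑Ω² : ‖ Ω ‖² ℤ.≤ + card H ℤ.* (w 0ᶠ ℤ.* (+ p ℤ.* w 0ᶠ))
        ∑Ω² = begin
          ‖ Ω ‖² ≡⟨ ∑ᶻ.∑-cong (λ s → ∑ᶻ.∑-prod) ⟩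
          ∑′ (λ s → ∑′ λ h → ∑′ λ h′ → + 𝟙 H h ℤ.* w (h ⊗ s) ℤ.* (+ 𝟙 H h′ ℤ.* w (h′ ⊗ s))) ≡⟨ ∑ᶻ.∑-swap ⟩
          ∑′ (λ h → ∑′ λ s → ∑′ λ h′ → + 𝟙 H h ℤ.* w (h ⊗ s) ℤ.* (+ 𝟙 H h′ ℤ.* w (h′ ⊗ s))) ≡⟨ ∑ᶻ.∑-cong (λ h → ∑ᶻ.∑-swap) ⟩
          ∑′ (λ h → ∑′ λ h′ → ∑′ λ s → + 𝟙 H h ℤ.* w (h ⊗ s) ℤ.* (+ 𝟙 H h′ ℤ.* w (h′ ⊗ s)))
            ≡⟨ ∑ᶻ.∑-cong₂ (λ h h′ → trans (∑ᶻ.∑-cong λ s → move (+ 𝟙 H h) (w (h ⊗ s)) (+ 𝟙 H h′) (w (h′ ⊗ s))) (∑ᶻ.∑-*ˡ (+ 𝟙 H h ℤ.* + 𝟙 H h′))) ⟩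
          ∑′ (λ h → ∑′ λ h′ → + 𝟙 H h ℤ.* + 𝟙 H h′ ℤ.* overlap′ h h′) ≤⟨ ∑ᶻ.∑-mono (λ h → ∑ᶻ.∑-mono λ h′ → each h h′ (h ∈? H)) ⟩
          ∑′ (λ h → ∑′ λ h′ → + 𝟙 H h ℤ.* overlap′ h h′) ≡⟨ ∑ᶻ.∑-cong (λ h → trans (∑ᶻ.∑-*ˡ (+ 𝟙 H h)) (cong (ℤ._*_ (+ 𝟙 H h)) (∑overlap h))) ⟩
          ∑′ (λ h → + 𝟙 H h ℤ.* (w 0ᶠ ℤ.* (+ p ℤ.* w 0ᶠ))) ≡⟨ ∑ᶻ.∑-*ʳ (w 0ᶠ ℤ.* (+ p ℤ.* w 0ᶠ)) ⟩
          ∑′ (λ h → + 𝟙 H h) ℤ.* (w 0ᶠ ℤ.* (+ p ℤ.* w 0ᶠ)) ≡⟨ cong (ℤ._* (w 0ᶠ ℤ.* (+ p ℤ.* w 0ᶠ))) (pos-∑ (𝟙 H)) ⟨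
          + card H ℤ.* (w 0ᶠ ℤ.* (+ p ℤ.* w 0ᶠ)) ∎
          where
          open ℤₚ.≤-Reasoning
          move : ∀ a b c d → a ℤ.* b ℤ.* (c ℤ.* d) ≡ a ℤ.* c ℤ.* (b ℤ.* d)
          move = solve-∀ᶻ
          each : ∀ h h′ → Dec (h ∈ H) → + 𝟙 H h ℤ.* + 𝟙 H h′ ℤ.* overlap′ h h′ ℤ.≤ + 𝟙 H h ℤ.* overlap′ h h′
          each h h′ (no h∉) = subst (λ t → + t ℤ.* + 𝟙 H h′ ℤ.* overlap′ h h′ ℤ.≤ + t ℤ.* overlap′ h h′) (sym (𝟙-∉ H h∉)) ℤₚ.≤-refl
          each h h′ (yes h∈) = subst (λ t → + t ℤ.* + 𝟙 H h′ ℤ.* overlap′ h h′ ℤ.≤ + t ℤ.* overlap′ h h′) (sym (𝟙-∈ H h∈))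
            (begin
              + 1 ℤ.* + 𝟙 H h′ ℤ.* overlap′ h h′ ≡⟨ cong (ℤ._* overlap′ h h′) (ℤₚ.*-identityˡ (+ 𝟙 H h′)) ⟩
              + 𝟙 H h′ ℤ.* overlap′ h h′ ≤⟨ ℤₚ.*-monoʳ-≤-nonNeg (overlap′ h h′) {{ℤ.nonNegative (0≤overlap h′ (H≢0 h∈))}} (ℤ.+≤+ (𝟙≤1 H h′)) ⟩
              + 1 ℤ.* overlap′ h h′ ∎)

      -- Cauchy-Schwarz for φ against the average of w over H. Compared with Cauchy-Schwarz for φ
      -- and w directly, the invariance of φ gains the factor |H|.
      pairing-averaged : + card H ℤ.* (pairing φ g ℤ.* pairing φ g) ℤ.≤ + ∑ (λ s → φ s * φ s) ℤ.* (‖ g ‖² ℤ.* (+ p ℤ.* ‖ g ‖²))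
      pairing-averaged = cancel (card H) (pairing φ g ℤ.* pairing φ g) (+ ∑ (λ s → φ s * φ s)) (‖ g ‖² ℤ.* (+ p ℤ.* ‖ g ‖²)) nonneg (begin
          + card H ℤ.* (+ card H ℤ.* (pairing φ g ℤ.* pairing φ g)) ≡⟨ e₁ (+ card H) (pairing φ g) ⟩
          + card H ℤ.* pairing φ g ℤ.* (+ card H ℤ.* pairing φ g) ≡⟨ cong₂ ℤ._*_ averaged averaged ⟩
          ∑′ (λ s → + φ s ℤ.* Ω s) ℤ.* ∑′ (λ s → + φ s ℤ.* Ω s) ≤⟨ cauchy-schwarzᶻ (λ s → + φ s) Ω ⟩
          ‖ (λ s → + φ s) ‖² ℤ.* ‖ Ω ‖² ≡⟨ cong (ℤ._* ‖ Ω ‖²) (trans (∑ᶻ.∑-cong λ s → sym (ℤₚ.pos-* (φ s) (φ s))) (sym (pos-∑ (λ s → φ s * φ s)))) ⟩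
          + ∑ (λ s → φ s * φ s) ℤ.* ‖ Ω ‖² ≤⟨ ℤₚ.*-monoˡ-≤-nonNeg (+ ∑ (λ s → φ s * φ s)) ∑Ω² ⟩
          + ∑ (λ s → φ s * φ s) ℤ.* (+ card H ℤ.* (w 0ᶠ ℤ.* (+ p ℤ.* w 0ᶠ))) ≡⟨ cong (λ t → + ∑ (λ s → φ s * φ s) ℤ.* (+ card H ℤ.* (t ℤ.* (+ p ℤ.* t)))) (acor-0 g) ⟩
          + ∑ (λ s → φ s * φ s) ℤ.* (+ card H ℤ.* (‖ g ‖² ℤ.* (+ p ℤ.* ‖ g ‖²))) ≡⟨ e₂ (+ ∑ (λ s → φ s * φ s)) (+ card H) (‖ g ‖² ℤ.* (+ p ℤ.* ‖ g ‖²)) ⟩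
          + card H ℤ.* (+ ∑ (λ s → φ s * φ s) ℤ.* (‖ g ‖² ℤ.* (+ p ℤ.* ‖ g ‖²))) ∎)
        where
        open ℤₚ.≤-Reasoning
        e₁ : ∀ c x → c ℤ.* (c ℤ.* (x ℤ.* x)) ≡ c ℤ.* x ℤ.* (c ℤ.* x)
        e₁ = solve-∀ᶻ
        e₂ : ∀ s c y → s ℤ.* (c ℤ.* y) ≡ c ℤ.* (s ℤ.* y)
        e₂ = solve-∀ᶻ
        nonneg : ℤ.0ℤ ℤ.≤ + ∑ (λ s → φ s * φ s) ℤ.* (‖ g ‖² ℤ.* (+ p ℤ.* ‖ g ‖²))
        nonneg = 0≤* {+ ∑ (λ s → φ s * φ s)} {‖ g ‖² ℤ.* (+ p ℤ.* ‖ g ‖²)} (ℤ.+≤+ z≤n) (0≤* {‖ g ‖²} {+ p ℤ.* ‖ g ‖²} (0≤‖‖² g) (0≤* {+ p} {‖ g ‖²} (ℤ.+≤+ z≤n) (0≤‖‖² g)))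
        cancel : ∀ c x s y → ℤ.0ℤ ℤ.≤ s ℤ.* y → + c ℤ.* (+ c ℤ.* x) ℤ.≤ + c ℤ.* (s ℤ.* y) → + c ℤ.* x ℤ.≤ s ℤ.* y
        cancel zero x s y 0≤ h = 0≤
        cancel (suc c) x s y 0≤ h = ℤₚ.*-cancelˡ-≤-pos (+ suc c ℤ.* x) (s ℤ.* y) (+ suc c) h

-- Plateaus of iterated autocorrelations and the spectral gap

^-distrib-* : ∀ n a b → (a * b) ^ n ≡ a ^ n * b ^ n
^-distrib-* zero a b = refl
^-distrib-* (suc n) a b = trans (cong (_*_ (a * b)) (^-distrib-* n a b)) (e a b (a ^ n) (b ^ n))
  where e : ∀ a b x y → a * b * (x * y) ≡ a * x * (b * y)
        e = solve-∀

^2^suc : ∀ a j → a ^ (2 ^ suc j) ≡ a ^ (2 ^ j) * a ^ (2 ^ j)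
^2^suc a j = trans (cong (λ e → a ^ (2 ^ j + e)) (ℕₚ.+-identityʳ (2 ^ j))) (ℕₚ.^-distribˡ-+-* a (2 ^ j) (2 ^ j))

module SpectralGap (q : ℕ) (prime : Prime (suc q)) where

  open Spectral q prime public
  open Exponents using (eTotal)

  module _
    (π : F → ℕ) (H : FSet) (h K d J : ℕ) (2≤K : 2 ≤ K) (0<∑π : 0 < ∑ π)
    (H≢0 : ∀ {x} → x ∈ H → x ≢ 0ᶠ) (π-inv : ∀ {x} → x ∈ H → ∀ y → π (x ⊗ y) ≡ π y)
    (h≤H : h ≤ card H) (h-energy : h * ∑ (λ x → π x * π x) ≤ ∑ π * ∑ π)
    (large : K ^ suc (eTotal d) ≤ h) (p<hᵈ : p < (2 * h) ^ d) (p<Kᴶ : p < K ^ J) where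

    private
      instance
        K≢0 : NonZero K
        K≢0 = >-nonZero (ℕₚ.≤-trans (s≤s z≤n) 2≤K)

      -- The iteration starts at `cor π` rather than π, so that each member is largest at 0 and
      -- `top` is its maximum.
      f : ℕ → F → ℕ
      f zero = cor π
      f (suc j) = cor (f j)

      M top : ℕ → ℕ
      M j = ∑ (f j)
      top j = f j 0ᶠ

      M-suc : ∀ j → M (suc j) ≡ M j * M j
      M-suc j = ∑-cor (f j)

      f≤top : ∀ j x → f j x ≤ top j
      f≤top zero = cor-max π
      f≤top (suc j) = cor-max (f j)

      top-suc : ∀ j → top (suc j) ≡ ∑ (λ x → f j x * f j x)
      top-suc j = cor-0 (f j)

      top-suc≤ : ∀ j → ∑ (λ x → f j x * f j x) ≤ top j * M j
      top-suc≤ j = ℕₚ.≤-trans (∑-mono λ x → ℕₚ.*-monoˡ-≤ (f j x) (f≤top j x)) (ℕₚ.≤-reflexive (∑-*ˡ (top j)))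

      0<M : ∀ j → 0 < M j
      0<M zero = subst (0 <_) (sym (∑-cor π)) (ℕₚ.*-mono-< 0<∑π 0<∑π)
      0<M (suc j) = subst (0 <_) (sym (M-suc j)) (ℕₚ.*-mono-< (0<M j) (0<M j))

      M≤p*top : ∀ j → M j ≤ p * top j
      M≤p*top j = ∑≤const (f j) (f≤top j)

      0<top : ∀ j → 0 < top j
      0<top j = 0<m*n⇒0<n p (top j) (ℕₚ.<-≤-trans (0<M j) (M≤p*top j))

      -- The mass-to-maximum ratio never falls under autocorrelation: the new maximum is a sum of
      -- squares, at most old maximum times old mass, while the mass is squared.
      h*top≤M : ∀ j → h * top j ≤ M j
      h*top≤M zero = subst₂ _≤_ (cong (h *_) (sym (cor-0 π))) (sym (∑-cor π)) h-energy
      h*top≤M (suc j) = begin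
        h * top (suc j) ≡⟨ cong (h *_) (top-suc j) ⟩
        h * ∑ (λ x → f j x * f j x) ≤⟨ ℕₚ.*-monoʳ-≤ h (top-suc≤ j) ⟩
        h * (top j * M j) ≡⟨ ℕₚ.*-assoc h (top j) (M j) ⟨
        h * top j * M j ≤⟨ ℕₚ.*-monoˡ-≤ (M j) (h*top≤M j) ⟩
        M j * M j ≡⟨ M-suc j ⟨
        M (suc j) ∎
        where open ℕₚ.≤-Reasoning

      f-inv : ∀ j {x} → x ∈ H → ∀ y → f j (x ⊗ y) ≡ f j y
      f-inv zero x∈ = cor-dilate (H≢0 x∈) π (π-inv x∈)
      f-inv (suc j) x∈ = cor-dilate (H≢0 x∈) (f j) (f-inv j x∈)

      -- Since `top (suc (suc j))` is the sum of the squares of `cor (f j)`, this is precisely the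
      -- energy hypothesis of the Balog-Szemerédi-Gowers step for f j.
      Plateau : ℕ → Set
      Plateau j = M j * M j * M j * top j ≤ K * top (suc (suc j))

      -- top j / M j loses a factor K every two steps until a plateau is reached, and it is at least 1 / p.
      search : ∀ i j s → s * top j ≤ M j → (∃ λ j′ → j′ < j + (i + i) × Plateau j′) ⊎ K ^ i * s ≤ p
      search zero j s bound = inj₂ (ℕₚ.≤-trans (ℕₚ.≤-reflexive (ℕₚ.*-identityˡ s))
        (ℕₚ.*-cancelʳ-≤ s p (top j) {{>-nonZero (0<top j)}} (ℕₚ.≤-trans bound (M≤p*top j))))
      search (suc i) j s bound = decide (M j * M j * M j * top j ≤? K * top (suc (suc j)))
        where
        open ℕₚ.≤-Reasoning
        shift : suc (suc j) + (i + i) ≡ j + (suc i + suc i)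
        shift = e j i
          where e : ∀ j i → suc (suc j) + (i + i) ≡ j + (suc i + suc i)
                e = solve-∀
        later : (∃ λ j′ → j′ < suc (suc j) + (i + i) × Plateau j′) ⊎ K ^ i * (K * s) ≤ p →
                (∃ λ j′ → j′ < j + (suc i + suc i) × Plateau j′) ⊎ K ^ suc i * s ≤ p
        later (inj₁ (j′ , j′< , pl)) = inj₁ (j′ , subst (j′ <_) shift j′< , pl)
        later (inj₂ le) = inj₂ (subst (_≤ p) (e (K ^ i) K s) le)
          where e : ∀ a K s → a * (K * s) ≡ K * a * s
                e = solve-∀
        decide : Dec (Plateau j) → (∃ λ j′ → j′ < j + (suc i + suc i) × Plateau j′) ⊎ K ^ suc i * s ≤ p
        decide (yes pl) = inj₁ (j , ℕₚ.m<m+n j (s≤s z≤n) , pl)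
        decide (no ¬pl) = later (search i (suc (suc j)) (K * s) (begin
          K * s * top (suc (suc j)) ≡⟨ e₁ K s (top (suc (suc j))) ⟩
          s * (K * top (suc (suc j))) ≤⟨ ℕₚ.*-monoʳ-≤ s (ℕₚ.≰⇒≥ ¬pl) ⟩
          s * (M j * M j * M j * top j) ≡⟨ e₂ s (M j) (top j) ⟩
          M j * M j * M j * (s * top j) ≤⟨ ℕₚ.*-monoʳ-≤ (M j * M j * M j) bound ⟩
          M j * M j * M j * M j ≡⟨ ℕₚ.*-assoc (M j * M j) (M j) (M j) ⟩
          M j * M j * (M j * M j) ≡⟨ trans (M-suc (suc j)) (cong₂ _*_ (M-suc j) (M-suc j)) ⟨
          M (suc (suc j)) ∎))
          where
          e₁ : ∀ K s t → K * s * t ≡ s * (K * t)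
          e₁ = solve-∀
          e₂ : ∀ s M t → s * (M * M * M * t) ≡ M * M * M * (s * t)
          e₂ = solve-∀

      plateau : ∃ λ j → j < J + J × Plateau j
      plateau = from (search J 0 1 (ℕₚ.≤-trans (ℕₚ.≤-reflexive (ℕₚ.*-identityˡ (top 0))) (term≤∑ (f 0) 0ᶠ)))
        where
        from : (∃ λ j → j < J + J × Plateau j) ⊎ K ^ J * 1 ≤ p → ∃ λ j → j < J + J × Plateau j
        from (inj₁ w) = w
        from (inj₂ le) = contradiction p<Kᴶ (ℕₚ.≤⇒≯ (subst (_≤ p) (ℕₚ.*-identityʳ (K ^ J)) le))

      module At (j : ℕ) (pl : Plateau j) where

        C : ℕ
        C = eTotal d

        uniform : p * top j ≤ K ^ C * M j
        uniform = nearly-uniform (f j) H (top j) K h d 2≤K (f≤top j) (0<top j) H≢0 (f-inv j) h≤H (h*top≤M j)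
          (ℕₚ.≤-trans (ℕₚ.m≤n*m (K ^ C) K) large) p<hᵈ
          (subst (λ t → M j * M j * M j * top j ≤ K * t) (top-suc (suc j)) pl)

        module _ (g : F → ℤ) (mean-zero : ∑′ g ≡ ℤ.0ℤ) (0<g : 0 < ℤ.∣ ‖ g ‖² ∣) where

          α β : ℕ
          α = ℤ.∣ ‖ convolve π g ‖² ∣
          β = ℤ.∣ ‖ g ‖² ∣
          θ : ℕ → ℕ
          θ i = ℤ.∣ pairing (f i) g ∣

          0≤pairing-cor : ∀ φ → ℤ.0ℤ ℤ.≤ pairing (cor φ) g
          0≤pairing-cor φ = subst (ℤ.0ℤ ℤ.≤_) (sym (pairing-cor φ g)) (0≤‖‖² (convolve φ g))

          0≤pairing : ∀ i → ℤ.0ℤ ℤ.≤ pairing (f i) g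
          0≤pairing zero = 0≤pairing-cor π
          0≤pairing (suc i) = 0≤pairing-cor (f i)

          +θ : ∀ i → + θ i ≡ pairing (f i) g
          +θ i = ℤₚ.0≤i⇒+∣i∣≡i (0≤pairing i)
          +β : + β ≡ ‖ g ‖²
          +β = ℤₚ.0≤i⇒+∣i∣≡i (0≤‖‖² g)

          θ₀ : θ 0 ≡ α
          θ₀ = cong ℤ.∣_∣ (pairing-cor π g)

          log-convex : ∀ i → θ i * θ i ≤ β * θ (suc i)
          log-convex i = ℤₚ.drop‿+≤+ (subst₂ ℤ._≤_
            (trans (sym (cong₂ ℤ._*_ (+θ i) (+θ i))) (sym (ℤₚ.pos-* (θ i) (θ i))))
            (trans (sym (cong₂ ℤ._*_ +β (+θ (suc i)))) (sym (ℤₚ.pos-* β (θ (suc i)))))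
            (pairing²≤ (f i) g))

          averaged : h * (θ j * θ j) ≤ ∑ (λ x → f j x * f j x) * (β * (p * β))
          averaged = ℕₚ.≤-trans (ℕₚ.*-monoˡ-≤ (θ j * θ j) h≤H) (ℤₚ.drop‿+≤+ (subst₂ ℤ._≤_
            (trans (cong (ℤ._*_ (+ card H)) (trans (sym (cong₂ ℤ._*_ (+θ j) (+θ j))) (sym (ℤₚ.pos-* (θ j) (θ j))))) (sym (ℤₚ.pos-* (card H) (θ j * θ j))))
            (trans (cong (ℤ._*_ (+ E)) (trans (cong₂ (λ s t → s ℤ.* (+ p ℤ.* t)) (sym +β) (sym +β)) (trans (cong (ℤ._*_ (+ β)) (sym (ℤₚ.pos-* p β))) (sym (ℤₚ.pos-* β (p * β)))))) (sym (ℤₚ.pos-* E (β * (p * β)))))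
            (pairing-averaged g mean-zero H H≢0 (f j) (f-inv j))))
            where
            E : ℕ
            E = ∑ (λ x → f j x * f j x)

          -- Iterated log-convexity with denominators cleared: (α / β)^(2^i) ≤ θ i / β.
          powers : ∀ i → α ^ (2 ^ i) * β ≤ β ^ (2 ^ i) * θ i
          powers zero = ℕₚ.≤-reflexive (trans (cong (_* β) (ℕₚ.*-identityʳ α)) (trans (ℕₚ.*-comm α β) (cong₂ _*_ (sym (ℕₚ.*-identityʳ β)) (sym θ₀))))
          powers (suc i) = ℕₚ.*-cancelʳ-≤ _ _ β {{>-nonZero 0<g}} (begin
            α ^ (2 ^ suc i) * β * β ≡⟨ cong (λ t → t * β * β) (^2^suc α i) ⟩
            X * X * β * β ≡⟨ e₁ X β ⟩
            X * β * (X * β) ≤⟨ ℕₚ.*-mono-≤ (powers i) (powers i) ⟩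
            Y * θ i * (Y * θ i) ≡⟨ e₂ Y (θ i) ⟩
            Y * Y * (θ i * θ i) ≤⟨ ℕₚ.*-monoʳ-≤ (Y * Y) (log-convex i) ⟩
            Y * Y * (β * θ (suc i)) ≡⟨ e₃ (Y * Y) β (θ (suc i)) ⟩
            Y * Y * θ (suc i) * β ≡⟨ cong (λ t → t * θ (suc i) * β) (^2^suc β i) ⟨
            β ^ (2 ^ suc i) * θ (suc i) * β ∎)
            where
            open ℕₚ.≤-Reasoning
            X Y : ℕ
            X = α ^ (2 ^ i)
            Y = β ^ (2 ^ i)
            e₁ : ∀ x b → x * x * b * b ≡ x * b * (x * b)
            e₁ = solve-∀
            e₂ : ∀ y t → y * t * (y * t) ≡ y * y * (t * t)
            e₂ = solve-∀
            e₃ : ∀ y b t → y * (b * t) ≡ y * t * b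
            e₃ = solve-∀

          M-power : ∀ i → M i ≡ (∑ π * ∑ π) ^ (2 ^ i)
          M-power zero = trans (∑-cor π) (sym (ℕₚ.*-identityʳ (∑ π * ∑ π)))
          M-power (suc i) = trans (M-suc i) (trans (cong₂ _*_ (M-power i) (M-power i)) (sym (^2^suc (∑ π * ∑ π) i)))

          -- At the plateau h θ² ≤ `top` M p β², and near uniformity replaces p `top` by K^C M. As h
          -- is at least K^(C + 1), exactly one factor K is left as the gain.
          gap : K * α ^ (2 ^ suc j) ≤ (∑ π * ∑ π * β) ^ (2 ^ suc j)
          gap = ℕₚ.*-cancelˡ-≤ (K ^ C * (β * β)) {{ℕₚ.m*n≢0 (K ^ C) (β * β) {{ℕₚ.m^n≢0 K C}} {{ℕₚ.m*n≢0 β β {{>-nonZero 0<g}} {{>-nonZero 0<g}}}}}} (begin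
            K ^ C * (β * β) * (K * α ^ (2 ^ suc j)) ≡⟨ cong (λ t → K ^ C * (β * β) * (K * t)) (^2^suc α j) ⟩
            K ^ C * (β * β) * (K * (X * X)) ≡⟨ e₁ (K ^ C) β K X ⟩
            K * K ^ C * (X * β * (X * β)) ≤⟨ ℕₚ.*-mono-≤ large (ℕₚ.*-mono-≤ (powers j) (powers j)) ⟩
            h * (Y * θ j * (Y * θ j)) ≡⟨ e₂ h Y (θ j) ⟩
            Y * Y * (h * (θ j * θ j)) ≤⟨ ℕₚ.*-monoʳ-≤ (Y * Y) (ℕₚ.≤-trans averaged (ℕₚ.*-monoˡ-≤ (β * (p * β)) (top-suc≤ j))) ⟩
            Y * Y * (top j * M j * (β * (p * β))) ≡⟨ e₃ Y (top j) (M j) β p ⟩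
            Y * Y * (M j * (β * β)) * (p * top j) ≤⟨ ℕₚ.*-monoʳ-≤ (Y * Y * (M j * (β * β))) uniform ⟩
            Y * Y * (M j * (β * β)) * (K ^ C * M j) ≡⟨ e₄ Y (M j) β (K ^ C) ⟩
            K ^ C * (β * β) * (M j * M j * (Y * Y)) ≡⟨ cong (K ^ C * (β * β) *_) (cong₂ (λ s t → s * t) (trans (cong₂ _*_ (M-power j) (M-power j)) (sym (^2^suc (∑ π * ∑ π) j))) (sym (^2^suc β j))) ⟩
            K ^ C * (β * β) * ((∑ π * ∑ π) ^ (2 ^ suc j) * β ^ (2 ^ suc j)) ≡⟨ cong (K ^ C * (β * β) *_) (^-distrib-* (2 ^ suc j) (∑ π * ∑ π) β) ⟨
            K ^ C * (β * β) * (∑ π * ∑ π * β) ^ (2 ^ suc j) ∎)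
            where
            open ℕₚ.≤-Reasoning
            X Y : ℕ
            X = α ^ (2 ^ j)
            Y = β ^ (2 ^ j)
            e₁ : ∀ C b K X → C * (b * b) * (K * (X * X)) ≡ K * C * (X * b * (X * b))
            e₁ = solve-∀
            e₂ : ∀ h y t → h * (y * t * (y * t)) ≡ y * y * (h * (t * t))
            e₂ = solve-∀
            e₃ : ∀ Y t M b p → Y * Y * (t * M * (b * (p * b))) ≡ Y * Y * (M * (b * b)) * (p * t)
            e₃ = solve-∀
            e₄ : ∀ Y M b C → Y * Y * (M * (b * b)) * (C * M) ≡ C * (b * b) * (M * M * (Y * Y))
            e₄ = solve-∀

    opaque
      spectral-gap : ∃ λ j → j < J + J × (∀ g → ∑′ g ≡ ℤ.0ℤ → 0 < ℤ.∣ ‖ g ‖² ∣ →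
        K * ℤ.∣ ‖ convolve π g ‖² ∣ ^ (2 ^ suc j) ≤ (∑ π * ∑ π * ℤ.∣ ‖ g ‖² ∣) ^ (2 ^ suc j))
      spectral-gap = from plateau
        where
        from : (∃ λ j → j < J + J × Plateau j) → ∃ λ j → j < J + J × (∀ g → ∑′ g ≡ ℤ.0ℤ → 0 < ℤ.∣ ‖ g ‖² ∣ →
          K * ℤ.∣ ‖ convolve π g ‖² ∣ ^ (2 ^ suc j) ≤ (∑ π * ∑ π * ℤ.∣ ‖ g ‖² ∣) ^ (2 ^ suc j))
        from (j , j< , pl) = j , j< , λ g mz 0<g → At.gap j pl g mz 0<g

-- Polynomial roots and the m-th power map

∑′-single : ∀ {n} (f : Fin n → ℤ) (a : Fin n) → (∀ x → x ≢ a → f x ≡ ℤ.0ℤ) → ∑ᶻ.∑ f ≡ f a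
∑′-single {suc n} f Fin.zero h = begin
  ∑ᶻ.∑ f ≡⟨ ∑ᶻ.∑-suc f ⟩
  f Fin.zero ℤ.+ ∑ᶻ.∑ (λ x → f (Fin.suc x)) ≡⟨ cong (ℤ._+_ (f Fin.zero)) (trans (∑ᶻ.∑-cong λ x → h (Fin.suc x) λ ()) (∑ᶻ.∑-zero {n = n})) ⟩
  f Fin.zero ℤ.+ ℤ.0ℤ ≡⟨ ℤₚ.+-identityʳ (f Fin.zero) ⟩
  f Fin.zero ∎
  where open ≡-Reasoning
∑′-single {suc n} f (Fin.suc a) h = begin
  ∑ᶻ.∑ f ≡⟨ ∑ᶻ.∑-suc f ⟩
  f Fin.zero ℤ.+ ∑ᶻ.∑ (λ x → f (Fin.suc x)) ≡⟨ cong₂ ℤ._+_ (h Fin.zero λ ()) (∑′-single (λ x → f (Fin.suc x)) a λ x x≢a → h (Fin.suc x) λ e → x≢a (Data.Fin.Properties.suc-injective e)) ⟩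
  ℤ.0ℤ ℤ.+ f (Fin.suc a) ≡⟨ ℤₚ.+-identityˡ (f (Fin.suc a)) ⟩
  f (Fin.suc a) ∎
  where open ≡-Reasoning

module Powers (q : ℕ) (prime : Prime (suc q)) where

  open SpectralGap q prime public

  -- Low n f: f is a polynomial function of degree < n.  Monic n f: f is monic of degree n.
  -- Both are phrased through divided differences, so that no coefficients are needed.
  Low Monic : ℕ → (F → F) → Set
  Low zero f = ∀ x → f x ≡ 0ᶠ
  Low (suc n) f = ∀ r → ∃ λ g → Low n g × (∀ x → f x ⊖ f r ≡ (x ⊖ r) ⊗ g x)
  Monic zero f = ∀ x → f x ≡ 1ᶠ
  Monic (suc n) f = ∀ r → ∃ λ g → Monic n g × (∀ x → f x ⊖ f r ≡ (x ⊖ r) ⊗ g x)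

  low-const : ∀ n c → Low (suc n) (λ _ → c)
  low-const zero c r = (λ _ → 0ᶠ) , (λ _ → refl) , λ x → e c x r
    where e : ∀ c x r → c ⊖ c ≡ (x ⊖ r) ⊗ 0ᶠ
          e = solve 3 (λ c x r → c :- c := (x :- r) :* con ℤ.0ℤ) refl
  low-const (suc n) c r = (λ _ → 0ᶠ) , low-const n 0ᶠ , λ x → e c x r
    where e : ∀ c x r → c ⊖ c ≡ (x ⊖ r) ⊗ 0ᶠ
          e = solve 3 (λ c x r → c :- c := (x :- r) :* con ℤ.0ℤ) refl

  monic⇒low : ∀ n f s → Monic n f → Low (suc n) (λ x → s ⊗ f x)
  monic⇒low zero f s mf r = (λ _ → 0ᶠ) , (λ _ → refl) , λ x →
      trans (cong₂ (λ a b → s ⊗ a ⊖ s ⊗ b) (mf x) (mf r)) (e s x r)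
    where e : ∀ s x r → s ⊗ 1ᶠ ⊖ s ⊗ 1ᶠ ≡ (x ⊖ r) ⊗ 0ᶠ
          e = solve 3 (λ s x r → s :* con ℤ.1ℤ :- s :* con ℤ.1ℤ := (x :- r) :* con ℤ.0ℤ) refl
  monic⇒low (suc n) f s mf r = (λ x → s ⊗ proj₁ (mf r) x) , monic⇒low n (proj₁ (mf r)) s (proj₁ (proj₂ (mf r))) , λ x →
      trans (e₁ s (f x) (f r)) (trans (cong (s ⊗_) (proj₂ (proj₂ (mf r)) x)) (e₂ s (x ⊖ r) (proj₁ (mf r) x)))
    where
    e₁ : ∀ s a b → s ⊗ a ⊖ s ⊗ b ≡ s ⊗ (a ⊖ b)
    e₁ = solve 3 (λ s a b → s :* a :- s :* b := s :* (a :- b)) refl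
    e₂ : ∀ s t g → s ⊗ (t ⊗ g) ≡ t ⊗ (s ⊗ g)
    e₂ = solve 3 (λ s t g → s :* (t :* g) := t :* (s :* g)) refl

  monic-+-low : ∀ n f g → Monic n f → Low n g → Monic n (λ x → f x ⊕ g x)
  monic-+-low zero f g mf lg x = trans (cong₂ _⊕_ (mf x) (lg x)) (⊕-idʳ 1ᶠ)
  monic-+-low (suc n) f g mf lg r = (λ x → proj₁ (mf r) x ⊕ proj₁ (lg r) x) ,
      monic-+-low n _ _ (proj₁ (proj₂ (mf r))) (proj₁ (proj₂ (lg r))) , λ x →
      trans (e₁ (f x) (g x) (f r) (g r)) (trans (cong₂ _⊕_ (proj₂ (proj₂ (mf r)) x) (proj₂ (proj₂ (lg r)) x)) (e₂ (x ⊖ r) _ _))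
    where
    e₁ : ∀ a b c d → a ⊕ b ⊖ (c ⊕ d) ≡ (a ⊖ c) ⊕ (b ⊖ d)
    e₁ = solve 4 (λ a b c d → a :+ b :- (c :+ d) := (a :- c) :+ (b :- d)) refl
    e₂ : ∀ t g h → t ⊗ g ⊕ t ⊗ h ≡ t ⊗ (g ⊕ h)
    e₂ = solve 3 (λ t g h → t :* g :+ t :* h := t :* (g :+ h)) refl

  -- From x f x - r f r = (x - r) f x + r (f x - f r): the divided difference is f plus r times the
  -- divided difference of f, which has lower degree and does not disturb the leading term.
  monic-x* : ∀ n f → Monic n f → Monic (suc n) (λ x → x ⊗ f x)
  monic-x* zero f mf r = (λ _ → 1ᶠ) , (λ _ → refl) , λ x →
      trans (cong₂ (λ a b → x ⊗ a ⊖ r ⊗ b) (mf x) (mf r)) (e x r)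
    where e : ∀ x r → x ⊗ 1ᶠ ⊖ r ⊗ 1ᶠ ≡ (x ⊖ r) ⊗ 1ᶠ
          e = solve 2 (λ x r → x :* con ℤ.1ℤ :- r :* con ℤ.1ℤ := (x :- r) :* con ℤ.1ℤ) refl
  monic-x* (suc n) f mf r = (λ x → f x ⊕ r ⊗ g x) , monic-+-low (suc n) f _ mf (monic⇒low n g r (proj₁ (proj₂ (mf r)))) , λ x →
      trans (e₁ x r (f x) (f r)) (trans (cong (λ t → (x ⊖ r) ⊗ f x ⊕ r ⊗ t) (proj₂ (proj₂ (mf r)) x)) (e₂ x r (f x) (g x)))
    where
    g : F → F
    g = proj₁ (mf r)
    e₁ : ∀ x r a b → x ⊗ a ⊖ r ⊗ b ≡ (x ⊖ r) ⊗ a ⊕ r ⊗ (a ⊖ b)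
    e₁ = solve 4 (λ x r a b → x :* a :- r :* b := (x :- r) :* a :+ r :* (a :- b)) refl
    e₂ : ∀ x r a g → (x ⊖ r) ⊗ a ⊕ r ⊗ ((x ⊖ r) ⊗ g) ≡ (x ⊖ r) ⊗ (a ⊕ r ⊗ g)
    e₂ = solve 4 (λ x r a g → (x :- r) :* a :+ r :* ((x :- r) :* g) := (x :- r) :* (a :+ r :* g)) refl

  monic-roots : ∀ n f → Monic n f → ∀ Z → (∀ x → x ∈ Z → f x ≡ 0ᶠ) → card Z ≤ n
  monic-roots zero f mf Z root = ℕₚ.≮⇒≥ λ 0<Z → 0ᶠ≢1ᶠ (trans (sym (root _ (proj₂ (0<card⇒∃∈ Z 0<Z)))) (mf _))
  monic-roots (suc n) f mf Z root = decide (0 <? card Z)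
    where
    decide : Dec (0 < card Z) → card Z ≤ suc n
    decide (no empty) = ℕₚ.≤-trans (ℕₚ.≮⇒≥ empty) z≤n
    decide (yes 0<Z) = begin
      card Z ≤⟨ ∑-mono (λ x → split x (x ≟ᶠ r)) ⟩
      ∑ (λ x → 𝟙 Single x + 𝟙 Z′ x) ≡⟨ ∑-+ ⟩
      card Single + card Z′ ≤⟨ ℕₚ.+-mono-≤ (card-unique Single λ x y x∈ y∈ → trans (does-elim (x ≟ᶠ r) x∈) (sym (does-elim (y ≟ᶠ r) y∈)))
                                 (monic-roots n g (proj₁ (proj₂ (mf r))) Z′ root′) ⟩
      suc n ∎
      where
      open ℕₚ.≤-Reasoning
      r : F
      r = proj₁ (0<card⇒∃∈ Z 0<Z)
      r∈ : r ∈ Z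
      r∈ = proj₂ (0<card⇒∃∈ Z 0<Z)
      g : F → F
      g = proj₁ (mf r)
      Single Z′ : FSet
      Single x = does (x ≟ᶠ r)
      Z′ x = does ((x ∈? Z) ×-dec ¬? (x ≟ᶠ r))
      split : ∀ x → Dec (x ≡ r) → 𝟙 Z x ≤ 𝟙 Single x + 𝟙 Z′ x
      split x (yes e) = ℕₚ.m≤n⇒m≤n+o (𝟙 Z′ x) (𝟙-mono Z Single λ _ → does-intro (x ≟ᶠ r) e)
      split x (no ne) = ℕₚ.m≤n⇒m≤o+n (𝟙 Single x) (𝟙-mono Z Z′ λ x∈ → does-intro ((x ∈? Z) ×-dec ¬? (x ≟ᶠ r)) (x∈ , ne))
      root′ : ∀ x → x ∈ Z′ → g x ≡ 0ᶠ
      root′ x x∈ = from (does-elim ((x ∈? Z) ×-dec ¬? (x ≟ᶠ r)) x∈)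
        where
        minus : 0ᶠ ⊖ 0ᶠ ≡ 0ᶠ
        minus = solve 0 (con ℤ.0ℤ :- con ℤ.0ℤ := con ℤ.0ℤ) refl
        from : x ∈ Z × x ≢ r → g x ≡ 0ᶠ
        from (x∈Z , x≢r) = ⊗-cancelˡ (λ e → x≢r (⊖≡0⇒≡ e)) (trans (sym (proj₂ (proj₂ (mf r)) x))
          (trans (cong₂ _⊖_ (root x x∈Z) (root r r∈)) (trans minus (sym (zeroʳ (x ⊖ r))))))

  infixr 8 _^ᶠ_
  _^ᶠ_ : F → ℕ → F
  x ^ᶠ zero = 1ᶠ
  x ^ᶠ suc m = x ⊗ x ^ᶠ m

  ι-^ : ∀ a m → ι (+ (a ^ m)) ≡ ι (+ a) ^ᶠ m
  ι-^ a zero = refl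
  ι-^ a (suc m) = trans (cong ι (ℤₚ.pos-* a (a ^ m))) (trans (ι-⊗ (+ a) (+ (a ^ m))) (cong (ι (+ a) ⊗_) (ι-^ a m)))

  ^ᶠ-⊗ : ∀ x y m → (x ⊗ y) ^ᶠ m ≡ x ^ᶠ m ⊗ y ^ᶠ m
  ^ᶠ-⊗ x y zero = sym (⊗-idˡ 1ᶠ)
  ^ᶠ-⊗ x y (suc m) = trans (cong (x ⊗ y ⊗_) (^ᶠ-⊗ x y m)) (e x y (x ^ᶠ m) (y ^ᶠ m))
    where e : ∀ x y a b → x ⊗ y ⊗ (a ⊗ b) ≡ x ⊗ a ⊗ (y ⊗ b)
          e = solve 4 (λ x y a b → x :* y :* (a :* b) := x :* a :* (y :* b)) refl

  ^ᶠ-nonzero : ∀ {x} m → x ≢ 0ᶠ → x ^ᶠ m ≢ 0ᶠ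
  ^ᶠ-nonzero zero x≢0 e = 0ᶠ≢1ᶠ (sym e)
  ^ᶠ-nonzero (suc m) x≢0 = ⊗-nonzero x≢0 (^ᶠ-nonzero m x≢0)

  monic-^ : ∀ m → Monic m (_^ᶠ m)
  monic-^ zero x = refl
  monic-^ (suc m) = monic-x* m (_^ᶠ m) (monic-^ m)

  module PowerMap (m : ℕ) where

    root? : ∀ c x → Dec (x ≢ 0ᶠ × x ^ᶠ m ≡ c)
    root? c x = ¬? (x ≟ᶠ 0ᶠ) ×-dec (x ^ᶠ m ≟ᶠ c)

    roots : F → FSet
    roots c x = does (root? c x)

    π : F → ℕ
    π c = card (roots c)

    H : FSet
    H c = does (0 <? π c)

    H-root : ∀ {c} → c ∈ H → ∃ λ t → t ≢ 0ᶠ × t ^ᶠ m ≡ c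
    H-root {c} c∈ = proj₁ t∈ , does-elim (root? c (proj₁ t∈)) (proj₂ t∈)
      where t∈ = 0<card⇒∃∈ (roots c) (does-elim (0 <? π c) c∈)

    H≢0 : ∀ {c} → c ∈ H → c ≢ 0ᶠ
    H≢0 {c} c∈ = from (H-root c∈)
      where
      from : (∃ λ t → t ≢ 0ᶠ × t ^ᶠ m ≡ c) → c ≢ 0ᶠ
      from (t , t≢0 , e) c≡0 = ^ᶠ-nonzero m t≢0 (trans e c≡0)

    π-inv : ∀ {h} → h ∈ H → ∀ c → π (h ⊗ c) ≡ π c
    π-inv {h} h∈ c = from (H-root h∈)
      where
      from : (∃ λ t → t ≢ 0ᶠ × t ^ᶠ m ≡ h) → π (h ⊗ c) ≡ π c
      from (t , t≢0 , e) = trans (sym (∑-⊗ t≢0 (𝟙 (roots (h ⊗ c))))) (∑-cong λ x → ℕₚ.≤-antisym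
          (𝟙-mono (roots (h ⊗ c)) (roots c) λ tx∈ → does-intro (root? c x) (down x (does-elim (root? (h ⊗ c) (t ⊗ x)) tx∈)))
          (𝟙-mono (roots c) (roots (h ⊗ c)) λ x∈ → does-intro (root? (h ⊗ c) (t ⊗ x)) (up x (does-elim (root? c x) x∈))))
        where
        down : ∀ x → t ⊗ x ≢ 0ᶠ × (t ⊗ x) ^ᶠ m ≡ h ⊗ c → x ≢ 0ᶠ × x ^ᶠ m ≡ c
        down x (tx≢0 , e′) = (λ x≡0 → tx≢0 (trans (cong (t ⊗_) x≡0) (zeroʳ t))) ,
          ⊗-cancelˡ (H≢0 h∈) (trans (cong (_⊗ x ^ᶠ m) (sym e)) (trans (sym (^ᶠ-⊗ t x m)) e′))
        up : ∀ x → x ≢ 0ᶠ × x ^ᶠ m ≡ c → t ⊗ x ≢ 0ᶠ × (t ⊗ x) ^ᶠ m ≡ h ⊗ c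
        up x (x≢0 , e′) = ⊗-nonzero t≢0 x≢0 , trans (^ᶠ-⊗ t x m) (cong₂ _⊗_ e e′)

    π≤m : 1 ≤ m → ∀ c → π c ≤ m
    π≤m 1≤m c = bound m 1≤m refl
      where
      bound : ∀ n → 1 ≤ n → n ≡ m → π c ≤ m
      bound (suc n) _ refl = monic-roots (suc n) _ (monic-+-low (suc n) _ _ (monic-^ (suc n)) (low-const n (⊝ c))) (roots c)
        λ x x∈ → trans (cong (_⊖ c) (proj₂ (does-elim (root? c x) x∈))) (e c)
        where e : ∀ c → c ⊖ c ≡ 0ᶠ
              e = solve 1 (λ c → c :- c := con ℤ.0ℤ) refl

    convolve-π : ∀ g z → convolve π g z ≡ ∑′ (λ (i : Fin q) → g (z ⊖ Fin.suc i ^ᶠ m))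
    convolve-π g z = begin
      convolve π g z ≡⟨ convolve-def π g z ⟩
      ∑′ (λ c → + π c ℤ.* g (z ⊖ c)) ≡⟨ ∑ᶻ.∑-cong (λ c → trans (cong (ℤ._* g (z ⊖ c)) (pos-∑ (𝟙 (roots c)))) (sym (∑ᶻ.∑-*ʳ (g (z ⊖ c))))) ⟩
      ∑′ (λ c → ∑′ λ x → + 𝟙 (roots c) x ℤ.* g (z ⊖ c)) ≡⟨ ∑ᶻ.∑-swap ⟩
      ∑′ term ≡⟨ ∑ᶻ.∑-suc term ⟩
      term Fin.zero ℤ.+ ∑′ (λ i → term (Fin.suc i)) ≡⟨ cong₂ ℤ._+_ at-zero (∑ᶻ.∑-cong λ i → at-nonzero (Fin.suc i) λ e → case trans e 0ᶠ≡zero of λ ()) ⟩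
      ℤ.0ℤ ℤ.+ ∑′ (λ (i : Fin q) → g (z ⊖ Fin.suc i ^ᶠ m)) ≡⟨ ℤₚ.+-identityˡ _ ⟩
      ∑′ (λ (i : Fin q) → g (z ⊖ Fin.suc i ^ᶠ m)) ∎
      where
      open ≡-Reasoning
      term : F → ℤ
      term x = ∑′ λ c → + 𝟙 (roots c) x ℤ.* g (z ⊖ c)
      vanish : ∀ c x → ¬ (x ≢ 0ᶠ × x ^ᶠ m ≡ c) → + 𝟙 (roots c) x ℤ.* g (z ⊖ c) ≡ ℤ.0ℤ
      vanish c x no-root = cong (λ t → + t ℤ.* g (z ⊖ c)) (𝟙-∉ (roots c) λ x∈ → no-root (does-elim (root? c x) x∈))
      at-zero : term Fin.zero ≡ ℤ.0ℤ
      at-zero = trans (∑ᶻ.∑-cong λ c → vanish c Fin.zero λ (≢0 , _) → ≢0 (sym 0ᶠ≡zero)) (∑ᶻ.∑-zero {n = p})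
      at-nonzero : ∀ x → x ≢ 0ᶠ → term x ≡ g (z ⊖ x ^ᶠ m)
      at-nonzero x x≢0 = trans (∑′-single _ (x ^ᶠ m) λ c c≢ → vanish c x λ (_ , e) → c≢ (sym e))
        (trans (cong (λ t → + t ℤ.* g (z ⊖ x ^ᶠ m)) (𝟙-∈ (roots (x ^ᶠ m)) (does-intro (root? (x ^ᶠ m) x) (x≢0 , refl)))) (ℤₚ.*-identityˡ _))

    ∑π : ∑ π ≡ q
    ∑π = begin
      ∑ (λ c → ∑ λ x → 𝟙 (roots c) x) ≡⟨ ∑-swap ⟩
      ∑ term ≡⟨ ∑-suc term ⟩
      term Fin.zero + ∑ (λ i → term (Fin.suc i)) ≡⟨ cong₂ _+_ at-zero (∑-cong λ i → at-nonzero (Fin.suc i) λ e → case trans e 0ᶠ≡zero of λ ()) ⟩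
      ∑ (λ (_ : Fin q) → 1) ≡⟨ ∑-const q 1 ⟩
      q * 1 ≡⟨ ℕₚ.*-identityʳ q ⟩
      q ∎
      where
      open ≡-Reasoning
      term : F → ℕ
      term x = ∑ λ c → 𝟙 (roots c) x
      at-zero : term Fin.zero ≡ 0
      at-zero = trans (∑-cong λ c → 𝟙-∉ (roots c) λ x∈ → proj₁ (does-elim (root? c Fin.zero) x∈) (sym 0ᶠ≡zero)) (∑-zero {n = p})
      at-nonzero : ∀ x → x ≢ 0ᶠ → term x ≡ 1
      at-nonzero x x≢0 = ℕₚ.≤-antisym
        (∑-unique _ (λ c → 𝟙≤1 (roots c) x) λ c c′ pos pos′ →
          trans (sym (proj₂ (does-elim (root? c x) (0<𝟙⇒∈ (roots c) pos)))) (proj₂ (does-elim (root? c′ x) (0<𝟙⇒∈ (roots c′) pos′))))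
        (ℕₚ.≤-trans (ℕₚ.≤-reflexive (sym (𝟙-∈ (roots (x ^ᶠ m)) (does-intro (root? (x ^ᶠ m) x) (x≢0 , refl))))) (term≤∑ _ (x ^ᶠ m)))

    q≤H*m : 1 ≤ m → q ≤ card H * m
    q≤H*m 1≤m = begin
      q ≡⟨ ∑π ⟨
      ∑ π ≤⟨ ∑-mono (λ c → each c (0 <? π c)) ⟩
      ∑ (λ c → 𝟙 H c * m) ≡⟨ ∑-*ʳ m ⟩
      card H * m ∎
      where
      open ℕₚ.≤-Reasoning
      each : ∀ c → Dec (0 < π c) → π c ≤ 𝟙 H c * m
      each c (yes pos) = ℕₚ.≤-trans (π≤m 1≤m c) (ℕₚ.≤-reflexive (sym (trans (cong (_* m) (𝟙-∈ H (does-intro (0 <? π c) pos))) (ℕₚ.*-identityˡ m))))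
      each c (no ¬pos) = ℕₚ.≤-trans (ℕₚ.≮⇒≥ ¬pos) z≤n

    ∑π²≤ : 1 ≤ m → ∑ (λ c → π c * π c) ≤ m * q
    ∑π²≤ 1≤m = ℕₚ.≤-trans (∑-mono λ c → ℕₚ.*-monoˡ-≤ (π c) (π≤m 1≤m c)) (ℕₚ.≤-reflexive (trans (∑-*ˡ m) (cong (m *_) ∑π)))

-- Choice of K and T, and the power saving for all p

floor-root : ∀ r n b → 1 ≤ r → n < b ^ r → ∃ λ k → k ^ r ≤ n × n < suc k ^ r
floor-root (suc r) n zero _ ()
floor-root r n (suc b) 1≤r n<b with n <? b ^ r
... | yes n<bʳ = floor-root r n b 1≤r n<bʳ
... | no n≮bʳ = b , ℕₚ.≮⇒≥ n≮bʳ , n<b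

bernoulli : ∀ q n → q ^ suc n + suc n * q ^ n ≤ suc q ^ suc n
bernoulli q zero = ℕₚ.≤-reflexive (e q)
  where e : ∀ q → q * 1 + (1 + 0) * 1 ≡ (1 + q) * 1
        e = solve-∀
bernoulli q (suc n) = begin
  q * (q * q ^ n) + suc (suc n) * (q * q ^ n) ≤⟨ ℕₚ.m≤m+n _ (suc n * q ^ n) ⟩
  q * (q * q ^ n) + suc (suc n) * (q * q ^ n) + suc n * q ^ n ≡⟨ e q n (q ^ n) ⟩
  suc q * (q * q ^ n + suc n * q ^ n) ≤⟨ ℕₚ.*-monoʳ-≤ (suc q) (bernoulli q n) ⟩
  suc q * suc q ^ suc n ∎
  where
  open ℕₚ.≤-Reasoning
  e : ∀ q n x → q * (q * x) + (1 + (1 + n)) * (q * x) + (1 + n) * x ≡ (1 + q) * (q * x + (1 + n) * x)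
  e = solve-∀

-- Bernoulli: (1 + 1/q)^n ≥ 1 + n/q ≥ 1 + q. This turns the quotient of p = q + 1 by q into a gain
-- of p when p is bounded.
power-gain : ∀ q n → q * q ≤ n → q ^ n * suc q ≤ suc q ^ n
power-gain zero zero _ = ℕₚ.≤-refl
power-gain q (suc n) q²≤ = begin
  q * q ^ n * suc q ≡⟨ e₁ q (q ^ n) ⟩
  q * q ^ n + q * q * q ^ n ≤⟨ ℕₚ.+-monoʳ-≤ (q * q ^ n) (ℕₚ.*-monoˡ-≤ (q ^ n) q²≤) ⟩
  q ^ suc n + suc n * q ^ n ≤⟨ bernoulli q n ⟩
  suc q ^ suc n ∎
  where
  open ℕₚ.≤-Reasoning
  e₁ : ∀ q x → q * x * (1 + q) ≡ q * x + q * q * x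
  e₁ = solve-∀

-- K^C must stay below h: the total loss, plus one factor as the gain. With K the integer R-th root
-- of p and R = d (C + 1), K^(C + 1) is at most p^(1/d) < 2 h. Taking J = 2 R gives p < K^J in spite
-- of the rounding. The power T = J 2^(2J) contains 2^(j + 1) for every j < 2 J and repeats the gain
-- K at least J times.
gapC gapR gapJ gapT : ℕ → ℕ
gapC d = suc (Exponents.eTotal d)
gapR d = d * suc (gapC d)
gapJ d = gapR d + gapR d
gapT d = gapJ d * 2 ^ (gapJ d + gapJ d)

module PowerSums (q : ℕ) (prime : Prime (suc q)) where

  open Powers q prime public

  acor≤ : ∀ g s → acor g s ℤ.≤ ‖ g ‖²
  acor≤ g s = halve-≤ᶻ (begin
    acor g s ℤ.+ acor g s ≡⟨ cong₂ ℤ._+_ (acor-def g s) (acor-def g s) ⟩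
    ∑′ (λ c → g c ℤ.* g (c ⊖ s)) ℤ.+ ∑′ (λ c → g c ℤ.* g (c ⊖ s)) ≡⟨ ∑ᶻ.∑-+ ⟨
    ∑′ (λ c → g c ℤ.* g (c ⊖ s) ℤ.+ g c ℤ.* g (c ⊖ s)) ≤⟨ ∑ᶻ.∑-mono (λ c → amgm-ℤ (g c) (g (c ⊖ s))) ⟩
    ∑′ (λ c → g c ℤ.* g c ℤ.+ g (c ⊖ s) ℤ.* g (c ⊖ s)) ≡⟨ ∑ᶻ.∑-+ ⟩
    ‖ g ‖² ℤ.+ ∑′ (λ c → g (c ⊖ s) ℤ.* g (c ⊖ s)) ≡⟨ cong (ℤ._+_ ‖ g ‖²) (Reindexᶻ.∑-⊖ s (λ c → g c ℤ.* g c)) ⟩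
    ‖ g ‖² ℤ.+ ‖ g ‖² ∎)
    where open ℤₚ.≤-Reasoning

  convolve-norm : ∀ φ g → ‖ convolve φ g ‖² ℤ.≤ + (∑ φ * ∑ φ) ℤ.* ‖ g ‖²
  convolve-norm φ g = begin
    ‖ convolve φ g ‖² ≡⟨ trans (sym (pairing-cor φ g)) (pairing-def (cor φ) g) ⟩
    ∑′ (λ s → + cor φ s ℤ.* acor g s) ≤⟨ ∑ᶻ.∑-mono (λ s → ℤₚ.*-monoˡ-≤-nonNeg (+ cor φ s) (acor≤ g s)) ⟩
    ∑′ (λ s → + cor φ s ℤ.* ‖ g ‖²) ≡⟨ ∑ᶻ.∑-*ʳ ‖ g ‖² ⟩
    ∑′ (λ s → + cor φ s) ℤ.* ‖ g ‖² ≡⟨ cong (ℤ._* ‖ g ‖²) (trans (sym (pos-∑ (cor φ))) (cong +_ (∑-cor φ))) ⟩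
    + (∑ φ * ∑ φ) ℤ.* ‖ g ‖² ∎
    where open ℤₚ.≤-Reasoning

  norm-ℕ : (F → ℤ) → ℕ
  norm-ℕ g = ℤ.∣ ‖ g ‖² ∣

  +norm-ℕ : ∀ g → + norm-ℕ g ≡ ‖ g ‖²
  +norm-ℕ g = ℤₚ.0≤i⇒+∣i∣≡i (0≤‖‖² g)

  module _ (m d : ℕ) (1≤m : 1 ≤ m) (1≤d : 1 ≤ d) (m-small : m ^ d < p ^ (d ∸ 1)) where

    open PowerMap m

    private
      C R J T₀ : ℕ
      C = gapC d
      R = gapR d
      J = gapJ d
      T₀ = gapT d

    private
      instance
        m≢0 : NonZero m
        m≢0 = >-nonZero 1≤m

      1≤R : 1 ≤ R
      1≤R = ℕₚ.*-mono-≤ {1} {d} {1} {suc C} 1≤d (s≤s z≤n)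
      1≤J : 1 ≤ J
      1≤J = ℕₚ.≤-trans 1≤R (ℕₚ.m≤m+n R R)

      α≤ : ∀ g → norm-ℕ (convolve π g) ≤ q * q * norm-ℕ g
      α≤ g = ℤₚ.drop‿+≤+ (subst₂ ℤ._≤_ (sym (+norm-ℕ (convolve π g)))
        (trans (cong₂ (λ s t → + (s * s) ℤ.* t) ∑π (sym (+norm-ℕ g))) (sym (ℤₚ.pos-* (q * q) (norm-ℕ g)))) (convolve-norm π g))

      1≤T₀ : 1 ≤ T₀
      1≤T₀ = ℕₚ.*-mono-≤ 1≤J (ℕₚ.m^n>0 2 (J + J))

      square-power : ∀ a t → (a * a) ^ t ≡ a ^ (t + t)
      square-power a t = trans (^-distrib-* t a a) (sym (ℕₚ.^-distribˡ-+-* a t t))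

      -- The trivial operator bound is q, not p; since p is bounded by 2^R, the exponent 2 T exceeds
      -- q² and the quotient p / q already yields a factor p.
      small-case : ∀ g → p < 2 ^ R → norm-ℕ (convolve π g) ^ T₀ * p ≤ (p * p * norm-ℕ g) ^ T₀
      small-case g p<2ᴿ = begin
        norm-ℕ (convolve π g) ^ T₀ * p ≤⟨ ℕₚ.*-monoˡ-≤ p (ℕₚ.^-monoˡ-≤ T₀ (α≤ g)) ⟩
        (q * q * β) ^ T₀ * p ≡⟨ cong (_* p) (trans (^-distrib-* T₀ (q * q) β) (cong (_* β ^ T₀) (square-power q T₀))) ⟩
        q ^ (T₀ + T₀) * β ^ T₀ * p ≡⟨ e (q ^ (T₀ + T₀)) (β ^ T₀) p ⟩
        q ^ (T₀ + T₀) * p * β ^ T₀ ≤⟨ ℕₚ.*-monoˡ-≤ (β ^ T₀) (power-gain q (T₀ + T₀) q²≤) ⟩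
        p ^ (T₀ + T₀) * β ^ T₀ ≡⟨ trans (^-distrib-* T₀ (p * p) β) (cong (_* β ^ T₀) (square-power p T₀)) ⟨
        (p * p * β) ^ T₀ ∎
        where
        open ℕₚ.≤-Reasoning
        β : ℕ
        β = norm-ℕ g
        e : ∀ a b c → a * b * c ≡ a * c * b
        e = solve-∀
        q≤ : q ≤ 2 ^ R
        q≤ = ℕₚ.<⇒≤ (ℕₚ.<-trans (ℕₚ.n<1+n q) p<2ᴿ)
        q²≤ : q * q ≤ T₀ + T₀
        q²≤ = begin
          q * q ≤⟨ ℕₚ.*-mono-≤ q≤ q≤ ⟩
          2 ^ R * 2 ^ R ≡⟨ ℕₚ.^-distribˡ-+-* 2 R R ⟨
          2 ^ J ≤⟨ ℕₚ.^-monoʳ-≤ 2 (ℕₚ.m≤m+n J J) ⟩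
          2 ^ (J + J) ≤⟨ ℕₚ.m≤n*m (2 ^ (J + J)) J {{>-nonZero 1≤J}} ⟩
          T₀ ≤⟨ ℕₚ.m≤m+n T₀ T₀ ⟩
          T₀ + T₀ ∎

      m<p : m < p
      m<p = ℕₚ.≰⇒> λ p≤m → ℕₚ.<⇒≱ m-small (ℕₚ.≤-trans (ℕₚ.^-monoʳ-≤ p (ℕₚ.m∸n≤m d 1)) (ℕₚ.^-monoˡ-≤ d p≤m))

      -- Fibres of the power map have at most m elements, so this is a lower bound for the number of
      -- m-th powers.
      h : ℕ
      h = q Data.Nat./ m

      h*m≤q : h * m ≤ q
      h*m≤q = Data.Nat.DivMod.m/n*n≤m q m

      p≤2hm : p ≤ 2 * h * m
      p≤2hm = begin
        suc q ≡⟨ cong suc (Data.Nat.DivMod.m≡m%n+[m/n]*n q m) ⟩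
        suc (q Data.Nat.% m) + h * m ≤⟨ ℕₚ.+-monoˡ-≤ (h * m) (Data.Nat.DivMod.m%n<n q m) ⟩
        suc h * m ≤⟨ ℕₚ.*-monoˡ-≤ m (ℕₚ.+-mono-≤ 1≤h (ℕₚ.m≤m+n h 0)) ⟩
        2 * h * m ∎
        where
        open ℕₚ.≤-Reasoning
        1≤h : 1 ≤ h
        1≤h = Data.Nat.DivMod.m≥n⇒m/n>0 (ℕₚ.≤-pred m<p)

      p<hᵈ : p < (2 * h) ^ d
      p<hᵈ = ℕₚ.*-cancelʳ-< (p ^ (d ∸ 1)) p ((2 * h) ^ d) (begin-strict
        p * p ^ (d ∸ 1) ≡⟨ cong (p ^_) (ℕₚ.m+[n∸m]≡n 1≤d) ⟩
        p ^ d ≤⟨ ℕₚ.^-monoˡ-≤ d p≤2hm ⟩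
        (2 * h * m) ^ d ≡⟨ ^-distrib-* d (2 * h) m ⟩
        (2 * h) ^ d * m ^ d <⟨ ℕₚ.*-monoʳ-< ((2 * h) ^ d) {{>-nonZero 0<hᵈ}} m-small ⟩
        (2 * h) ^ d * p ^ (d ∸ 1) ∎)
        where
        open ℕₚ.≤-Reasoning
        0<hᵈ : 0 < (2 * h) ^ d
        0<hᵈ = ℕₚ.m^n>0 (2 * h) {{>-nonZero (0<m*n⇒0<n m (2 * h) (subst (0 <_) (ℕₚ.*-comm (2 * h) m) (ℕₚ.<-≤-trans (s≤s z≤n) p≤2hm)))}} d

      h≤H : h ≤ card H
      h≤H = ℕₚ.*-cancelʳ-≤ h (card H) m (ℕₚ.≤-trans h*m≤q (q≤H*m 1≤m))

      h-energy : h * ∑ (λ c → π c * π c) ≤ ∑ π * ∑ π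
      h-energy = begin
        h * ∑ (λ c → π c * π c) ≤⟨ ℕₚ.*-monoʳ-≤ h (∑π²≤ 1≤m) ⟩
        h * (m * q) ≡⟨ ℕₚ.*-assoc h m q ⟨
        h * m * q ≤⟨ ℕₚ.*-monoˡ-≤ q h*m≤q ⟩
        q * q ≡⟨ cong₂ _*_ ∑π ∑π ⟨
        ∑ π * ∑ π ∎
        where open ℕₚ.≤-Reasoning

      module Large (K : ℕ) (Kᴿ≤p : K ^ R ≤ p) (p<K⁺ : p < suc K ^ R) (2ᴿ≤p : 2 ^ R ≤ p) where

        2≤K : 2 ≤ K
        2≤K = ℕₚ.≮⇒≥ λ K<2 → ℕₚ.<⇒≱ p<K⁺ (ℕₚ.≤-trans (ℕₚ.^-monoˡ-≤ R K<2) 2ᴿ≤p)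

        instance
          K≢0 : NonZero K
          K≢0 = >-nonZero (ℕₚ.≤-trans (s≤s z≤n) 2≤K)

        p<Kᴶ : p < K ^ J
        p<Kᴶ = begin-strict
          p <⟨ p<K⁺ ⟩
          suc K ^ R ≤⟨ ℕₚ.^-monoˡ-≤ R K+1≤K² ⟩
          (K * K) ^ R ≡⟨ square-power K R ⟩
          K ^ J ∎
          where
          open ℕₚ.≤-Reasoning
          K+1≤K² : suc K ≤ K * K
          K+1≤K² = ℕₚ.≤-trans (ℕₚ.+-mono-≤ (ℕₚ.≤-trans (s≤s z≤n) 2≤K) (ℕₚ.m≤m+n K 0)) (ℕₚ.*-monoˡ-≤ K 2≤K)

        -- R was chosen with C + 1 in place of C: the spare factor K ≥ 2 pays for the 2 lost by
        -- rounding q / m down.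
        large : K ^ C ≤ h
        large = ℕₚ.*-cancelˡ-≤ 2 (ℕₚ.≤-trans (ℕₚ.*-monoˡ-≤ (K ^ C) 2≤K) (ℕₚ.<⇒≤ (ℕₚ.≰⇒> λ 2h≤ → ℕₚ.<⇒≱ p<hᵈ (begin
          (2 * h) ^ d ≤⟨ ℕₚ.^-monoˡ-≤ d 2h≤ ⟩
          (K ^ suc C) ^ d ≡⟨ trans (ℕₚ.^-*-assoc K (suc C) d) (cong (K ^_) (ℕₚ.*-comm (suc C) d)) ⟩
          K ^ R ≤⟨ Kᴿ≤p ⟩
          p ∎))))
          where open ℕₚ.≤-Reasoning

        0<q : 0 < q
        0<q = ℕₚ.<-≤-trans 1≤m (ℕₚ.≤-pred m<p)

        gap : ∃ λ j → j < J + J × (∀ g → ∑′ g ≡ ℤ.0ℤ → 0 < norm-ℕ g →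
                K * norm-ℕ (convolve π g) ^ (2 ^ suc j) ≤ (∑ π * ∑ π * norm-ℕ g) ^ (2 ^ suc j))
        gap = spectral-gap π H h K d J 2≤K (subst (0 <_) (sym ∑π) 0<q) H≢0 π-inv h≤H h-energy large p<hᵈ p<Kᴶ

        large-case : ∀ g → ∑′ g ≡ ℤ.0ℤ → 0 < norm-ℕ g → norm-ℕ (convolve π g) ^ T₀ * p ≤ (p * p * norm-ℕ g) ^ T₀
        large-case g mz 0<g = from gap
          where
          open ℕₚ.≤-Reasoning
          α β : ℕ
          α = norm-ℕ (convolve π g)
          β = norm-ℕ g
          from : (∃ λ j → j < J + J × (∀ g → ∑′ g ≡ ℤ.0ℤ → 0 < norm-ℕ g →
                K * norm-ℕ (convolve π g) ^ (2 ^ suc j) ≤ (∑ π * ∑ π * norm-ℕ g) ^ (2 ^ suc j))) → α ^ T₀ * p ≤ (p * p * β) ^ T₀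
          from (j , j< , bound) = begin
            α ^ T₀ * p ≤⟨ ℕₚ.*-monoʳ-≤ (α ^ T₀) (ℕₚ.≤-trans (ℕₚ.<⇒≤ p<Kᴶ) (ℕₚ.^-monoʳ-≤ K (ℕₚ.m≤m*n J e {{ℕₚ.m^n≢0 2 (J + J ∸ suc j)}}))) ⟩
            α ^ T₀ * K ^ (J * e) ≡⟨ cong (λ t → α ^ t * K ^ (J * e)) T₀≡ ⟩
            α ^ (n * (J * e)) * K ^ (J * e) ≡⟨ cong (_* K ^ (J * e)) (ℕₚ.^-*-assoc α n (J * e)) ⟨
            (α ^ n) ^ (J * e) * K ^ (J * e) ≡⟨ trans (^-distrib-* (J * e) K (α ^ n)) (ℕₚ.*-comm (K ^ (J * e)) _) ⟨
            (K * α ^ n) ^ (J * e) ≤⟨ ℕₚ.^-monoˡ-≤ (J * e) (bound g mz 0<g) ⟩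
            ((∑ π * ∑ π * β) ^ n) ^ (J * e) ≡⟨ ℕₚ.^-*-assoc (∑ π * ∑ π * β) n (J * e) ⟩
            (∑ π * ∑ π * β) ^ (n * (J * e)) ≡⟨ cong₂ (λ s t → (s * s * β) ^ t) ∑π (sym T₀≡) ⟩
            (q * q * β) ^ T₀ ≤⟨ ℕₚ.^-monoˡ-≤ T₀ (ℕₚ.*-monoˡ-≤ β (ℕₚ.*-mono-≤ (ℕₚ.n≤1+n q) (ℕₚ.n≤1+n q))) ⟩
            (p * p * β) ^ T₀ ∎
            where
            n e : ℕ
            n = 2 ^ suc j
            -- The part of the power T that depth j leaves over; taking powers J e of the gap makes
            -- the final exponent independent of j.
            e = 2 ^ (J + J ∸ suc j)
            swap : ∀ J n e → J * (n * e) ≡ n * (J * e)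
            swap = solve-∀
            T₀≡ : T₀ ≡ n * (J * e)
            T₀≡ = trans (cong (λ t → J * 2 ^ t) (sym (ℕₚ.m+[n∸m]≡n j<))) (trans (cong (J *_) (ℕₚ.^-distribˡ-+-* 2 (suc j) (J + J ∸ suc j))) (swap J n e))

    opaque
      power-sum-bound : ∀ g → ∑′ g ≡ ℤ.0ℤ → norm-ℕ (convolve π g) ^ gapT d * p ≤ (p * p * norm-ℕ g) ^ gapT d
      power-sum-bound g mz = decide (p <? 2 ^ R) (0 <? norm-ℕ g)
        where
        decide : Dec (p < 2 ^ R) → Dec (0 < norm-ℕ g) → norm-ℕ (convolve π g) ^ T₀ * p ≤ (p * p * norm-ℕ g) ^ T₀
        decide (yes p<2ᴿ) _ = small-case g p<2ᴿ
        decide (no p≮2ᴿ) (yes 0<g) = from (floor-root R p (suc p) 1≤R p<)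
          where
          p< : p < suc p ^ R
          p< = ℕₚ.<-≤-trans (ℕₚ.n<1+n p) (subst (_≤ suc p ^ R) (ℕₚ.*-identityʳ (suc p)) (ℕₚ.^-monoʳ-≤ (suc p) 1≤R))
          from : (∃ λ k → k ^ R ≤ p × p < suc k ^ R) → norm-ℕ (convolve π g) ^ T₀ * p ≤ (p * p * norm-ℕ g) ^ T₀
          from (K , Kᴿ≤p , p<K⁺) = Large.large-case K Kᴿ≤p p<K⁺ (ℕₚ.≮⇒≥ p≮2ᴿ) g mz 0<g
        -- For norm 0 the image has norm 0 as well, and T ≥ 1 makes the left side vanish.
        decide (no _) (no g≮) = subst (λ t → t ^ T₀ * p ≤ (p * p * norm-ℕ g) ^ T₀) (sym α≡0) (subst (_≤ (p * p * norm-ℕ g) ^ T₀) (sym (cong (_* p) (0^ T₀ 1≤T₀))) z≤n)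
          where
          0^ : ∀ t → 1 ≤ t → 0 ^ t ≡ 0
          0^ (suc t) _ = refl
          α≡0 : norm-ℕ (convolve π g) ≡ 0
          α≡0 = ℕₚ.n≤0⇒n≡0 (ℕₚ.≤-trans (α≤ g) (ℕₚ.≤-reflexive (trans (cong (_*_ (q * q)) (ℕₚ.n≤0⇒n≡0 (ℕₚ.≮⇒≥ g≮))) (ℕₚ.*-zeroʳ (q * q)))))

-- Elementary symmetric polynomials in translations, Newton's identities and subset counts

count : ∀ {A : Set} → (A → Bool) → List A → ℕ
count P xs = length (filterᵇ P xs)

count-++ : ∀ {A : Set} (P : A → Bool) xs ys → count P (xs ++ ys) ≡ count P xs + count P ys
count-++ P [] ys = refl
count-++ P (x ∷ xs) ys with P x
... | true = cong suc (count-++ P xs ys)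
... | false = count-++ P xs ys

count-map : ∀ {A B : Set} (P : B → Bool) (f : A → B) xs → count P (map f xs) ≡ count (λ x → P (f x)) xs
count-map P f [] = refl
count-map P f (x ∷ xs) with P (f x)
... | true = cong suc (count-map P f xs)
... | false = count-map P f xs

count-cong : ∀ {A : Set} {P Q : A → Bool} → (∀ x → P x ≡ Q x) → ∀ xs → count P xs ≡ count Q xs
count-cong {P = P} {Q} e [] = refl
count-cong {P = P} {Q} e (x ∷ xs) with P x | Q x | e x
... | true | _ | refl = cong suc (count-cong e xs)
... | false | _ | refl = count-cong e xs

count-none : ∀ {A : Set} (xs : List A) → count (λ _ → false) xs ≡ 0
count-none [] = refl
count-none (x ∷ xs) = count-none xs

≡ᵇ-does : ∀ {n} (x y : Fin n) → (toℕ x ≡ᵇ toℕ y) ≡ does (x ≟ᶠ y)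
≡ᵇ-does x y = does-≡-T (x ≟ᶠ y) (λ t → Data.Fin.Properties.toℕ-injective (ℕₚ.≡ᵇ⇒≡ (toℕ x) (toℕ y) t)) (λ e → ℕₚ.≡⇒≡ᵇ (toℕ x) (toℕ y) (cong toℕ e))
  where
  does-≡-T : ∀ {P : Set} {b} (d : Dec P) → (T b → P) → (P → T b) → b ≡ does d
  does-≡-T {b = true} (yes _) _ _ = refl
  does-≡-T {b = true} (no ¬p) f _ = ⊥-elim (¬p (f tt))
  does-≡-T {b = false} (yes p) _ g = ⊥-elim (g p)
  does-≡-T {b = false} (no _) _ _ = refl

module ElementarySymmetric (q : ℕ) (prime : Prime (suc q)) where

  open PowerSums q prime public
  open import Function.Bundles using (mk⇔)
  open import Relation.Nullary.Decidable using (does-⇔)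

  -- The k-th elementary symmetric polynomial in the translations by c 0, …, c (n - 1), acting on functions.
  elementary : ∀ {n} → (Fin n → F) → ℕ → (F → ℤ) → F → ℤ
  elementary c zero g z = g z
  elementary {zero} c (suc k) g z = ℤ.0ℤ
  elementary {suc n} c (suc k) g z = elementary (λ i → c (Fin.suc i)) (suc k) g z ℤ.+ elementary (λ i → c (Fin.suc i)) k g (z ⊖ c Fin.zero)

  -- The j-th power sum: the j-th power of the translation by c is the translation by j c.
  powerSum : ∀ {n} → (Fin n → F) → ℕ → (F → ℤ) → F → ℤ
  powerSum c j u z = ∑′ λ i → u (z ⊖ ι (+ j) ⊗ c i)

  -- Σ_{l ≤ k} (-1)^l p_{j+l} e_{k-l}.
  newtonSum : ∀ {n} → (Fin n → F) → ℕ → ℕ → (F → ℤ) → F → ℤ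
  newtonSum c j zero g z = powerSum c j (elementary c zero g) z
  newtonSum c j (suc k) g z = powerSum c j (elementary c (suc k) g) z ℤ.- newtonSum c (suc j) k g z

  private
    ι-suc-⊗ : ∀ j c → ι (+ suc j) ⊗ c ≡ ι (+ j) ⊗ c ⊕ c
    ι-suc-⊗ j c = trans (cong (_⊗ c) (ι-⊕ (+ 1) (+ j))) (e (ι (+ j)) c)
      where e : ∀ a c → (1ᶠ ⊕ a) ⊗ c ≡ a ⊗ c ⊕ c
            e = solve 2 (λ a c → (con ℤ.1ℤ :+ a) :* c := a :* c :+ c) refl

    powerSum-step : ∀ {n} (c : Fin (suc n) → F) j k g z →
      powerSum c j (elementary c (suc k) g) z ≡
        (elementary (λ i → c (Fin.suc i)) (suc k) g (z ⊖ ι (+ j) ⊗ c Fin.zero) ℤ.+ elementary (λ i → c (Fin.suc i)) k g (z ⊖ ι (+ suc j) ⊗ c Fin.zero))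
        ℤ.+ (powerSum (λ i → c (Fin.suc i)) j (elementary (λ i → c (Fin.suc i)) (suc k) g) z
             ℤ.+ powerSum (λ i → c (Fin.suc i)) j (elementary (λ i → c (Fin.suc i)) k g) (z ⊖ c Fin.zero))
    powerSum-step c j k g z = trans (∑ᶻ.∑-suc _) (cong₂ ℤ._+_
        (cong (ℤ._+_ (elementary c′ (suc k) g (z ⊖ ι (+ j) ⊗ c₀))) (cong (elementary c′ k g) (trans (e₁ z (ι (+ j) ⊗ c₀) c₀) (cong (z ⊖_) (sym (ι-suc-⊗ j c₀))))))
        (trans ∑ᶻ.∑-+ (cong (ℤ._+_ (powerSum c′ j (elementary c′ (suc k) g) z)) (∑ᶻ.∑-cong λ i → cong (elementary c′ k g) (e₂ z (ι (+ j) ⊗ c′ i) c₀)))))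
      where
      c₀ : F
      c₀ = c Fin.zero
      c′ : Fin _ → F
      c′ i = c (Fin.suc i)
      e₁ : ∀ z t c → z ⊖ t ⊖ c ≡ z ⊖ (t ⊕ c)
      e₁ = solve 3 (λ z t c → z :- t :- c := z :- (t :+ c)) refl
      e₂ : ∀ z t c → z ⊖ t ⊖ c ≡ z ⊖ c ⊖ t
      e₂ = solve 3 (λ z t c → z :- t :- c := z :- c :- t) refl

    newtonSum-zero : ∀ {n} (c : Fin (suc n) → F) j g z →
      newtonSum c j 0 g z ≡ g (z ⊖ ι (+ j) ⊗ c Fin.zero) ℤ.+ newtonSum (λ i → c (Fin.suc i)) j 0 g z
    newtonSum-zero c j g z = ∑ᶻ.∑-suc _

    -- All but one of the terms contributed by a new variable telescope.
    newtonSum-step : ∀ {n} (c : Fin (suc n) → F) j k g z →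
      newtonSum c j (suc k) g z ≡
        newtonSum (λ i → c (Fin.suc i)) j (suc k) g z ℤ.+ newtonSum (λ i → c (Fin.suc i)) j k g (z ⊖ c Fin.zero)
        ℤ.+ elementary (λ i → c (Fin.suc i)) (suc k) g (z ⊖ ι (+ j) ⊗ c Fin.zero)
    newtonSum-step c j zero g z = trans (cong₂ ℤ._-_ (powerSum-step c j 0 g z) (newtonSum-zero c (suc j) g z))
      (e (elementary (λ i → c (Fin.suc i)) (suc 0) g (z ⊖ ι (+ j) ⊗ c Fin.zero)) (elementary (λ i → c (Fin.suc i)) 0 g (z ⊖ ι (+ suc j) ⊗ c Fin.zero))
        (powerSum (λ i → c (Fin.suc i)) j (elementary (λ i → c (Fin.suc i)) (suc 0) g) z) (powerSum (λ i → c (Fin.suc i)) j (elementary (λ i → c (Fin.suc i)) 0 g) (z ⊖ c Fin.zero))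
        (newtonSum (λ i → c (Fin.suc i)) (suc j) 0 g z))
      where e : ∀ E G P₁ P₀ R → E ℤ.+ G ℤ.+ (P₁ ℤ.+ P₀) ℤ.- (G ℤ.+ R) ≡ P₁ ℤ.- R ℤ.+ P₀ ℤ.+ E
            e = solve-∀ᶻ
    newtonSum-step c j (suc k) g z = trans (cong₂ ℤ._-_ (powerSum-step c j (suc k) g z) (newtonSum-step c (suc j) k g z))
      (e (elementary (λ i → c (Fin.suc i)) (suc (suc k)) g (z ⊖ ι (+ j) ⊗ c Fin.zero)) (elementary (λ i → c (Fin.suc i)) (suc k) g (z ⊖ ι (+ suc j) ⊗ c Fin.zero))
        (powerSum (λ i → c (Fin.suc i)) j (elementary (λ i → c (Fin.suc i)) (suc (suc k)) g) z) (powerSum (λ i → c (Fin.suc i)) j (elementary (λ i → c (Fin.suc i)) (suc k) g) (z ⊖ c Fin.zero))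
        (newtonSum (λ i → c (Fin.suc i)) (suc j) (suc k) g z) (newtonSum (λ i → c (Fin.suc i)) (suc j) k g (z ⊖ c Fin.zero)))
      where e : ∀ E G P₁ P₀ R S → E ℤ.+ G ℤ.+ (P₁ ℤ.+ P₀) ℤ.- (R ℤ.+ S ℤ.+ G) ≡ P₁ ℤ.- R ℤ.+ (P₀ ℤ.- S) ℤ.+ E
            e = solve-∀ᶻ

    newtonSum-empty : (c : Fin 0 → F) → ∀ j k g z → newtonSum c j k g z ≡ ℤ.0ℤ
    newtonSum-empty c j zero g z = ∑ᶻ.∑-empty _
    newtonSum-empty c j (suc k) g z = cong₂ ℤ._-_ (∑ᶻ.∑-empty _) (newtonSum-empty c (suc j) k g z)

  -- Induction on the number of translations: a new variable contributes e_k(new) = e_k + c₀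
  -- e_(k-1), and the alternating sum obeys the same recursion by `newtonSum-step`.
  newton : ∀ {n} (c : Fin n → F) k g z → + suc k ℤ.* elementary c (suc k) g z ≡ newtonSum c 1 k g z
  newton {zero} c k g z = trans (ℤₚ.*-zeroʳ (+ suc k)) (sym (newtonSum-empty c 1 k g z))
  newton {suc n} c zero g z = begin
    + 1 ℤ.* (elementary c′ 1 g z ℤ.+ g (z ⊖ c₀)) ≡⟨ ℤₚ.*-distribˡ-+ (+ 1) (elementary c′ 1 g z) (g (z ⊖ c₀)) ⟩
    + 1 ℤ.* elementary c′ 1 g z ℤ.+ + 1 ℤ.* g (z ⊖ c₀) ≡⟨ cong₂ ℤ._+_ (newton c′ 0 g z) (trans (ℤₚ.*-identityˡ _) (cong (λ t → g (z ⊖ t)) (sym (⊗-idˡ c₀)))) ⟩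
    newtonSum c′ 1 0 g z ℤ.+ g (z ⊖ ι (+ 1) ⊗ c₀) ≡⟨ ℤₚ.+-comm (newtonSum c′ 1 0 g z) _ ⟩
    g (z ⊖ ι (+ 1) ⊗ c₀) ℤ.+ newtonSum c′ 1 0 g z ≡⟨ newtonSum-zero c 1 g z ⟨
    newtonSum c 1 0 g z ∎
    where
    open ≡-Reasoning
    c₀ : F
    c₀ = c Fin.zero
    c′ : Fin n → F
    c′ i = c (Fin.suc i)
  newton {suc n} c (suc k) g z = begin
    + suc (suc k) ℤ.* (elementary c′ (suc (suc k)) g z ℤ.+ elementary c′ (suc k) g (z ⊖ c₀)) ≡⟨ e (+ suc k) (elementary c′ (suc (suc k)) g z) (elementary c′ (suc k) g (z ⊖ c₀)) ⟩
    (+ 1 ℤ.+ + suc k) ℤ.* elementary c′ (suc (suc k)) g z ℤ.+ + suc k ℤ.* elementary c′ (suc k) g (z ⊖ c₀) ℤ.+ elementary c′ (suc k) g (z ⊖ c₀)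
      ≡⟨ cong₂ ℤ._+_ (cong₂ ℤ._+_ (newton c′ (suc k) g z) (newton c′ k g (z ⊖ c₀))) (cong (λ t → elementary c′ (suc k) g (z ⊖ t)) (sym (⊗-idˡ c₀))) ⟩
    newtonSum c′ 1 (suc k) g z ℤ.+ newtonSum c′ 1 k g (z ⊖ c₀) ℤ.+ elementary c′ (suc k) g (z ⊖ ι (+ 1) ⊗ c₀) ≡⟨ newtonSum-step c 1 k g z ⟨
    newtonSum c 1 (suc k) g z ∎
    where
    open ≡-Reasoning
    c₀ : F
    c₀ = c Fin.zero
    c′ : Fin n → F
    c′ i = c (Fin.suc i)
    e : ∀ s a b → (+ 1 ℤ.+ s) ℤ.* (a ℤ.+ b) ≡ (+ 1 ℤ.+ s) ℤ.* a ℤ.+ s ℤ.* b ℤ.+ b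
    e = solve-∀ᶻ

  elementary-mean-zero : ∀ {n} (c : Fin n → F) k g → ∑′ g ≡ ℤ.0ℤ → ∑′ (elementary c k g) ≡ ℤ.0ℤ
  elementary-mean-zero c zero g mz = mz
  elementary-mean-zero {zero} c (suc k) g mz = ∑ᶻ.∑-zero {n = p}
  elementary-mean-zero {suc n} c (suc k) g mz = trans ∑ᶻ.∑-+ (cong₂ ℤ._+_ (elementary-mean-zero (λ i → c (Fin.suc i)) (suc k) g mz)
    (trans (Reindexᶻ.∑-⊖ (c Fin.zero) (elementary (λ i → c (Fin.suc i)) k g)) (elementary-mean-zero (λ i → c (Fin.suc i)) k g mz)))

  delta : F → ℤ
  delta z = + (if does (0ᶠ ≟ᶠ z) then 1 else 0)

  -- Translations fix constants, so the k-th polynomial multiplies the constant 1 by its number of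
  -- terms. Centring by p δ - 1 keeps integer values and has mean zero, and it produces p times the
  -- error of the theorem.
  elementary-centred : ∀ {n} (c : Fin n → F) k z →
    elementary c k (λ z → + p ℤ.* delta z ℤ.- + 1) z ≡ + p ℤ.* elementary c k delta z ℤ.- + (n C k)
  elementary-centred {n} c zero z = refl
  elementary-centred {zero} c (suc k) z = sym (cong (ℤ._- + 0) (ℤₚ.*-zeroʳ (+ p)))
  elementary-centred {suc n} c (suc k) z = begin
    elementary c′ (suc k) (λ z → + p ℤ.* delta z ℤ.- + 1) z ℤ.+ elementary c′ k (λ z → + p ℤ.* delta z ℤ.- + 1) (z ⊖ c Fin.zero)
      ≡⟨ cong₂ ℤ._+_ (elementary-centred c′ (suc k) z) (elementary-centred c′ k (z ⊖ c Fin.zero)) ⟩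
    (+ p ℤ.* x ℤ.- + (n C suc k)) ℤ.+ (+ p ℤ.* y ℤ.- + (n C k)) ≡⟨ e (+ p) x y (+ (n C suc k)) (+ (n C k)) ⟩
    + p ℤ.* (x ℤ.+ y) ℤ.- (+ (n C k) ℤ.+ + (n C suc k)) ≡⟨ cong (λ t → + p ℤ.* (x ℤ.+ y) ℤ.- t) (trans (sym (ℤₚ.pos-+ (n C k) (n C suc k))) (cong +_ (nCk+nC[k+1]≡[n+1]C[k+1] n k))) ⟩
    + p ℤ.* (x ℤ.+ y) ℤ.- + (suc n C suc k) ∎
    where
    open ≡-Reasoning
    open import Data.Nat.Combinatorics using (nCk+nC[k+1]≡[n+1]C[k+1])
    c′ : Fin n → F
    c′ i = c (Fin.suc i)
    x y : ℤ
    x = elementary c′ (suc k) delta z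
    y = elementary c′ k delta (z ⊖ c Fin.zero)
    e : ∀ p x y a b → p ℤ.* x ℤ.- a ℤ.+ (p ℤ.* y ℤ.- b) ≡ p ℤ.* (x ℤ.+ y) ℤ.- (b ℤ.+ a)
    e = solve-∀ᶻ

  chosen : ∀ {n} → (Fin n → ℕ) → ℕ → F → Subset n → Bool
  chosen f k b S = (cardˢ S ≡ᵇ k) ∧ does (ι (+ sumOver f S) ≟ᶠ b)

  -- Applied to a point mass at 0, each product of k translations marks one subset sum; the
  -- recursion of the polynomial splits subsets by their first element.
  elementary-count : ∀ {n} (f : Fin n → ℕ) k b →
    elementary (λ i → ι (+ f i)) k delta b ≡ + count (chosen f k b) (subsets n)
  elementary-count {zero} f zero b with does (0ᶠ ≟ᶠ b)
  ... | true = refl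
  ... | false = refl
  elementary-count {zero} f (suc k) b = refl
  elementary-count {suc n} f k b = begin
    elementary (λ i → ι (+ f i)) k delta b ≡⟨ split k ⟩
    + (count (λ S → chosen f k b (inside ∷ᵛ S)) (subsets n) + count (λ S → chosen f k b (outside ∷ᵛ S)) (subsets n))
      ≡⟨ cong +_ (cong₂ _+_ (sym (count-map (chosen f k b) (inside ∷ᵛ_) (subsets n))) (sym (count-map (chosen f k b) (outside ∷ᵛ_) (subsets n)))) ⟩
    + (count (chosen f k b) (map (inside ∷ᵛ_) (subsets n)) + count (chosen f k b) (map (outside ∷ᵛ_) (subsets n)))
      ≡⟨ cong +_ (count-++ (chosen f k b) (map (inside ∷ᵛ_) (subsets n)) (map (outside ∷ᵛ_) (subsets n))) ⟨
    + count (chosen f k b) (subsets (suc n)) ∎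
    where
    open ≡-Reasoning
    f′ : Fin n → ℕ
    f′ i = f (Fin.suc i)
    shifted : ∀ k S → chosen f′ k (b ⊖ ι (+ f Fin.zero)) S ≡ chosen f (suc k) b (inside ∷ᵛ S)
    shifted k S = cong (λ t → (cardˢ S ≡ᵇ k) ∧ t) (does-⇔ (mk⇔
        (λ e → trans (ι-⊕ (+ f Fin.zero) (+ s)) (trans (cong (ι (+ f Fin.zero) ⊕_) e) (e₁ (ι (+ f Fin.zero)) b)))
        (λ e → trans (e₂ (ι (+ f Fin.zero)) (ι (+ s))) (cong (_⊖ ι (+ f Fin.zero)) (trans (sym (ι-⊕ (+ f Fin.zero) (+ s))) e))))
        (ι (+ s) ≟ᶠ b ⊖ ι (+ f Fin.zero)) (ι (+ (f Fin.zero + s)) ≟ᶠ b))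
      where
      s : ℕ
      s = sumOver f′ S
      e₁ : ∀ a b → a ⊕ (b ⊖ a) ≡ b
      e₁ = solve 2 (λ a b → a :+ (b :- a) := b) refl
      e₂ : ∀ a s → s ≡ a ⊕ s ⊖ a
      e₂ = solve 2 (λ a s → s := a :+ s :- a) refl
    split : ∀ k → elementary (λ i → ι (+ f i)) k delta b ≡
      + (count (λ S → chosen f k b (inside ∷ᵛ S)) (subsets n) + count (λ S → chosen f k b (outside ∷ᵛ S)) (subsets n))
    split zero = trans (elementary-count f′ zero b) (cong (λ t → + (t + count (chosen f′ zero b) (subsets n))) (sym (count-none (subsets n))))
    split (suc k) = begin
      elementary (λ i → ι (+ f′ i)) (suc k) delta b ℤ.+ elementary (λ i → ι (+ f′ i)) k delta (b ⊖ ι (+ f Fin.zero))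
        ≡⟨ cong₂ ℤ._+_ (elementary-count f′ (suc k) b) (elementary-count f′ k (b ⊖ ι (+ f Fin.zero))) ⟩
      + count (chosen f′ (suc k) b) (subsets n) ℤ.+ + count (chosen f′ k (b ⊖ ι (+ f Fin.zero))) (subsets n)
        ≡⟨ ℤₚ.+-comm (+ count (chosen f′ (suc k) b) (subsets n)) (+ count (chosen f′ k (b ⊖ ι (+ f Fin.zero))) (subsets n)) ⟩
      + (count (chosen f′ k (b ⊖ ι (+ f Fin.zero))) (subsets n) + count (chosen f′ (suc k) b) (subsets n))
        ≡⟨ cong (λ t → + (t + count (chosen f′ (suc k) b) (subsets n))) (count-cong (shifted k) (subsets n)) ⟩
      + (count (λ S → chosen f (suc k) b (inside ∷ᵛ S)) (subsets n) + count (chosen f′ (suc k) b) (subsets n)) ∎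

  module _ (m : ℕ) where

    open PowerMap m

    powers : Fin q → F
    powers i = Fin.suc i ^ᶠ m

    ι-powers : ∀ i → ι (+ (suc (toℕ i) ^ m)) ≡ powers i
    ι-powers i = trans (ι-^ (suc (toℕ i)) m) (cong (_^ᶠ m) (ι-toℕ (Fin.suc i)))

    Nstar-elementary : ∀ k b → + Nstar p m k b ≡ elementary (λ i → ι (+ (suc (toℕ i) ^ m))) k delta b
    Nstar-elementary k b = trans (cong +_ (count-cong (λ S → cong (λ t → (cardˢ S ≡ᵇ k) ∧ t)
        (trans (cong (_≡ᵇ toℕ b) (sym (toℕ-ι (sumOver (λ i → suc (toℕ i) ^ m) S)))) (≡ᵇ-does (ι (+ sumOver (λ i → suc (toℕ i) ^ m) S)) b))) (subsets q)))
      (sym (elementary-count {q} (λ i → suc (toℕ i) ^ m) k b))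

    -- Substituting j z for z carries the dilation by j from the powers to u, so every power sum
    -- with j invertible has the same operator norm as convolution with π.
    powerSum-norm : ∀ j → ι (+ j) ≢ 0ᶠ → ∀ u → ‖ powerSum (λ i → ι (+ (suc (toℕ i) ^ m))) j u ‖² ≡ ‖ convolve π (λ y → u (ι (+ j) ⊗ y)) ‖²
    powerSum-norm j j≢0 u = trans (sym (Reindexᶻ.∑-⊗ j≢0 (λ z → powerSum c j u z ℤ.* powerSum c j u z)))
        (∑ᶻ.∑-cong λ z → cong (λ t → t ℤ.* t) (pointwise z))
      where
      c : Fin q → F
      c i = ι (+ (suc (toℕ i) ^ m))
      factor : ∀ j z c → j ⊗ z ⊖ j ⊗ c ≡ j ⊗ (z ⊖ c)
      factor = solve 3 (λ j z c → j :* z :- j :* c := j :* (z :- c)) refl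
      pointwise : ∀ z → powerSum c j u (ι (+ j) ⊗ z) ≡ convolve π (λ y → u (ι (+ j) ⊗ y)) z
      pointwise z = trans (∑ᶻ.∑-cong λ i → cong u (trans (factor (ι (+ j)) z (c i)) (cong (λ t → ι (+ j) ⊗ (z ⊖ t)) (ι-powers i))))
        (sym (convolve-π (λ y → u (ι (+ j) ⊗ y)) z))

  ι-nonzero : ∀ j → 1 ≤ j → j < p → ι (+ j) ≢ 0ᶠ
  ι-nonzero j 1≤j j<p e = ℕₚ.<⇒≢ 1≤j (sym (trans (sym (Data.Nat.DivMod.m<n⇒m%n≡m j<p)) (trans (sym (toℕ-ι j)) (trans (cong toℕ e) (cong toℕ 0ᶠ≡zero)))))

  ∑delta : ∑′ delta ≡ + 1
  ∑delta = trans (∑′-single delta 0ᶠ λ x x≢0 → off x (0ᶠ ≟ᶠ x) x≢0) (on (0ᶠ ≟ᶠ 0ᶠ))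
    where
    off : ∀ x (d : Dec (0ᶠ ≡ x)) → x ≢ 0ᶠ → + (if does d then 1 else 0) ≡ ℤ.0ℤ
    off x (yes e) x≢0 = ⊥-elim (x≢0 (sym e))
    off x (no _) _ = refl
    on : (d : Dec (0ᶠ ≡ 0ᶠ)) → + (if does d then 1 else 0) ≡ + 1
    on (yes _) = refl
    on (no ne) = ⊥-elim (ne refl)

  norm-centred : ‖ (λ z → + p ℤ.* delta z ℤ.- + 1) ‖² ≡ + (p * q)
  norm-centred = begin
    ‖ g ‖² ≡⟨ ∑ᶻ.∑-cong (λ z → square (0ᶠ ≟ᶠ z)) ⟩
    ∑′ (λ z → + (p * p) ℤ.* delta z ℤ.- + (p + p) ℤ.* delta z ℤ.+ + 1) ≡⟨ ∑ᶻ.∑-cong (λ z → collect (+ (p * p)) (+ (p + p)) (delta z)) ⟩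
    ∑′ (λ z → (+ (p * p) ℤ.- + (p + p)) ℤ.* delta z ℤ.+ + 1) ≡⟨ ∑ᶻ.∑-+ ⟩
    ∑′ (λ z → (+ (p * p) ℤ.- + (p + p)) ℤ.* delta z) ℤ.+ ∑′ (λ (_ : F) → + 1) ≡⟨ cong₂ ℤ._+_ (trans (∑ᶻ.∑-*ˡ (+ (p * p) ℤ.- + (p + p))) (trans (cong (ℤ._*_ (+ (p * p) ℤ.- + (p + p))) ∑delta) (ℤₚ.*-identityʳ (+ (p * p) ℤ.- + (p + p))))) (∑′-const p (+ 1)) ⟩
    + (p * p) ℤ.- + (p + p) ℤ.+ + p ℤ.* + 1 ≡⟨ cong₂ (λ s t → s ℤ.- t ℤ.+ + p ℤ.* + 1) (ℤₚ.pos-* p p) (ℤₚ.pos-+ p p) ⟩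
    + p ℤ.* + p ℤ.- (+ p ℤ.+ + p) ℤ.+ + p ℤ.* + 1 ≡⟨ final (+ q) ⟩
    (+ 1 ℤ.+ + q) ℤ.* + q ≡⟨ ℤₚ.pos-* p q ⟨
    + (p * q) ∎
    where
    open ≡-Reasoning
    g : F → ℤ
    g z = + p ℤ.* delta z ℤ.- + 1
    collect : ∀ a b d → a ℤ.* d ℤ.- b ℤ.* d ℤ.+ + 1 ≡ (a ℤ.- b) ℤ.* d ℤ.+ + 1
    collect = solve-∀ᶻ
    final : ∀ q → (+ 1 ℤ.+ q) ℤ.* (+ 1 ℤ.+ q) ℤ.- ((+ 1 ℤ.+ q) ℤ.+ (+ 1 ℤ.+ q)) ℤ.+ (+ 1 ℤ.+ q) ℤ.* + 1 ≡ (+ 1 ℤ.+ q) ℤ.* q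
    final = solve-∀ᶻ
    square : ∀ {P : Set} (d : Dec P) → let δ = + (if does d then 1 else 0) in
      (+ p ℤ.* δ ℤ.- + 1) ℤ.* (+ p ℤ.* δ ℤ.- + 1) ≡ + (p * p) ℤ.* δ ℤ.- + (p + p) ℤ.* δ ℤ.+ + 1
    square (yes _) = trans (e (+ p)) (cong₂ (λ s t → s ℤ.* + 1 ℤ.- t ℤ.* + 1 ℤ.+ + 1) (sym (ℤₚ.pos-* p p)) (sym (ℤₚ.pos-+ p p)))
      where e : ∀ p → (p ℤ.* + 1 ℤ.- + 1) ℤ.* (p ℤ.* + 1 ℤ.- + 1) ≡ p ℤ.* p ℤ.* + 1 ℤ.- (p ℤ.+ p) ℤ.* + 1 ℤ.+ + 1
            e = solve-∀ᶻ
    square (no _) = trans (e (+ p)) (cong₂ (λ s t → s ℤ.* + 0 ℤ.- t ℤ.* + 0 ℤ.+ + 1) (sym (ℤₚ.pos-* p p)) (sym (ℤₚ.pos-+ p p)))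
      where e : ∀ p → (p ℤ.* + 0 ℤ.- + 1) ℤ.* (p ℤ.* + 0 ℤ.- + 1) ≡ p ℤ.* p ℤ.* + 0 ℤ.- (p ℤ.+ p) ℤ.* + 0 ℤ.+ + 1
            e = solve-∀ᶻ

  mean-zero-centred : ∑′ (λ z → + p ℤ.* delta z ℤ.- + 1) ≡ ℤ.0ℤ
  mean-zero-centred = begin
    ∑′ (λ z → + p ℤ.* delta z ℤ.- + 1) ≡⟨ ∑ᶻ.∑-+ ⟩
    ∑′ (λ z → + p ℤ.* delta z) ℤ.+ ∑′ (λ (_ : F) → ℤ.- + 1) ≡⟨ cong₂ ℤ._+_ (trans (∑ᶻ.∑-*ˡ (+ p)) (cong (ℤ._*_ (+ p)) ∑delta)) (∑′-const p (ℤ.- + 1)) ⟩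
    + p ℤ.* + 1 ℤ.+ + p ℤ.* (ℤ.- + 1) ≡⟨ e (+ p) ⟩
    ℤ.0ℤ ∎
    where
    open ≡-Reasoning
    e : ∀ p → p ℤ.* + 1 ℤ.+ p ℤ.* (ℤ.- + 1) ≡ ℤ.0ℤ
    e = solve-∀ᶻ

-- Rational arithmetic, binomial coefficients and extraction of roots

module RationalLemmas where

  open Data.Rational.Solver.+-*-Solver using () renaming (solve to solveℚ; _:=_ to _:≡_; _:+_ to _:⊹_; _:*_ to _:×_; _:-_ to _:∸_; con to conℚ; :-_ to :⊝_) public

  fromℤ : ℤ → ℚ
  fromℤ i = i ℚ./ 1

  private
    toℚᵘ-fromℤ : ∀ i → ℚ.toℚᵘ (fromℤ i) ℚᵘ.≃ ℚᵘ.mkℚᵘ i 0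
    toℚᵘ-fromℤ i = ℚₚ.toℚᵘ-fromℚᵘ (ℚᵘ.mkℚᵘ i 0)

  fromℤ-+ : ∀ i j → fromℤ (i ℤ.+ j) ≡ fromℤ i ℚ.+ fromℤ j
  fromℤ-+ i j = ℚₚ.toℚᵘ-injective (begin
    ℚ.toℚᵘ (fromℤ (i ℤ.+ j)) ≈⟨ toℚᵘ-fromℤ (i ℤ.+ j) ⟩
    ℚᵘ.mkℚᵘ (i ℤ.+ j) 0 ≈⟨ ℚᵘ.*≡* (e i j) ⟩
    ℚᵘ.mkℚᵘ i 0 ℚᵘ.+ ℚᵘ.mkℚᵘ j 0 ≈⟨ ℚᵘₚ.+-cong (toℚᵘ-fromℤ i) (toℚᵘ-fromℤ j) ⟨
    ℚ.toℚᵘ (fromℤ i) ℚᵘ.+ ℚ.toℚᵘ (fromℤ j) ≈⟨ ℚₚ.toℚᵘ-homo-+ (fromℤ i) (fromℤ j) ⟨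
    ℚ.toℚᵘ (fromℤ i ℚ.+ fromℤ j) ∎)
    where
    open import Relation.Binary.Reasoning.Setoid ℚᵘₚ.≃-setoid
    e : ∀ i j → (i ℤ.+ j) ℤ.* + 1 ≡ (i ℤ.* + 1 ℤ.+ j ℤ.* + 1) ℤ.* + 1
    e = solve-∀ᶻ

  fromℤ-* : ∀ i j → fromℤ (i ℤ.* j) ≡ fromℤ i ℚ.* fromℤ j
  fromℤ-* i j = ℚₚ.toℚᵘ-injective (begin
    ℚ.toℚᵘ (fromℤ (i ℤ.* j)) ≈⟨ toℚᵘ-fromℤ (i ℤ.* j) ⟩
    ℚᵘ.mkℚᵘ i 0 ℚᵘ.* ℚᵘ.mkℚᵘ j 0 ≈⟨ ℚᵘₚ.*-cong (toℚᵘ-fromℤ i) (toℚᵘ-fromℤ j) ⟨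
    ℚ.toℚᵘ (fromℤ i) ℚᵘ.* ℚ.toℚᵘ (fromℤ j) ≈⟨ ℚₚ.toℚᵘ-homo-* (fromℤ i) (fromℤ j) ⟨
    ℚ.toℚᵘ (fromℤ i ℚ.* fromℤ j) ∎)
    where open import Relation.Binary.Reasoning.Setoid ℚᵘₚ.≃-setoid

  fromℤ-neg : ∀ i → fromℤ (ℤ.- i) ≡ ℚ.- fromℤ i
  fromℤ-neg i = ℚₚ.toℚᵘ-injective (begin
    ℚ.toℚᵘ (fromℤ (ℤ.- i)) ≈⟨ toℚᵘ-fromℤ (ℤ.- i) ⟩
    ℚᵘ.- ℚᵘ.mkℚᵘ i 0 ≈⟨ ℚᵘₚ.-‿cong (toℚᵘ-fromℤ i) ⟨
    ℚᵘ.- ℚ.toℚᵘ (fromℤ i) ≈⟨ ℚₚ.toℚᵘ-homo‿- (fromℤ i) ⟨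
    ℚ.toℚᵘ (ℚ.- fromℤ i) ∎)
    where open import Relation.Binary.Reasoning.Setoid ℚᵘₚ.≃-setoid

  fromℤ-mono-≤ : ∀ {i j} → i ℤ.≤ j → fromℤ i ℚ.≤ fromℤ j
  fromℤ-mono-≤ {i} {j} i≤j = ℚₚ.toℚᵘ-cancel-≤ (ℚᵘₚ.≤-trans (ℚᵘₚ.≤-reflexive (toℚᵘ-fromℤ i))
    (ℚᵘₚ.≤-trans (ℚᵘ.*≤* (ℤₚ.*-monoʳ-≤-nonNeg (+ 1) i≤j)) (ℚᵘₚ.≤-reflexive (ℚᵘₚ.≃-sym (toℚᵘ-fromℤ j)))))

  fromℕ-+ : ∀ a b → fromℕ (a + b) ≡ fromℕ a ℚ.+ fromℕ b
  fromℕ-+ a b = fromℤ-+ (+ a) (+ b)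

  fromℕ-* : ∀ a b → fromℕ (a * b) ≡ fromℕ a ℚ.* fromℕ b
  fromℕ-* a b = trans (cong fromℤ (ℤₚ.pos-* a b)) (fromℤ-* (+ a) (+ b))

  fromℕ-mono-≤ : ∀ {a b} → a ≤ b → fromℕ a ℚ.≤ fromℕ b
  fromℕ-mono-≤ a≤b = fromℤ-mono-≤ (ℤ.+≤+ a≤b)

  0≤fromℕ : ∀ a → 0ℚ ℚ.≤ fromℕ a
  0≤fromℕ a = fromℕ-mono-≤ {0} {a} z≤n

  1≤fromℕ : ∀ {a} → 1 ≤ a → 1ℚ ℚ.≤ fromℕ a
  1≤fromℕ {a} = fromℕ-mono-≤ {1} {a}

  0<fromℕ : ∀ {a} → 1 ≤ a → 0ℚ ℚ.< fromℕ a
  0<fromℕ 1≤a = ℚₚ.<-≤-trans (ℚₚ.positive⁻¹ 1ℚ) (1≤fromℕ 1≤a)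

  *-monoˡ : ∀ {a b c} → 0ℚ ℚ.≤ a → b ℚ.≤ c → a ℚ.* b ℚ.≤ a ℚ.* c
  *-monoˡ {a} 0≤a = ℚₚ.*-monoˡ-≤-nonNeg a {{ℚ.nonNegative 0≤a}}

  *-monoʳ : ∀ {a b c} → 0ℚ ℚ.≤ a → b ℚ.≤ c → b ℚ.* a ℚ.≤ c ℚ.* a
  *-monoʳ {a} 0≤a = ℚₚ.*-monoʳ-≤-nonNeg a {{ℚ.nonNegative 0≤a}}

  *-mono : ∀ {a b c d} → 0ℚ ℚ.≤ b → 0ℚ ℚ.≤ c → a ℚ.≤ b → c ℚ.≤ d → a ℚ.* c ℚ.≤ b ℚ.* d
  *-mono 0≤b 0≤c a≤b c≤d = ℚₚ.≤-trans (*-monoʳ 0≤c a≤b) (*-monoˡ 0≤b c≤d)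

  *-nonneg : ∀ {a b} → 0ℚ ℚ.≤ a → 0ℚ ℚ.≤ b → 0ℚ ℚ.≤ a ℚ.* b
  *-nonneg {a} {b} 0≤a 0≤b = subst (ℚ._≤ a ℚ.* b) (ℚₚ.*-zeroʳ a) (*-monoˡ 0≤a 0≤b)

  +-nonneg : ∀ {a b} → 0ℚ ℚ.≤ a → 0ℚ ℚ.≤ b → 0ℚ ℚ.≤ a ℚ.+ b
  +-nonneg 0≤a 0≤b = ℚₚ.+-mono-≤ 0≤a 0≤b

  *-pos : ∀ {a b} → 0ℚ ℚ.< a → 0ℚ ℚ.< b → 0ℚ ℚ.< a ℚ.* b
  *-pos {a} {b} 0<a 0<b = subst (ℚ._< a ℚ.* b) (ℚₚ.*-zeroʳ a) (ℚₚ.*-monoʳ-<-pos a {{ℚ.positive 0<a}} 0<b)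

  *-cancelˡ-pos : ∀ {a b c} → 0ℚ ℚ.< a → a ℚ.* b ℚ.≤ a ℚ.* c → b ℚ.≤ c
  *-cancelˡ-pos {a} 0<a = ℚₚ.*-cancelˡ-≤-pos a {{ℚ.positive 0<a}}

  <⇒≱ℚ : ∀ {a b} → a ℚ.< b → ¬ b ℚ.≤ a
  <⇒≱ℚ a<b b≤a = ℚₚ.<-irrefl refl (ℚₚ.<-≤-trans a<b b≤a)

  square-cancel : ∀ {x y} → 0ℚ ℚ.≤ y → x ℚ.* x ℚ.≤ y ℚ.* y → x ℚ.≤ y
  square-cancel {x} {y} 0≤y x²≤y² = ℚₚ.≮⇒≥ λ y<x → <⇒≱ℚ (ℚₚ.≤-<-trans (*-monoˡ 0≤y (ℚₚ.<⇒≤ y<x))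
    (ℚₚ.*-monoˡ-<-pos x {{ℚ.positive (ℚₚ.≤-<-trans 0≤y y<x)}} y<x)) x²≤y²

  ∣∣-square : ∀ x → ℚ.∣ x ∣ ℚ.* ℚ.∣ x ∣ ≡ x ℚ.* x
  ∣∣-square x with ℚₚ.∣p∣≡p∨∣p∣≡-p x
  ... | inj₁ e = cong₂ ℚ._*_ e e
  ... | inj₂ e = trans (cong₂ ℚ._*_ e e) (solveℚ 1 (λ x → :⊝ x :× :⊝ x :≡ x :× x) refl x)

  powℚ-+ : ∀ x i j → powℚ x (i + j) ≡ powℚ x i ℚ.* powℚ x j
  powℚ-+ x zero j = sym (ℚₚ.*-identityˡ (powℚ x j))
  powℚ-+ x (suc i) j = trans (cong (x ℚ.*_) (powℚ-+ x i j)) (sym (ℚₚ.*-assoc x (powℚ x i) (powℚ x j)))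

  powℚ-* : ∀ x y n → powℚ (x ℚ.* y) n ≡ powℚ x n ℚ.* powℚ y n
  powℚ-* x y zero = sym (ℚₚ.*-identityˡ 1ℚ)
  powℚ-* x y (suc n) = trans (cong (x ℚ.* y ℚ.*_) (powℚ-* x y n))
    (solveℚ 4 (λ x y a b → x :× y :× (a :× b) :≡ x :× a :× (y :× b)) refl x y (powℚ x n) (powℚ y n))

  powℚ-fromℕ : ∀ a n → powℚ (fromℕ a) n ≡ fromℕ (a ^ n)
  powℚ-fromℕ a zero = refl
  powℚ-fromℕ a (suc n) = trans (cong (fromℕ a ℚ.*_) (powℚ-fromℕ a n)) (sym (fromℕ-* a (a ^ n)))

  powℚ-nonneg : ∀ {x} n → 0ℚ ℚ.≤ x → 0ℚ ℚ.≤ powℚ x n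
  powℚ-nonneg zero 0≤x = 0≤fromℕ 1
  powℚ-nonneg (suc n) 0≤x = *-nonneg 0≤x (powℚ-nonneg n 0≤x)

  powℚ-mono : ∀ {x y} n → 0ℚ ℚ.≤ x → x ℚ.≤ y → powℚ x n ℚ.≤ powℚ y n
  powℚ-mono zero 0≤x x≤y = ℚₚ.≤-refl
  powℚ-mono (suc n) 0≤x x≤y = *-mono (ℚₚ.≤-trans 0≤x x≤y) (powℚ-nonneg n 0≤x) x≤y (powℚ-mono n 0≤x x≤y)

  ÷ℕ-cancel : ∀ x n → 1 ≤ n → (x ÷ℕ n) ℚ.* fromℕ n ≡ x
  ÷ℕ-cancel x (suc n) _ = trans (ℚₚ.*-assoc x ((+ 1) ℚ./ suc n) (fromℕ (suc n)))
      (trans (cong (x ℚ.*_) inverse) (ℚₚ.*-identityʳ x))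
    where
    open import Relation.Binary.Reasoning.Setoid ℚᵘₚ.≃-setoid
    inverse : ((+ 1) ℚ./ suc n) ℚ.* fromℕ (suc n) ≡ 1ℚ
    inverse = ℚₚ.toℚᵘ-injective (begin
      ℚ.toℚᵘ (((+ 1) ℚ./ suc n) ℚ.* fromℕ (suc n)) ≈⟨ ℚₚ.toℚᵘ-homo-* ((+ 1) ℚ./ suc n) (fromℕ (suc n)) ⟩
      ℚ.toℚᵘ ((+ 1) ℚ./ suc n) ℚᵘ.* ℚ.toℚᵘ (fromℕ (suc n)) ≈⟨ ℚᵘₚ.*-cong (ℚₚ.toℚᵘ-fromℚᵘ (ℚᵘ.mkℚᵘ (+ 1) n)) (toℚᵘ-fromℤ (+ suc n)) ⟩
      ℚᵘ.mkℚᵘ (+ 1) n ℚᵘ.* ℚᵘ.mkℚᵘ (+ suc n) 0 ≈⟨ ℚᵘ.*≡* (trans (e (+ suc n)) (cong (λ t → + 1 ℤ.* t) (sym (ℤₚ.pos-* (suc n) 1)))) ⟩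
      ℚᵘ.mkℚᵘ (+ 1) 0 ∎)
      where
      e : ∀ s → + 1 ℤ.* s ℤ.* + 1 ≡ + 1 ℤ.* (s ℤ.* + 1)
      e = solve-∀ᶻ

  falling-suc : ∀ y k → falling y (suc k) ≡ y ℚ.* falling (y - 1ℚ) k
  falling-suc y zero = solveℚ 1 (λ y → conℚ 1ℚ :× (y :∸ conℚ 0ℚ) :≡ y :× conℚ 1ℚ) refl y
  falling-suc y (suc k) = begin
    falling y (suc k) ℚ.* (y - fromℕ (suc k)) ≡⟨ cong₂ (λ a b → a ℚ.* (y - b)) (falling-suc y k) (fromℕ-+ 1 k) ⟩
    y ℚ.* falling (y - 1ℚ) k ℚ.* (y - (1ℚ ℚ.+ fromℕ k)) ≡⟨ solveℚ 3 (λ y a k → y :× a :× (y :∸ (conℚ 1ℚ :⊹ k)) :≡ y :× (a :× ((y :∸ conℚ 1ℚ) :∸ k))) refl y (falling (y - 1ℚ) k) (fromℕ k) ⟩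
    y ℚ.* (falling (y - 1ℚ) k ℚ.* (y - 1ℚ - fromℕ k)) ∎
    where open ≡-Reasoning

  -- The coefficient (B + k - 1 choose k), in the recursive form that Newton's identity yields: k +
  -- 1 times the next value is B + k times the present one.
  multichoose : ℚ → ℕ → ℚ
  multichoose B zero = 1ℚ
  multichoose B (suc k) = (multichoose B k ℚ.* (B ℚ.+ fromℕ k)) ÷ℕ suc k

  multichoose-suc : ∀ B k → multichoose B (suc k) ℚ.* fromℕ (suc k) ≡ multichoose B k ℚ.* (B ℚ.+ fromℕ k)
  multichoose-suc B k = ÷ℕ-cancel (multichoose B k ℚ.* (B ℚ.+ fromℕ k)) (suc k) (s≤s z≤n)

  ÷ℕ-nonneg : ∀ {x} n → 0ℚ ℚ.≤ x → 0ℚ ℚ.≤ x ÷ℕ n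
  ÷ℕ-nonneg zero 0≤x = ℚₚ.≤-refl
  ÷ℕ-nonneg {x} (suc n) 0≤x = *-cancelˡ-pos (0<fromℕ {suc n} (s≤s z≤n)) (subst₂ ℚ._≤_ (sym (ℚₚ.*-zeroʳ (fromℕ (suc n))))
    (sym (trans (ℚₚ.*-comm (fromℕ (suc n)) (x ÷ℕ suc n)) (÷ℕ-cancel x (suc n) (s≤s z≤n)))) 0≤x)

  multichoose-nonneg : ∀ {B} k → 0ℚ ℚ.≤ B → 0ℚ ℚ.≤ multichoose B k
  multichoose-nonneg zero 0≤B = 0≤fromℕ 1
  multichoose-nonneg {B} (suc k) 0≤B = ÷ℕ-nonneg (suc k) (*-nonneg (multichoose-nonneg k 0≤B) (+-nonneg 0≤B (0≤fromℕ k)))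

  -- Factor by factor, largest with largest: B + k - 1 is compared with y, B + k - 2 with y - 1, and
  -- so on. The hypothesis says y ≥ B + k - 1 without subtraction.
  multichoose-factorial : ∀ {B} k y → 0ℚ ℚ.≤ B → B ℚ.+ fromℕ k ℚ.≤ y ℚ.+ 1ℚ →
    multichoose B k ℚ.* fromℕ (k !) ℚ.≤ falling y k
  multichoose-factorial zero y 0≤B _ = ℚₚ.≤-reflexive refl
  multichoose-factorial {B} (suc k) y 0≤B h = subst₂ ℚ._≤_ (sym lhs) (sym (falling-suc y k))
      (subst (ℚ._≤ y ℚ.* falling (y - 1ℚ) k) (ℚₚ.*-comm (B ℚ.+ fromℕ k) _)
        (*-mono 0≤y 0≤mc B+k≤y (multichoose-factorial k (y - 1ℚ) 0≤B (subst (B ℚ.+ fromℕ k ℚ.≤_) (back y) B+k≤y))))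
    where
    back : ∀ y → y ≡ y - 1ℚ ℚ.+ 1ℚ
    back = solveℚ 1 (λ y → y :≡ y :∸ conℚ 1ℚ :⊹ conℚ 1ℚ) refl
    shift : ∀ b k → b ℚ.+ (1ℚ ℚ.+ k) ℚ.+ ℚ.- 1ℚ ≡ b ℚ.+ k
    shift = solveℚ 2 (λ b k → b :⊹ (conℚ 1ℚ :⊹ k) :⊹ conℚ (ℚ.- 1ℚ) :≡ b :⊹ k) refl
    unshift : ∀ y → y ℚ.+ 1ℚ ℚ.+ ℚ.- 1ℚ ≡ y
    unshift = solveℚ 1 (λ y → y :⊹ conℚ 1ℚ :⊹ conℚ (ℚ.- 1ℚ) :≡ y) refl
    B+k≤y : B ℚ.+ fromℕ k ℚ.≤ y
    B+k≤y = subst₂ ℚ._≤_ (trans (cong (λ t → B ℚ.+ t ℚ.+ ℚ.- 1ℚ) (fromℕ-+ 1 k)) (shift B (fromℕ k))) (unshift y) (ℚₚ.+-monoˡ-≤ (ℚ.- 1ℚ) h)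
    0≤y : 0ℚ ℚ.≤ y
    0≤y = ℚₚ.≤-trans (+-nonneg 0≤B (0≤fromℕ k)) B+k≤y
    0≤mc : 0ℚ ℚ.≤ multichoose B k ℚ.* fromℕ (k !)
    0≤mc = *-nonneg (multichoose-nonneg k 0≤B) (0≤fromℕ (k !))
    lhs : multichoose B (suc k) ℚ.* fromℕ (suc k !) ≡ multichoose B k ℚ.* fromℕ (k !) ℚ.* (B ℚ.+ fromℕ k)
    lhs = begin
      multichoose B (suc k) ℚ.* fromℕ (suc k * k !) ≡⟨ cong (multichoose B (suc k) ℚ.*_) (fromℕ-* (suc k) (k !)) ⟩
      multichoose B (suc k) ℚ.* (fromℕ (suc k) ℚ.* fromℕ (k !)) ≡⟨ ℚₚ.*-assoc (multichoose B (suc k)) (fromℕ (suc k)) (fromℕ (k !)) ⟨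
      multichoose B (suc k) ℚ.* fromℕ (suc k) ℚ.* fromℕ (k !) ≡⟨ cong (ℚ._* fromℕ (k !)) (multichoose-suc B k) ⟩
      multichoose B k ℚ.* (B ℚ.+ fromℕ k) ℚ.* fromℕ (k !) ≡⟨ solveℚ 3 (λ a b c → a :× b :× c :≡ a :× c :× b) refl (multichoose B k) (B ℚ.+ fromℕ k) (fromℕ (k !)) ⟩
      multichoose B k ℚ.* fromℕ (k !) ℚ.* (B ℚ.+ fromℕ k) ∎
      where open ≡-Reasoning

  multichoose≤binom : ∀ {B} k y → 0ℚ ℚ.≤ B → B ℚ.+ fromℕ k ℚ.≤ y ℚ.+ 1ℚ → multichoose B k ℚ.≤ binomℚ y k
  multichoose≤binom {B} k y 0≤B h = ℚₚ.*-cancelʳ-≤-pos (fromℕ (k !)) {{ℚ.positive (0<fromℕ 1≤k!)}}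
      (subst (multichoose B k ℚ.* fromℕ (k !) ℚ.≤_) (sym (÷ℕ-cancel (falling y k) (k !) 1≤k!)) (multichoose-factorial k y 0≤B h))
    where
    1≤k! : 1 ≤ k !
    1≤k! = ℕₚ.1≤n! k

  -- ε will be 1 / (T * c + T * c), which is why the exponents in the last hypothesis have this shape.
  root-bound : ∀ T c p α β B → 1 ≤ T → 1 ≤ c → 1 ≤ p → 0ℚ ℚ.< B →
    α ^ T * p ≤ (p * p * β) ^ T →
    powℚ (fromℕ p) (T * c + T * c ∸ 1) ℚ.< powℚ B (T * c + T * c) →
    fromℕ α ℚ.≤ B ℚ.* B ℚ.* fromℕ β
  root-bound T c p α β B 1≤T 1≤c 1≤p 0<B bound B-large = ℚₚ.≮⇒≥ λ lt → absurd lt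
    where
    N : ℕ
    N = T * c
    1≤N : 1 ≤ N
    1≤N = ℕₚ.*-mono-≤ 1≤T 1≤c
    0≤B : 0ℚ ℚ.≤ B
    0≤B = ℚₚ.<⇒≤ 0<B
    0<p : 0ℚ ℚ.< fromℕ p
    0<p = 0<fromℕ 1≤p

    boundN : α ^ N * p ≤ (p * p * β) ^ N
    boundN = begin
      α ^ N * p ≡⟨ cong (α ^ N *_) (ℕₚ.*-identityʳ p) ⟨
      α ^ N * p ^ 1 ≤⟨ ℕₚ.*-monoʳ-≤ (α ^ N) (ℕₚ.^-monoʳ-≤ p {{>-nonZero 1≤p}} 1≤c) ⟩
      α ^ N * p ^ c ≡⟨ cong (_* p ^ c) (ℕₚ.^-*-assoc α T c) ⟨
      (α ^ T) ^ c * p ^ c ≡⟨ ^-distrib-* c (α ^ T) p ⟨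
      (α ^ T * p) ^ c ≤⟨ ℕₚ.^-monoˡ-≤ c bound ⟩
      ((p * p * β) ^ T) ^ c ≡⟨ ℕₚ.^-*-assoc (p * p * β) T c ⟩
      (p * p * β) ^ N ∎
      where open ℕₚ.≤-Reasoning

    -- One factor p is split off to cancel the gain p on the left, leaving p^(2N - 1); its
    -- comparison with B^(2N) is the inequality p^(1 - ε) < B for ε = 1 / (2N).
    p² : (p * p) ^ N ≡ p * p ^ (N + N ∸ 1)
    p² = trans (^-distrib-* N p p) (trans (sym (ℕₚ.^-distribˡ-+-* p N N)) (cong (p ^_) (sym (ℕₚ.m+[n∸m]≡n (ℕₚ.≤-trans 1≤N (ℕₚ.m≤m+n N N))))))

    αβ : 1 ≤ β → fromℕ p ℚ.* powℚ (fromℕ α) N ℚ.< fromℕ p ℚ.* powℚ (B ℚ.* B ℚ.* fromℕ β) N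
    αβ 1≤β = begin-strict
      fromℕ p ℚ.* powℚ (fromℕ α) N ≡⟨ trans (cong (fromℕ p ℚ.*_) (powℚ-fromℕ α N)) (trans (sym (fromℕ-* p (α ^ N))) (cong fromℕ (ℕₚ.*-comm p (α ^ N)))) ⟩
      fromℕ (α ^ N * p) ≤⟨ fromℕ-mono-≤ boundN ⟩
      fromℕ ((p * p * β) ^ N) ≡⟨ cong fromℕ (trans (^-distrib-* N (p * p) β) (trans (cong (_* β ^ N) p²) (ℕₚ.*-assoc p (p ^ (N + N ∸ 1)) (β ^ N)))) ⟩
      fromℕ (p * (p ^ (N + N ∸ 1) * β ^ N)) ≡⟨ trans (fromℕ-* p (p ^ (N + N ∸ 1) * β ^ N)) (cong (fromℕ p ℚ.*_) (trans (fromℕ-* (p ^ (N + N ∸ 1)) (β ^ N)) (cong₂ ℚ._*_ (sym (powℚ-fromℕ p (N + N ∸ 1))) (sym (powℚ-fromℕ β N))))) ⟩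
      fromℕ p ℚ.* (powℚ (fromℕ p) (N + N ∸ 1) ℚ.* powℚ (fromℕ β) N) <⟨ ℚₚ.*-monoʳ-<-pos (fromℕ p) {{ℚ.positive 0<p}} (ℚₚ.*-monoˡ-<-pos (powℚ (fromℕ β) N) {{ℚ.positive 0<βᴺ}} B-large) ⟩
      fromℕ p ℚ.* (powℚ B (N + N) ℚ.* powℚ (fromℕ β) N) ≡⟨ cong (λ t → fromℕ p ℚ.* (t ℚ.* powℚ (fromℕ β) N)) (trans (powℚ-+ B N N) (sym (powℚ-* B B N))) ⟩
      fromℕ p ℚ.* (powℚ (B ℚ.* B) N ℚ.* powℚ (fromℕ β) N) ≡⟨ cong (fromℕ p ℚ.*_) (powℚ-* (B ℚ.* B) (fromℕ β) N) ⟨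
      fromℕ p ℚ.* powℚ (B ℚ.* B ℚ.* fromℕ β) N ∎
      where
      open ℚₚ.≤-Reasoning
      0<βᴺ : 0ℚ ℚ.< powℚ (fromℕ β) N
      0<βᴺ = subst (0ℚ ℚ.<_) (sym (powℚ-fromℕ β N)) (0<fromℕ (ℕₚ.m^n>0 β {{>-nonZero 1≤β}} N))

    absurd : B ℚ.* B ℚ.* fromℕ β ℚ.< fromℕ α → ⊥
    absurd lt with 1 ≤? β
    ... | yes 1≤β = <⇒≱ℚ (αβ 1≤β) (*-monoˡ (ℚₚ.<⇒≤ 0<p) (powℚ-mono N (*-nonneg (*-nonneg 0≤B 0≤B) (0≤fromℕ β)) (ℚₚ.<⇒≤ lt)))
    -- When β = 0 strictness is lost in the division by β^N, but the integer bound then forces α = 0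
    -- directly.
    ... | no 1≰β = zero-case N 1≤N boundN (ℕₚ.n≤0⇒n≡0 (ℕₚ.≮⇒≥ 1≰β))
      where
      zero-case : ∀ N → 1 ≤ N → α ^ N * p ≤ (p * p * β) ^ N → β ≡ 0 → ⊥
      zero-case (suc N) _ le refl = α-pos (1 ≤? α)
        where
        α-pos : Dec (1 ≤ α) → ⊥
        α-pos (yes 1≤α) = ℕₚ.<⇒≱ (ℕₚ.*-mono-< (ℕₚ.m^n>0 α {{>-nonZero 1≤α}} (suc N)) 1≤p)
          (ℕₚ.≤-trans le (ℕₚ.≤-reflexive (cong (_* (p * p * 0) ^ N) (ℕₚ.*-zeroʳ (p * p)))))
        α-pos (no α≰) = <⇒≱ℚ lt (ℚₚ.≤-trans (fromℕ-mono-≤ (ℕₚ.≤-reflexive (ℕₚ.n≤0⇒n≡0 (ℕₚ.≮⇒≥ α≰)))) (*-nonneg (*-nonneg 0≤B 0≤B) (0≤fromℕ 0)))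

-- From the operator bound to the error in the subset count

module SubsetSums (q : ℕ) (prime : Prime (suc q)) where

  open ElementarySymmetric q prime public
  open RationalLemmas

  private
    norm : (F → ℤ) → ℚ
    norm u = fromℤ ‖ u ‖²

    0≤norm : ∀ u → 0ℚ ℚ.≤ norm u
    0≤norm u = fromℤ-mono-≤ (0≤‖‖² u)

  -- Norm of u at most κ₁ times the square root of G, squared so that no root is taken.
  Bounded : ℚ → (F → ℤ) → ℚ → Set
  Bounded G u κ₁ = fromℤ ‖ u ‖² ℚ.≤ κ₁ ℚ.* κ₁ ℚ.* G

  module _ (G : ℚ) (0≤G : 0ℚ ℚ.≤ G) where

    bounded-cong : ∀ {u v κ₁} → (∀ z → u z ≡ v z) → Bounded G u κ₁ → Bounded G v κ₁
    bounded-cong {u} {v} {κ₁} e = subst (λ t → fromℤ t ℚ.≤ κ₁ ℚ.* κ₁ ℚ.* G) (∑ᶻ.∑-cong λ z → cong₂ ℤ._*_ (e z) (e z))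

    bounded-neg : ∀ {u κ₁} → Bounded G u κ₁ → Bounded G (λ z → ℤ.- u z) κ₁
    bounded-neg {u} {κ₁} = subst (λ t → fromℤ t ℚ.≤ κ₁ ℚ.* κ₁ ℚ.* G) (∑ᶻ.∑-cong λ z → e (u z))
      where e : ∀ a → a ℤ.* a ≡ (ℤ.- a) ℤ.* (ℤ.- a)
            e = solve-∀ᶻ

    -- The triangle inequality in squared form; Cauchy-Schwarz bounds the mixed term.
    bounded-+ : ∀ {u v κ₁ κ₂} → 0ℚ ℚ.≤ κ₁ → 0ℚ ℚ.≤ κ₂ → Bounded G u κ₁ → Bounded G v κ₂ → Bounded G (λ z → u z ℤ.+ v z) (κ₁ ℚ.+ κ₂)
    bounded-+ {u} {v} {κ₁} {κ₂} 0≤κ₁ 0≤κ₂ Bu Bv = begin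
      norm (λ z → u z ℤ.+ v z) ≡⟨ cong fromℤ expand ⟩
      fromℤ (‖ u ‖² ℤ.+ ‖ v ‖² ℤ.+ (inner ℤ.+ inner)) ≡⟨ trans (fromℤ-+ (‖ u ‖² ℤ.+ ‖ v ‖²) (inner ℤ.+ inner)) (cong₂ ℚ._+_ (fromℤ-+ ‖ u ‖² ‖ v ‖²) (fromℤ-+ inner inner)) ⟩
      norm u ℚ.+ norm v ℚ.+ (fromℤ inner ℚ.+ fromℤ inner) ≤⟨ ℚₚ.+-mono-≤ (ℚₚ.+-mono-≤ Bu Bv) (ℚₚ.+-mono-≤ cross cross) ⟩
      κ₁ ℚ.* κ₁ ℚ.* G ℚ.+ κ₂ ℚ.* κ₂ ℚ.* G ℚ.+ (κ₁ ℚ.* κ₂ ℚ.* G ℚ.+ κ₁ ℚ.* κ₂ ℚ.* G) ≡⟨ solveℚ 3 (λ κ₁ κ₂ G → κ₁ :× κ₁ :× G :⊹ κ₂ :× κ₂ :× G :⊹ (κ₁ :× κ₂ :× G :⊹ κ₁ :× κ₂ :× G) :≡ (κ₁ :⊹ κ₂) :× (κ₁ :⊹ κ₂) :× G) refl κ₁ κ₂ G ⟩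
      (κ₁ ℚ.+ κ₂) ℚ.* (κ₁ ℚ.+ κ₂) ℚ.* G ∎
      where
      open ℚₚ.≤-Reasoning
      inner : ℤ
      inner = ∑′ λ z → u z ℤ.* v z
      expand : ‖ (λ z → u z ℤ.+ v z) ‖² ≡ ‖ u ‖² ℤ.+ ‖ v ‖² ℤ.+ (inner ℤ.+ inner)
      expand = trans (∑ᶻ.∑-cong λ z → e (u z) (v z)) (trans ∑ᶻ.∑-+ (cong₂ ℤ._+_ ∑ᶻ.∑-+ ∑ᶻ.∑-+))
        where e : ∀ a b → (a ℤ.+ b) ℤ.* (a ℤ.+ b) ≡ a ℤ.* a ℤ.+ b ℤ.* b ℤ.+ (a ℤ.* b ℤ.+ a ℤ.* b)
              e = solve-∀ᶻ
      cross : fromℤ inner ℚ.≤ κ₁ ℚ.* κ₂ ℚ.* G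
      cross = square-cancel (*-nonneg (*-nonneg 0≤κ₁ 0≤κ₂) 0≤G) (begin
        fromℤ inner ℚ.* fromℤ inner ≡⟨ fromℤ-* inner inner ⟨
        fromℤ (inner ℤ.* inner) ≤⟨ fromℤ-mono-≤ (cauchy-schwarzᶻ u v) ⟩
        fromℤ (‖ u ‖² ℤ.* ‖ v ‖²) ≡⟨ fromℤ-* ‖ u ‖² ‖ v ‖² ⟩
        norm u ℚ.* norm v ≤⟨ *-mono (*-nonneg (*-nonneg 0≤κ₁ 0≤κ₁) 0≤G) (0≤norm v) Bu Bv ⟩
        κ₁ ℚ.* κ₁ ℚ.* G ℚ.* (κ₂ ℚ.* κ₂ ℚ.* G) ≡⟨ solveℚ 3 (λ κ₁ κ₂ G → κ₁ :× κ₁ :× G :× (κ₂ :× κ₂ :× G) :≡ κ₁ :× κ₂ :× G :× (κ₁ :× κ₂ :× G)) refl κ₁ κ₂ G ⟩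
        κ₁ ℚ.* κ₂ ℚ.* G ℚ.* (κ₁ ℚ.* κ₂ ℚ.* G) ∎)

    bounded-cancel : ∀ {u κ₁} k → Bounded G (λ z → + suc k ℤ.* u z) (κ₁ ℚ.* fromℕ (suc k)) → Bounded G u κ₁
    bounded-cancel {u} {κ₁} k h = *-cancelˡ-pos (*-pos 0<k 0<k) (begin
      fromℕ (suc k) ℚ.* fromℕ (suc k) ℚ.* norm u ≡⟨ cong (ℚ._* norm u) (fromℤ-* (+ suc k) (+ suc k)) ⟨
      fromℤ (+ suc k ℤ.* + suc k) ℚ.* norm u ≡⟨ fromℤ-* (+ suc k ℤ.* + suc k) ‖ u ‖² ⟨
      fromℤ (+ suc k ℤ.* + suc k ℤ.* ‖ u ‖²) ≡⟨ cong fromℤ (trans (sym (∑ᶻ.∑-*ˡ (+ suc k ℤ.* + suc k))) (∑ᶻ.∑-cong λ z → e (+ suc k) (u z))) ⟩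
      norm (λ z → + suc k ℤ.* u z) ≤⟨ h ⟩
      κ₁ ℚ.* fromℕ (suc k) ℚ.* (κ₁ ℚ.* fromℕ (suc k)) ℚ.* G ≡⟨ solveℚ 3 (λ κ₁ k G → κ₁ :× k :× (κ₁ :× k) :× G :≡ k :× k :× (κ₁ :× κ₁ :× G)) refl κ₁ (fromℕ (suc k)) G ⟩
      fromℕ (suc k) ℚ.* fromℕ (suc k) ℚ.* (κ₁ ℚ.* κ₁ ℚ.* G) ∎)
      where
      open ℚₚ.≤-Reasoning
      0<k : 0ℚ ℚ.< fromℕ (suc k)
      0<k = 0<fromℕ {suc k} (s≤s z≤n)
      e : ∀ k a → k ℤ.* k ℤ.* (a ℤ.* a) ≡ k ℤ.* a ℤ.* (k ℤ.* a)
      e = solve-∀ᶻ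

  elementary-vanish : ∀ {n} (c : Fin n → F) k g z → n < k → elementary c k g z ≡ ℤ.0ℤ
  elementary-vanish {zero} c (suc k) g z _ = refl
  elementary-vanish {suc n} c (suc k) g z (s≤s n<k) = cong₂ ℤ._+_ (elementary-vanish (λ i → c (Fin.suc i)) (suc k) g z (ℕₚ.m<n⇒m<1+n n<k)) (elementary-vanish (λ i → c (Fin.suc i)) k g (z ⊖ c Fin.zero) n<k)

  value²≤norm : ∀ u b → u b ℤ.* u b ℤ.≤ ‖ u ‖²
  value²≤norm u b = subst (ℤ._≤ ‖ u ‖²) (trans (∑′-single mask b (λ x x≢b → off x (x ≟ᶠ b) x≢b)) (on (b ≟ᶠ b))) (∑ᶻ.∑-mono λ x → mask≤ x (x ≟ᶠ b))
    where
    select : ∀ {P : Set} → Dec P → ℤ → ℤ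
    select d i = if does d then i else ℤ.0ℤ
    mask : F → ℤ
    mask x = select (x ≟ᶠ b) (u x ℤ.* u x)
    mask≤ : ∀ x (d : Dec (x ≡ b)) → select d (u x ℤ.* u x) ℤ.≤ u x ℤ.* u x
    mask≤ x (yes _) = ℤₚ.≤-refl
    mask≤ x (no _) = 0≤i*i (u x)
    off : ∀ x (d : Dec (x ≡ b)) → x ≢ b → select d (u x ℤ.* u x) ≡ ℤ.0ℤ
    off x (yes e) ne = ⊥-elim (ne e)
    off x (no _) _ = refl
    on : (d : Dec (b ≡ b)) → select d (u b ℤ.* u b) ≡ u b ℤ.* u b
    on (yes _) = refl
    on (no ne) = ⊥-elim (ne refl)

  module _ (m : ℕ) (B : ℚ) (0≤B : 0ℚ ℚ.≤ B) where

    open PowerMap m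

    module _ (gap : ∀ u → ∑′ u ≡ ℤ.0ℤ → fromℕ (norm-ℕ (convolve π u)) ℚ.≤ B ℚ.* B ℚ.* fromℕ (norm-ℕ u)) where

      private
        c : Fin q → F
        c i = ι (+ (suc (toℕ i) ^ m))

        g : F → ℤ
        g z = + p ℤ.* delta z ℤ.- + 1

        G : ℚ
        G = norm g

        0≤G : 0ℚ ℚ.≤ G
        0≤G = 0≤norm g

        0≤mc : ∀ k → 0ℚ ℚ.≤ multichoose B k
        0≤mc k = multichoose-nonneg k 0≤B

        powerSum-bounded : ∀ {κ₁} j u → 1 ≤ j → j < p → ∑′ u ≡ ℤ.0ℤ → Bounded G u κ₁ → Bounded G (powerSum c j u) (κ₁ ℚ.* B)
        powerSum-bounded {κ₁} j u 1≤j j<p mz Bu = begin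
          norm (powerSum c j u) ≡⟨ cong fromℤ (trans (powerSum-norm m j j≢0 u) (sym (+norm-ℕ (convolve π u′)))) ⟩
          fromℕ (norm-ℕ (convolve π u′)) ≤⟨ gap u′ (trans (Reindexᶻ.∑-⊗ j≢0 u) mz) ⟩
          B ℚ.* B ℚ.* fromℕ (norm-ℕ u′) ≡⟨ cong (λ t → B ℚ.* B ℚ.* fromℤ t) (trans (+norm-ℕ u′) (Reindexᶻ.∑-⊗ j≢0 (λ y → u y ℤ.* u y))) ⟩
          B ℚ.* B ℚ.* norm u ≤⟨ *-monoˡ (*-nonneg 0≤B 0≤B) Bu ⟩
          B ℚ.* B ℚ.* (κ₁ ℚ.* κ₁ ℚ.* G) ≡⟨ solveℚ 3 (λ B κ₁ G → B :× B :× (κ₁ :× κ₁ :× G) :≡ κ₁ :× B :× (κ₁ :× B) :× G) refl B κ₁ G ⟩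
          κ₁ ℚ.* B ℚ.* (κ₁ ℚ.* B) ℚ.* G ∎
          where
          open ℚₚ.≤-Reasoning
          j≢0 : ι (+ j) ≢ 0ᶠ
          j≢0 = ι-nonzero j 1≤j j<p
          u′ : F → ℤ
          u′ y = u (ι (+ j) ⊗ y)

        -- The power sum applied to the k-th polynomial contributes B times the bound for index k,
        -- and the remaining alternating sum contributes k times that same bound by induction;
        -- together B + k, the recursion of `multichoose`. The condition j + k < p keeps all the
        -- dilations in the sum invertible.
        newton-bounded : ∀ k j → 1 ≤ j → j + k < p → (∀ l → l ≤ k → Bounded G (elementary c l g) (multichoose B l)) →
          Bounded G (newtonSum c j k g) (multichoose B (suc k) ℚ.* fromℕ (suc k))
        newton-bounded zero j 1≤j j<p B≤ = subst (Bounded G (newtonSum c j 0 g))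
          (sym (trans (multichoose-suc B 0) (cong (ℚ._*_ 1ℚ) (ℚₚ.+-identityʳ B))))
          (powerSum-bounded {multichoose B 0} j (elementary c 0 g) 1≤j (subst (_< p) (ℕₚ.+-identityʳ j) j<p) (elementary-mean-zero c 0 g mean-zero-centred) (B≤ 0 z≤n))
        newton-bounded (suc k) j 1≤j j+k<p B≤ = subst (Bounded G (newtonSum c j (suc k) g)) total
          (bounded-+ G 0≤G {powerSum c j (elementary c (suc k) g)} {λ z → ℤ.- newtonSum c (suc j) k g z}
            (*-nonneg (0≤mc (suc k)) 0≤B) (*-nonneg (0≤mc (suc k)) (0≤fromℕ (suc k)))
            (powerSum-bounded {multichoose B (suc k)} j (elementary c (suc k) g) 1≤j (ℕₚ.≤-<-trans (ℕₚ.m≤m+n j (suc k)) j+k<p)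
              (elementary-mean-zero c (suc k) g mean-zero-centred) (B≤ (suc k) ℕₚ.≤-refl))
            (bounded-neg G 0≤G {newtonSum c (suc j) k g} {multichoose B (suc k) ℚ.* fromℕ (suc k)}
              (newton-bounded k (suc j) (s≤s z≤n) (subst (_< p) (ℕₚ.+-suc j k) j+k<p) (λ l l≤k → B≤ l (ℕₚ.m≤n⇒m≤1+n l≤k)))))
          where
          total : multichoose B (suc k) ℚ.* B ℚ.+ multichoose B (suc k) ℚ.* fromℕ (suc k) ≡ multichoose B (suc (suc k)) ℚ.* fromℕ (suc (suc k))
          total = trans (sym (ℚₚ.*-distribˡ-+ (multichoose B (suc k)) B (fromℕ (suc k)))) (sym (multichoose-suc B (suc k)))

        -- The identity for index k + 1 uses all smaller indices; the extra bound `K` makes this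
        -- strong induction structural.
        elementary-bounded : ∀ K → K < p → ∀ k → k ≤ K → Bounded G (elementary c k g) (multichoose B k)
        elementary-bounded K K<p zero _ = ℚₚ.≤-reflexive (sym (ℚₚ.*-identityˡ G))
        elementary-bounded (suc K) K<p (suc k) (s≤s k≤K) = bounded-cancel G 0≤G {elementary c (suc k) g} {multichoose B (suc k)} k
          (bounded-cong G 0≤G {newtonSum c 1 k g} {λ z → + suc k ℤ.* elementary c (suc k) g z} {multichoose B (suc k) ℚ.* fromℕ (suc k)} (λ z → sym (newton c k g z))
            (newton-bounded k 1 ℕₚ.≤-refl (ℕₚ.≤-<-trans (s≤s k≤K) K<p)
              (λ l l≤k → elementary-bounded K (ℕₚ.<-trans (ℕₚ.n<1+n K) K<p) l (ℕₚ.≤-trans l≤k k≤K))))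

        G≤p² : G ℚ.≤ fromℕ p ℚ.* fromℕ p
        G≤p² = begin
          G ≡⟨ cong fromℤ norm-centred ⟩
          fromℕ (p * q) ≤⟨ fromℕ-mono-≤ (ℕₚ.*-monoʳ-≤ p (ℕₚ.n≤1+n q)) ⟩
          fromℕ (p * p) ≡⟨ fromℕ-* p p ⟩
          fromℕ p ℚ.* fromℕ p ∎
          where open ℚₚ.≤-Reasoning

        error : ℕ → F → ℚ
        error k b = fromℕ (Nstar p m k b) - (fromℕ (q C k) ÷ℕ p)

        0<p : 0ℚ ℚ.< fromℕ p
        0<p = 0<fromℕ {p} (s≤s z≤n)

        p*error : ∀ k b → error k b ℚ.* fromℕ p ≡ fromℤ (elementary c k g b)
        p*error k b = begin
          (fromℕ N - (fromℕ (q C k) ÷ℕ p)) ℚ.* fromℕ p ≡⟨ solveℚ 3 (λ N d p → (N :∸ d) :× p :≡ p :× N :∸ d :× p) refl (fromℕ N) (fromℕ (q C k) ÷ℕ p) (fromℕ p) ⟩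
          fromℕ p ℚ.* fromℕ N - (fromℕ (q C k) ÷ℕ p) ℚ.* fromℕ p ≡⟨ cong (fromℕ p ℚ.* fromℕ N -_) (÷ℕ-cancel (fromℕ (q C k)) p (s≤s z≤n)) ⟩
          fromℕ p ℚ.* fromℕ N - fromℕ (q C k) ≡⟨ cong₂ ℚ._+_ (sym (fromℤ-* (+ p) (+ N))) (sym (fromℤ-neg (+ (q C k)))) ⟩
          fromℤ (+ p ℤ.* + N) ℚ.+ fromℤ (ℤ.- + (q C k)) ≡⟨ fromℤ-+ (+ p ℤ.* + N) (ℤ.- + (q C k)) ⟨
          fromℤ (+ p ℤ.* + N ℤ.- + (q C k)) ≡⟨ cong (λ t → fromℤ (+ p ℤ.* t ℤ.- + (q C k))) (Nstar-elementary m k b) ⟩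
          fromℤ (+ p ℤ.* elementary c k delta b ℤ.- + (q C k)) ≡⟨ cong fromℤ (elementary-centred c k b) ⟨
          fromℤ (elementary c k g b) ∎
          where
          open ≡-Reasoning
          N : ℕ
          N = Nstar p m k b

        elementary-value : ∀ k b → Dec (k < p) →
          fromℤ (elementary c k g b) ℚ.* fromℤ (elementary c k g b) ℚ.≤ multichoose B k ℚ.* multichoose B k ℚ.* (fromℕ p ℚ.* fromℕ p)
        elementary-value k b (yes k<p) = begin
          fromℤ (elementary c k g b) ℚ.* fromℤ (elementary c k g b) ≡⟨ fromℤ-* (elementary c k g b) (elementary c k g b) ⟨
          fromℤ (elementary c k g b ℤ.* elementary c k g b) ≤⟨ fromℤ-mono-≤ (value²≤norm (elementary c k g) b) ⟩
          norm (elementary c k g) ≤⟨ elementary-bounded k k<p k ℕₚ.≤-refl ⟩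
          multichoose B k ℚ.* multichoose B k ℚ.* G ≤⟨ *-monoˡ (*-nonneg (0≤mc k) (0≤mc k)) G≤p² ⟩
          multichoose B k ℚ.* multichoose B k ℚ.* (fromℕ p ℚ.* fromℕ p) ∎
          where open ℚₚ.≤-Reasoning
        -- For k ≥ p there are only p - 1 translations, so the polynomial is identically 0.
        elementary-value k b (no k≮p) = subst (λ t → fromℤ t ℚ.* fromℤ t ℚ.≤ multichoose B k ℚ.* multichoose B k ℚ.* (fromℕ p ℚ.* fromℕ p))
          (sym (elementary-vanish c k g b (ℕₚ.≮⇒≥ k≮p)))
          (*-nonneg (*-nonneg (0≤mc k) (0≤mc k)) (*-nonneg (ℚₚ.<⇒≤ 0<p) (ℚₚ.<⇒≤ 0<p)))

      -- A single value is bounded by the norm, and the starting function has norm at most p; this p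
      -- cancels the p by which the error was multiplied.
      subset-sum-error : ∀ k b → ℚ.∣ fromℕ (Nstar p m k b) - (fromℕ (q C k) ÷ℕ p) ∣ ℚ.≤ multichoose B k
      subset-sum-error k b = square-cancel (0≤mc k) (descend (error k b) (fromℕ p) (multichoose B k) 0<p
          (subst (λ t → t ℚ.* t ℚ.≤ multichoose B k ℚ.* multichoose B k ℚ.* (fromℕ p ℚ.* fromℕ p)) (sym (p*error k b)) (elementary-value k b (k <? p))))
        where
        descend : ∀ x P μ → 0ℚ ℚ.< P → x ℚ.* P ℚ.* (x ℚ.* P) ℚ.≤ μ ℚ.* μ ℚ.* (P ℚ.* P) → ℚ.∣ x ∣ ℚ.* ℚ.∣ x ∣ ℚ.≤ μ ℚ.* μ
        descend x P μ 0<P h = *-cancelˡ-pos (*-pos 0<P 0<P) (begin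
          P ℚ.* P ℚ.* (ℚ.∣ x ∣ ℚ.* ℚ.∣ x ∣) ≡⟨ cong (P ℚ.* P ℚ.*_) (∣∣-square x) ⟩
          P ℚ.* P ℚ.* (x ℚ.* x) ≡⟨ solveℚ 2 (λ p x → p :× p :× (x :× x) :≡ x :× p :× (x :× p)) refl P x ⟩
          x ℚ.* P ℚ.* (x ℚ.* P) ≤⟨ h ⟩
          μ ℚ.* μ ℚ.* (P ℚ.* P) ≡⟨ ℚₚ.*-comm (μ ℚ.* μ) (P ℚ.* P) ⟩
          P ℚ.* P ℚ.* (μ ℚ.* μ) ∎)
          where open ℚₚ.≤-Reasoning

-- Choice of ε and conclusion

open RationalLemmas

numerator<denominator : ∀ r → 0ℚ ℚ.≤ r → r ℚ.< 1ℚ → ℤ.∣ ℚ.↥ r ∣ < ℚ.↧ₙ r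
numerator<denominator (ℚ.mkℚ (+ a) d _) _ (ℚ.*<* lt) =
  ℤₚ.drop‿+<+ (subst₂ ℤ._<_ (ℤₚ.*-identityʳ (+ a)) (ℤₚ.*-identityˡ (+ suc d)) lt)
numerator<denominator (ℚ.mkℚ -[1+ a ] d _) (ℚ.*≤* ()) _

unitFraction : ℕ → ℚ
unitFraction e = ℚ.mkℚ (+ 1) e (Data.Nat.Coprimality.1-coprimeTo (suc e))

unitFraction-pos : ∀ e → 0ℚ ℚ.< unitFraction e
unitFraction-pos e = ℚₚ.positive⁻¹ (unitFraction e)

unitFraction< : ∀ e δ → 0ℚ ℚ.< δ → ℚ.↧ₙ δ ≤ e → unitFraction e ℚ.< δ
unitFraction< e (ℚ.mkℚ (+ zero) d _) (ℚ.*<* (ℤ.+<+ ())) _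
unitFraction< e (ℚ.mkℚ (+ suc a) d _) _ d<e = ℚ.*<* (subst₂ ℤ._<_ (sym (ℤₚ.*-identityˡ (+ suc d))) (ℤₚ.pos-* (suc a) (suc e))
  (ℤ.+<+ (ℕₚ.<-≤-trans (s≤s d<e) (ℕₚ.m≤n*m (suc e) (suc a)))))
unitFraction< e (ℚ.mkℚ -[1+ a ] d _) (ℚ.*<* ()) _

consecutive-coprime : ∀ e → Data.Nat.Coprimality.Coprime e (suc e)
consecutive-coprime e {i} (d∣e , d∣1+e) = Data.Nat.Divisibility.∣1⇒≡1 (Data.Nat.Divisibility.∣m+n∣m⇒∣n (subst (i Data.Nat.Divisibility.∣_) (ℕₚ.+-comm 1 e) d∣1+e) d∣e)

-- Real powers are encoded through the numerator and denominator in lowest terms, so the reduced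
-- form e / (e + 1) has to be exhibited exactly.
1-unitFraction : ∀ e → 1ℚ - unitFraction e ≡ ℚ.mkℚ (+ e) e (consecutive-coprime e)
1-unitFraction e = ℚₚ.toℚᵘ-injective (begin
  ℚ.toℚᵘ (1ℚ - unitFraction e) ≈⟨ ℚₚ.toℚᵘ-homo-+ 1ℚ (ℚ.- unitFraction e) ⟩
  ℚᵘ.mkℚᵘ (+ 1) 0 ℚᵘ.+ ℚᵘ.mkℚᵘ -[1+ 0 ] e ≈⟨ ℚᵘ.*≡* (trans (eq (+ e)) (cong (λ t → + e ℤ.* + t) (sym (ℕₚ.*-identityˡ (suc e))))) ⟩
  ℚᵘ.mkℚᵘ (+ e) e ∎)
  where
  open import Relation.Binary.Reasoning.Setoid ℚᵘₚ.≃-setoid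
  eq : ∀ e → (+ 1 ℤ.* (+ 1 ℤ.+ e) ℤ.+ ℤ.- + 1 ℤ.* + 1) ℤ.* (+ 1 ℤ.+ e) ≡ e ℤ.* (+ 1 ℤ.+ e)
  eq = solve-∀ᶻ

-- This is (m - 1)(k - 1) ≥ 0 without subtraction.
k+m≤mk+1 : ∀ m k → 1 ≤ m → 1 ≤ k → k + m ≤ m * k + 1
k+m≤mk+1 (suc m) (suc k) _ _ = subst (suc k + suc m ≤_) (e m k) (ℕₚ.m≤m+n (suc k + suc m) (m * k))
  where e : ∀ m k → (1 + k) + (1 + m) + m * k ≡ (1 + m) * (1 + k) + 1
        e = solve-∀

-- With B = y - (mk - m) the requirement B + k - 1 ≤ y reads k - 1 ≤ m (k - 1). It can fail at k =
-- 0, where both sides of the conclusion are 1.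
multichoose≤binom-shifted : ∀ m k y → 1 ≤ m → 0ℚ ℚ.≤ y - (fromℕ (m * k) - fromℕ m) →
  multichoose (y - (fromℕ (m * k) - fromℕ m)) k ℚ.≤ binomℚ y k
multichoose≤binom-shifted m zero y 1≤m _ = ℚₚ.≤-refl
multichoose≤binom-shifted m (suc k) y 1≤m 0≤z = multichoose≤binom (suc k) y 0≤z
    (subst (y - (fromℕ (m * suc k) - fromℕ m) ℚ.+ fromℕ (suc k) ℚ.≤_) (cancel y (fromℕ (m * suc k)) (fromℕ m))
      (ℚₚ.+-monoʳ-≤ (y - (fromℕ (m * suc k) - fromℕ m)) k≤))
  where
  cancel : ∀ y a b → y - (a - b) ℚ.+ (a ℚ.+ 1ℚ - b) ≡ y ℚ.+ 1ℚ
  cancel = solveℚ 3 (λ y a b → y :∸ (a :∸ b) :⊹ (a :⊹ conℚ 1ℚ :∸ b) :≡ y :⊹ conℚ 1ℚ) refl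
  k≤ : fromℕ (suc k) ℚ.≤ fromℕ (m * suc k) ℚ.+ 1ℚ - fromℕ m
  k≤ = subst₂ ℚ._≤_ (add-sub (fromℕ (suc k)) (fromℕ m)) refl
    (ℚₚ.+-monoˡ-≤ (ℚ.- fromℕ m) (subst₂ ℚ._≤_ (fromℕ-+ (suc k) m) (fromℕ-+ (m * suc k) 1) (fromℕ-mono-≤ (k+m≤mk+1 m (suc k) 1≤m (s≤s z≤n)))))
    where
    add-sub : ∀ a b → a ℚ.+ b ℚ.+ ℚ.- b ≡ a
    add-sub = solveℚ 2 (λ a b → a :⊹ b :⊹ :⊝ b :≡ a) refl

module _ (d c : ℕ) (1≤d : 1 ≤ d) (1≤c : 1 ≤ c) where

  private
    N : ℕ
    N = gapT d * c

  -- The denominator of ε is one more, namely 2 T c: T is the power in which the saving is a factor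
  -- p, the 2 comes from squared norms, and c pushes ε below δ.
  epsilonDenominator : ℕ
  epsilonDenominator = N + N ∸ 1

  1≤gapT : 1 ≤ gapT d
  1≤gapT = ℕₚ.*-mono-≤ {1} {gapJ d} {1} {2 ^ (gapJ d + gapJ d)} (ℕₚ.≤-trans (ℕₚ.*-mono-≤ {1} {d} {1} {suc (gapC d)} 1≤d (s≤s z≤n)) (ℕₚ.m≤m+n (gapR d) (gapR d))) (ℕₚ.m^n>0 2 (gapJ d + gapJ d))

  private
    c≤N : c ≤ N
    c≤N = ℕₚ.m≤n*m c (gapT d) {{>-nonZero 1≤gapT}}

    1≤N : 1 ≤ N
    1≤N = ℕₚ.≤-trans 1≤c c≤N

  suc-epsilonDenominator : suc epsilonDenominator ≡ N + N
  suc-epsilonDenominator = ℕₚ.m+[n∸m]≡n (ℕₚ.≤-trans 1≤N (ℕₚ.m≤m+n N N))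

  c≤epsilonDenominator : c ≤ epsilonDenominator
  c≤epsilonDenominator = ℕₚ.≤-pred (subst (suc c ≤_) (sym suc-epsilonDenominator) (ℕₚ.≤-trans (ℕₚ.+-mono-≤ 1≤N c≤N) ℕₚ.≤-refl))

  subset-sum-bound : ∀ p m k (b : Fin p) → Prime p → 1 ≤ m → m ^ d < p ^ (d ∸ 1) → ∀ z → 0ℚ ℚ.< z →
    powℚ (fromℕ p) epsilonDenominator ℚ.< powℚ z (suc epsilonDenominator) →
    ℚ.∣ fromℕ (Nstar p m k b) - (fromℕ ((p ∸ 1) C k) ÷ℕ p) ∣ ℚ.≤ multichoose z k
  subset-sum-bound (suc q) m k b pr 1≤m m-small z 0<z z-large =
      subset-sum-error m z (ℚₚ.<⇒≤ 0<z) gap k b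
    where
    open SubsetSums q pr
    gap : ∀ u → ∑′ u ≡ ℤ.0ℤ → fromℕ (norm-ℕ (convolve (PowerMap.π m) u)) ℚ.≤ z ℚ.* z ℚ.* fromℕ (norm-ℕ u)
    gap u mz = root-bound (gapT d) c p (norm-ℕ (convolve (PowerMap.π m) u)) (norm-ℕ u) z 1≤gapT 1≤c (s≤s z≤n) 0<z
      (power-sum-bound m d 1≤m 1≤d m-small u mz)
      (subst (λ t → powℚ (fromℕ p) epsilonDenominator ℚ.< powℚ z t) suc-epsilonDenominator z-large)

theorem1p1 : ∀ (δ : ℚ) → 0ℚ <ℚ δ → δ <ℚ 1ℚ →
    ∃ λ (ε : ℚ) → (0ℚ <ℚ ε) × (ε <ℚ δ) ×
    (∀ (p m k : ℕ) (b : Fin p) → Prime p → 2 < p → 1 ≤ m → NatLtRpow m p (1ℚ - δ) →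
    AbsLeBinomRpow (fromℕ (Nstar p m k b) - (fromℕ ((p ∸ 1) C k) ÷ℕ p)) p (1ℚ - ε) (fromℕ (m * k) - fromℕ m) k)
theorem1p1 δ 0<δ δ<1 = ε , unitFraction-pos e , unitFraction< e δ 0<δ (c≤epsilonDenominator d c 1≤d 1≤c) ,
    λ p m k b pr 2<p 1≤m m-small y (0<z , z-large) → ℚₚ.≤-trans
      (subset-sum-bound d c 1≤d 1≤c p m k b pr 1≤m (m-bound p m 2<p m-small) (y - (fromℕ (m * k) - fromℕ m)) 0<z
        (subst (λ r → powℚ (fromℕ p) ℤ.∣ ℚ.↥ r ∣ ℚ.< powℚ (y - (fromℕ (m * k) - fromℕ m)) (ℚ.↧ₙ r)) (1-unitFraction e) z-large))
      (multichoose≤binom-shifted m k y 1≤m (ℚₚ.<⇒≤ 0<z))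
  where
  r : ℚ
  r = 1ℚ - δ
  d c e : ℕ
  -- Since 1 - δ is below 1 its numerator is at most d - 1, which gives m^d < p^(d - 1). As c is the
  -- denominator of δ, δ ≥ 1 / c exceeds ε.
  d = ℚ.↧ₙ r
  c = ℚ.↧ₙ δ
  1≤d : 1 ≤ d
  1≤d = s≤s z≤n
  1≤c : 1 ≤ c
  1≤c = s≤s z≤n
  e = epsilonDenominator d c 1≤d 1≤c
  ε : ℚ
  ε = unitFraction e
  0≤r : 0ℚ ℚ.≤ r
  0≤r = ℚₚ.<⇒≤ (subst (ℚ._< r) (ℚₚ.+-inverseʳ δ) (ℚₚ.+-monoˡ-< (ℚ.- δ) δ<1))
  r<1 : r ℚ.< 1ℚ
  r<1 = subst (r ℚ.<_) (ℚₚ.+-identityʳ 1ℚ) (ℚₚ.+-monoʳ-< 1ℚ (ℚₚ.neg-antimono-< 0<δ))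
  m-bound : ∀ p m → 2 < p → NatLtRpow m p r → m ^ d < p ^ (d ∸ 1)
  m-bound p m 2<p lt = ℕₚ.<-≤-trans lt (ℕₚ.^-monoʳ-≤ p {{>-nonZero (ℕₚ.<-trans (s≤s z≤n) 2<p)}} (ℕₚ.≤-pred (numerator<denominator r 0≤r r<1)))
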